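{- Let $A, B > 0$ be real constants and let $(R_L)_{L\geq0}$ be a sequence of Lebesgue measurable subsets of $[0,1)$ such that for every $L$, $\mathbb{P}(R_L) \geq B^{ -L}$ and $R_L$ is a disjoint union of at most $A^L$ intervals. Then for almost all $\alpha \in [0,1)$ and every $\eta > 0$, there are infinitely many $L$ for which there exists a positive integer $h_L$ with $$h_L \leq (1+\eta)^L \frac{1}{\mathbb{P}(R_L)} \qquad\text{and}\qquad \{h_L \alpha\} \in R_L.$$
   Context: $\mathbb{P}$ denotes one-dimensional Lebesgue measure; $\{x\}$ denotes the fractional part of a real number $x$. -}

module Defs where

open import Algebra.Bundles using (CommutativeRing; Semiring)
import Algebra.Definitions.RawSemiring as RawSemiringOps
import Algebra.Properties.Monoid.Sum as MonoidSum
import Algebra.Properties.Ring as RingProperties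
open import Data.Fin.Base using (Fin; toℕ)
open import Data.Integer.Base using (ℤ; +_; -[1+_])
open import Data.Nat.Base as ℕ using (ℕ; zero; suc)
open import Data.Product.Base using (_×_; _,_; proj₁; proj₂; ∃; ∃₂)
open import Data.Sum.Base using (inj₁; inj₂)
open import Level using (0ℓ)
open import Relation.Binary.Core using (Rel)
import Relation.Binary.Construct.NonStrictToStrict as NonStrictToStrict
open import Relation.Binary.PropositionalEquality.Core using (_≢_)
open import Relation.Binary.Structures using (IsTotalOrder)
open import Relation.Nullary.Negation.Core using (¬_)
open import Relation.Unary using (Pred; _∈_; _⊆_; _≐_; _∩_; _∖_; _⊥_; Satisfiable; ⋃)

module Bounds {A : Set} (_≤_ : Rel A 0ℓ) where
  UpperBound LowerBound : Pred A 0ℓ → Pred A 0ℓ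
  UpperBound P u = ∀ x → x ∈ P → x ≤ u
  LowerBound P l = ∀ x → x ∈ P → l ≤ x

  IsSupremum IsInfimum : Pred A 0ℓ → Pred A 0ℓ
  IsSupremum P s = s ∈ UpperBound P × (∀ u → u ∈ UpperBound P → s ≤ u)
  IsInfimum  P i = i ∈ LowerBound P × (∀ l → l ∈ LowerBound P → l ≤ i)

-- The real numbers, axiomatised as a Dedekind-complete ordered field.
-- Under excluded middle these axioms determine ℝ up to unique isomorphism.
-- Equality is a setoid equality, so that constructions by Cauchy sequences or
-- cuts are instances.
record CompleteOrderedField : Set₁ where
  field
    commutativeRing : CommutativeRing 0ℓ 0ℓ

  open CommutativeRing commutativeRing public
    hiding (zero; _≉_)

  infix  4 _≤_
  infix  9 _⁻¹
  field
    _≤_          : Rel Carrier 0ℓ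
    isTotalOrder : IsTotalOrder _≈_ _≤_
    +-monoˡ-≤    : ∀ {x y} z → x ≤ y → x + z ≤ y + z
    *-nonNeg     : ∀ {x y} → 0# ≤ x → 0# ≤ y → 0# ≤ x * y
    0≉1          : ¬ (0# ≈ 1#)
    -- A total operation whose value at 0 is unspecified.
    _⁻¹          : Carrier → Carrier
    ⁻¹-cong      : ∀ {x y} → x ≈ y → x ⁻¹ ≈ y ⁻¹
    *-inverseʳ   : ∀ x → ¬ (x ≈ 0#) → x * x ⁻¹ ≈ 1#

  open Bounds _≤_ public

  field
    supremum : (P : Pred Carrier 0ℓ) → Satisfiable P → Satisfiable (UpperBound P) →
               ∃ (IsSupremum P)

  infimum : (P : Pred Carrier 0ℓ) → Satisfiable P → Satisfiable (LowerBound P) →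
            ∃ (IsInfimum P)
  infimum P (p , p∈P) bounded
    with s , s-upper , s-least ← supremum (LowerBound P) bounded
                                   (p , λ l l-lower → l-lower p p∈P)
    = s , (λ x x∈P → s-least x λ l l-lower → l-lower x x∈P) , s-upper

  open IsTotalOrder isTotalOrder public
    using (total; antisym; ≤-respˡ-≈; ≤-respʳ-≈)
    renaming (refl to ≤-refl; reflexive to ≤-reflexive; trans to ≤-trans)

  open NonStrictToStrict _≈_ _≤_ public using (_<_)

  open RawSemiringOps (Semiring.rawSemiring semiring) public
    using (_^_; sum) renaming (_×_ to _·_)

  fromℕ : ℕ → Carrier
  fromℕ n = n · 1#

  fromℤ : ℤ → Carrier
  fromℤ (+ n)    = fromℕ n
  fromℤ -[1+ n ] = - fromℕ (suc n)

module UnitInterval (ℝ : CompleteOrderedField) where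
  open CompleteOrderedField ℝ

  Subset : Set₁
  Subset = Pred Carrier 0ℓ

  [0,1⟩ : Subset
  [0,1⟩ x = 0# ≤ x × x < 1#

  -- y is the fractional part of x.
  IsFractionalPart : Carrier → Carrier → Set
  IsFractionalPart x y = y ∈ [0,1⟩ × ∃ λ k → x ≈ fromℤ k + y

  -- Arbitrary intervals: open, closed or half-open, possibly degenerate.
  IsInterval : Subset → Set
  IsInterval I = ∀ {x y z} → x ∈ I → z ∈ I → x ≤ y → y ≤ z → y ∈ I

  -- The bound is real, since it will be a power of a real number.
  IsDisjointUnionOfIntervals≤ : Carrier → Subset → Set₁
  IsDisjointUnionOfIntervals≤ N S =
    ∃₂ λ (n : ℕ) (I : Fin n → Subset) →
      fromℕ n ≤ N ×
      (∀ i → IsInterval (I i)) ×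
      (∀ i j → i ≢ j → I i ⊥ I j) ×
      S ≐ ⋃ (Fin n) I

  -- S has a countable cover by open intervals (aₙ , bₙ), with aₙ ≤ bₙ, of
  -- total length at most t; aₙ = bₙ gives the empty interval.
  CoverableWithin : Subset → Subset
  CoverableWithin S t =
    ∃₂ λ (a b : ℕ → Carrier) →
      (∀ n → a n ≤ b n) ×
      (∀ x → x ∈ S → ∃ λ n → a n < x × x < b n) ×
      (∀ n → sum {n} (λ i → b (toℕ i) - a (toℕ i)) ≤ t)

  private
    open RingProperties ring
      using (-‿distribˡ-*; -‿involutive)

    0≤1 : 0# ≤ 1#
    0≤1 with total 0# 1#
    ... | inj₁ 0≤1 = 0≤1
    ... | inj₂ 1≤0 = ≤-respʳ-≈ [-1]²≈1 (*-nonNeg 0≤-1 0≤-1)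
      where
      0≤-1 : 0# ≤ - 1#
      0≤-1 = ≤-respˡ-≈ (-‿inverseʳ 1#) (≤-respʳ-≈ (+-identityˡ (- 1#)) (+-monoˡ-≤ (- 1#) 1≤0))
      [-1]²≈1 : - 1# * - 1# ≈ 1#
      [-1]²≈1 = trans (sym (-‿distribˡ-* 1# (- 1#)))
                  (trans (-‿cong (*-identityˡ (- 1#))) (-‿involutive 1#))

    -1≤0 : - 1# ≤ 0#
    -1≤0 = ≤-respˡ-≈ (+-identityˡ (- 1#)) (≤-respʳ-≈ (-‿inverseʳ 1#) (+-monoˡ-≤ (- 1#) 0≤1))

    -1≉0 : ¬ (- 1# ≈ 0#)
    -1≉0 -1≈0 = 0≉1 (trans (sym (-‿inverseʳ 1#)) (trans (+-congˡ -1≈0) (+-identityʳ 1#)))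

    0≤1--1 : 0# ≤ 1# - - 1#
    0≤1--1 = ≤-respˡ-≈ (-‿inverseʳ (- 1#)) (+-monoˡ-≤ (- - 1#) (≤-trans -1≤0 0≤1))

    unitCoverable : (S : Subset) → Satisfiable (CoverableWithin (S ∩ [0,1⟩))
    unitCoverable S = 1# - - 1# , a , b , a≤b , covers , short
      where
      a b : ℕ → Carrier
      a zero    = - 1#
      a (suc _) = 0#
      b zero    = 1#
      b (suc _) = 0#
      a≤b : ∀ n → a n ≤ b n
      a≤b zero    = ≤-trans -1≤0 0≤1
      a≤b (suc _) = ≤-refl
      covers : ∀ x → x ∈ S ∩ [0,1⟩ → ∃ λ n → a n < x × x < b n
      covers x (_ , 0≤x , x<1) = 0 , (≤-trans -1≤0 0≤x , -1≉x) , x<1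
        where
        -1≉x : ¬ (- 1# ≈ x)
        -1≉x -1≈x = -1≉0 (antisym -1≤0 (≤-respʳ-≈ (sym -1≈x) 0≤x))
      short : ∀ n → sum {n} (λ i → b (toℕ i) - a (toℕ i)) ≤ 1# - - 1#
      short zero    = 0≤1--1
      short (suc n) = ≤-reflexive (trans (+-congˡ zeros) (+-identityʳ _))
        where
        open MonoidSum +-monoid using (sum-cong-≋; sum-replicate-zero)
        zeros : sum {n} (λ _ → 0# - 0#) ≈ 0#
        zeros = trans (sum-cong-≋ {n} λ _ → -‿inverseʳ 0#) (sum-replicate-zero n)

    0-lowerBound : (S : Subset) → 0# ∈ LowerBound (CoverableWithin S)
    0-lowerBound S t (_ , _ , _ , _ , short) = short 0

  -- Lebesgue outer measure restricted to [0,1).  Intersecting with [0,1) makes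
  -- the infimum finite for every S; for S ⊆ [0,1) it has no other effect.
  ℙ-infimum : (S : Subset) → ∃ (IsInfimum (CoverableWithin (S ∩ [0,1⟩)))
  ℙ-infimum S = infimum _ (unitCoverable S) (0# , 0-lowerBound (S ∩ [0,1⟩))

  ℙ : Subset → Carrier
  ℙ S = proj₁ (ℙ-infimum S)

  -- Carathéodory's criterion; for E ⊆ [0,1), test sets inside [0,1) suffice.
  IsMeasurable : Subset → Set₁
  IsMeasurable E = ∀ (T : Subset) → ℙ T ≈ ℙ (T ∩ E) + ℙ (T ∖ E)

  ForAlmostAll : Subset → Set
  ForAlmostAll Q = ℙ ([0,1⟩ ∖ Q) ≈ 0#

  InfinitelyMany : Pred ℕ 0ℓ → Set
  InfinitelyMany Q = ∀ N → ∃ λ L → N ℕ.≤ L × Q L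

{-# OPTIONS --safe #-}

-- For the multiples h take the primes p ≤ H = (1+η)^L / ℙ(R): by Chebyshev
-- there are at least H / O(L) of them.  Fix L, let f = 1_R - ℙ(R), and let
-- P_p be the projection onto functions of period 1/p.  For p ≠ q, translating
-- α by multiples of 1/q and of 1/p shows that f(pα) and f(qα) have the same
-- correlation as (P_q f)(pα) and (P_p f)(qα), so the variance of Σ_p f(pα)
-- over K primes is at most K (‖f‖² + Σ_p ‖P_p f‖²).  The P_p commute, which
-- gives Σ_p ‖P_p f‖² ≤ k ‖f‖² + Σ ‖P_{p₁} ⋯ P_{p_{k+1}} f‖², and each factor
-- divides the period and the variation by p; as R has at most A^L pieces, the
-- last sum is negligible once k is a large multiple of L.  By Chebyshev's
-- inequality the set of α for which no pα falls into R then has measure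
-- O(L²) (1+η)^(-L).  This tends to 0, so for fixed η the set of α which are
-- bad for all large L is null.
--
-- All sets are replaced by unions of cells of a grid fine enough that the
-- integrals are finite sums; outer measure enters only through explicit
-- covers, and constant factors are immaterial.
module Submission where

open import Defs
import Algebra.Properties.AbelianGroup as AbelianGroupProperties
import Algebra.Properties.Monoid.Mult as MonoidMult
import Algebra.Properties.Ring as RingProperties
import Algebra.Properties.Semiring.Exp as SemiringExp
import Algebra.Properties.Semiring.Mult as SemiringMult
import Algebra.Properties.Semiring.Sum as SemiringSum
import Algebra.Solver.Ring
open import Algebra.Solver.Ring.AlmostCommutativeRing using (fromCommutativeRing; _-Raw-AlmostCommutative⟶_)
open import Axiom.ExcludedMiddle using (ExcludedMiddle)
open import Data.Empty using (⊥)
open import Data.Fin.Base using (Fin; toℕ; fromℕ<)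
open import Data.Fin.Permutation using (permutation)
import Data.Fin.Properties as Finₚ
open import Data.Integer.Base as ℤ using (ℤ; -[1+_]; _⊖_)
import Data.Integer.Properties as ℤₚ
open import Data.List.Base using (List; []; _∷_; length; applyUpTo)
open import Data.List.Relation.Unary.All as All using (All; []; _∷_)
import Data.List.Relation.Unary.All.Properties as Allₚ
open import Data.List.Relation.Unary.AllPairs using (AllPairs; []; _∷_)
open import Data.List.Relation.Unary.Any using (Any; here; there)
import Data.List.Relation.Unary.Any.Properties as Anyₚ
open import Data.Maybe.Base using (Maybe; just; nothing)
open import Data.Nat.Base as ℕ using (ℕ; zero; suc; z≤n; s≤s; _!; NonZero; >-nonZero; nonTrivial⇒nonZero; nonTrivial⇒n>1; n>1⇒nonTrivial)
open import Data.Nat.Coprimality as Coprime using (Coprime; coprime-divisor; coprime-Bézout; prime⇒coprime)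
open import Data.Nat.DivMod using (_/_; _%_; m≡m%n+[m/n]*n; m%n<n; [m+kn]%n≡m%n; [m+n]%n≡m%n; m*n/n≡m; +-distrib-/-∣ʳ; m*[n/m]≡n; m/n/o≡m/[n*o]; m/n*n≤m; m<n⇒m%n≡m; m<n⇒m/n≡0; n%n≡0; %-distribˡ-*; m%n%n≡m%n)
open import Data.Nat.Divisibility using (_∣_; divides; _∣?_; _∣0; 1∣_; ∣-trans; ∣⇒≤; m∣m*n; n∣m*n; *-monoʳ-∣; m≤n⇒m!∣n!)
open import Data.Nat.GCD using (module Bézout)
open import Data.Nat.Induction using (<-rec)
open import Data.Nat.ListAction using (product)
open import Data.Nat.Primality using (Prime; prime?; ¬prime[0]; prime⇒nonTrivial; prime⇒nonZero; prime⇒irreducible)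
open import Data.Nat.Primality.Factorisation using (factorise)
import Data.Nat.Properties as ℕₚ
open import Data.Nat.Tactic.RingSolver using (solve-∀)
open import Data.Product.Base using (_×_; _,_; proj₁; proj₂; ∃; ∃₂; Σ)
open import Data.Sum.Base using (_⊎_; inj₁; inj₂)
open import Data.Unit.Base using (⊤; tt)
open import Level using (0ℓ)
open import Relation.Binary.Bundles using (Poset)
open import Relation.Binary.PropositionalEquality as ≡ using (_≡_; cong; cong₂; subst)
import Relation.Binary.Reasoning.PartialOrder
import Relation.Binary.Reasoning.Setoid
open import Relation.Binary.Structures using (IsTotalOrder)
open import Relation.Nullary.Decidable.Core using (Dec; yes; no)
open import Relation.Nullary.Negation.Core using (¬_; contradiction)
open import Relation.Unary using (_∈_; _⊆_; _∩_; _∖_)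

-- In Fourier terms P_p keeps the frequencies divisible by p, and `f(pα)` and `f(qα)` interact only
-- through the frequencies ql and pl of f. Primes are pairwise coprime and still so frequent that
-- restricting h to them costs only a factor O(L). The obstacle is that R may itself be nearly
-- periodic: if R has period 1/p, then P_p f = f and the correlations with `f(pα)` gain nothing.
-- This can happen for several primes at once, but not for many. A non-zero frequency with more than
-- k prime factors is huge, and a union of few intervals has little mass there; frequency 0 is
-- removed by subtracting ℙ(R). The last sum is small because Σ 1/p² < 1: the products of k+1
-- distinct factors 1/p² add up to at most (Σ 1/p²)^(k+1). This geometric decay has to beat A^(2L),
-- from the squared variation, and B^L, from the comparison with ℙ(R); so k is linear in L. That is
-- one factor of L²; the other is log H, from the density of the primes. The uncountably many η are
-- reduced to η = 1/(k+1), since the condition on h weakens as η grows.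

module PrimeCounting where

  open import Data.Nat.Combinatorics using (_C_; nCk+nC[k+1]≡[n+1]C[k+1]; nC1≡n; k>n⇒nCk≡0)
  open import Data.Nat.Properties

  -- Binomial coefficients and common multiples

  [k+1]*[n+1]C[k+1]≡[n+1]*nCk : ∀ n k → suc k ℕ.* (suc n C suc k) ≡ suc n ℕ.* (n C k)
  [k+1]*[n+1]C[k+1]≡[n+1]*nCk zero zero = ≡.refl
  [k+1]*[n+1]C[k+1]≡[n+1]*nCk zero (suc k) = begin
    suc (suc k) ℕ.* (1 C suc (suc k)) ≡⟨ cong (suc (suc k) ℕ.*_) (k>n⇒nCk≡0 {1} {suc (suc k)} (s≤s (s≤s z≤n))) ⟩
    suc (suc k) ℕ.* 0                 ≡⟨ *-zeroʳ (suc (suc k)) ⟩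
    0                                 ≡⟨ cong (1 ℕ.*_) (k>n⇒nCk≡0 {0} {suc k} (s≤s z≤n)) ⟨
    1 ℕ.* (0 C suc k)                 ∎
    where open ≡.≡-Reasoning
  [k+1]*[n+1]C[k+1]≡[n+1]*nCk (suc n) zero = begin
    1 ℕ.* (suc (suc n) C 1)  ≡⟨ *-identityˡ _ ⟩
    suc (suc n) C 1          ≡⟨ nC1≡n (suc (suc n)) ⟩
    suc (suc n)              ≡⟨ *-identityʳ _ ⟨
    suc (suc n) ℕ.* 1        ∎
    where open ≡.≡-Reasoning
  [k+1]*[n+1]C[k+1]≡[n+1]*nCk (suc n) (suc k) = begin
    suc (suc k) ℕ.* (suc (suc n) C suc (suc k)) ≡⟨ cong (suc (suc k) ℕ.*_) (nCk+nC[k+1]≡[n+1]C[k+1] (suc n) (suc k)) ⟨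
    suc (suc k) ℕ.* (c ℕ.+ c′)                  ≡⟨ expand k c c′ ⟩
    suc k ℕ.* c ℕ.+ c ℕ.+ suc (suc k) ℕ.* c′    ≡⟨ cong₂ (λ s t → s ℕ.+ c ℕ.+ t) ([k+1]*[n+1]C[k+1]≡[n+1]*nCk n k) ([k+1]*[n+1]C[k+1]≡[n+1]*nCk n (suc k)) ⟩
    suc n ℕ.* (n C k) ℕ.+ c ℕ.+ suc n ℕ.* (n C suc k) ≡⟨ collect n (n C k) (n C suc k) c ⟩
    suc n ℕ.* (n C k ℕ.+ n C suc k) ℕ.+ c       ≡⟨ cong (λ s → suc n ℕ.* s ℕ.+ c) (nCk+nC[k+1]≡[n+1]C[k+1] n k) ⟩
    suc n ℕ.* c ℕ.+ c                           ≡⟨ +-comm (suc n ℕ.* c) c ⟩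
    suc (suc n) ℕ.* c                           ∎
    where
    open ≡.≡-Reasoning
    c  = suc n C suc k
    c′ = suc n C suc (suc k)
    expand : ∀ k c c′ → suc (suc k) ℕ.* (c ℕ.+ c′) ≡ suc k ℕ.* c ℕ.+ c ℕ.+ suc (suc k) ℕ.* c′
    expand = solve-∀
    collect : ∀ n a b c → suc n ℕ.* a ℕ.+ c ℕ.+ suc n ℕ.* b ≡ suc n ℕ.* (a ℕ.+ b) ℕ.+ c
    collect = solve-∀

  nCk>0 : ∀ {n k} → k ℕ.≤ n → 0 ℕ.< n C k
  nCk>0 {n}     {zero}  _         = s≤s z≤n
  nCk>0 {suc n} {suc k} (s≤s k≤n) = ≤-trans (nCk>0 k≤n)
    (≤-trans (m≤m+n (n C k) (n C suc k)) (≤-reflexive (nCk+nC[k+1]≡[n+1]C[k+1] n k)))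

  -- The entries 1 / (k C(n,k)) of Leibniz's harmonic triangle are iterated
  -- differences of 1/1, …, 1/n, so a common multiple of 1, …, n clears them.
  k*nCk∣commonMultiple : ∀ {D} n k → k ℕ.≤ n → (∀ {i} → 1 ℕ.≤ i → i ℕ.≤ suc n → i ∣ D) →
                         suc k ℕ.* (suc n C suc k) ∣ D
  k*nCk∣commonMultiple {D} n zero _ multiple =
    subst (_∣ D) (≡.sym (≡.trans (*-identityˡ _) (nC1≡n (suc n)))) (multiple (s≤s z≤n) ≤-refl)
  k*nCk∣commonMultiple {D} (suc n) (suc k) (s≤s k≤n) multiple
    with divides u D≡ua ← k*nCk∣commonMultiple n k k≤n (λ 1≤i i≤1+n → multiple 1≤i (m≤n⇒m≤1+n i≤1+n))
       | divides v D≡va+b ← k*nCk∣commonMultiple (suc n) k (m≤n⇒m≤1+n k≤n) multiple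
    = divides (u ℕ.∸ v) (*-cancelʳ-≡ D _ b {{>-nonZero (nCk>0 (m≤n⇒m≤1+n k≤n))}} (begin
      D ℕ.* b                                     ≡⟨ m+n∸m≡n (D ℕ.* a) (D ℕ.* b) ⟨
      D ℕ.* a ℕ.+ D ℕ.* b ℕ.∸ D ℕ.* a             ≡⟨ cong (ℕ._∸ D ℕ.* a) (≡.sym (*-distribˡ-+ D a b)) ⟩
      D ℕ.* (a ℕ.+ b) ℕ.∸ D ℕ.* a                 ≡⟨ cong₂ ℕ._∸_ (cong (ℕ._* (a ℕ.+ b)) D≡ua) (cong (ℕ._* a) (≡.trans D≡va+b (cong (λ t → v ℕ.* (suc k ℕ.* t)) (≡.sym pascal)))) ⟩
      u ℕ.* (suc k ℕ.* a) ℕ.* (a ℕ.+ b) ℕ.∸ v ℕ.* (suc k ℕ.* (a ℕ.+ b)) ℕ.* a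
                                                  ≡⟨ cong₂ ℕ._∸_ (shuffle u (suc k) a (a ℕ.+ b)) (≡.trans (*-assoc v _ a) (cong (λ t → v ℕ.* t) (*-comm (suc k ℕ.* (a ℕ.+ b)) a))) ⟩
      u ℕ.* y ℕ.∸ v ℕ.* y                         ≡⟨ *-distribʳ-∸ y u v ⟨
      (u ℕ.∸ v) ℕ.* y                             ≡⟨ cong ((u ℕ.∸ v) ℕ.*_) y≡zb ⟩
      (u ℕ.∸ v) ℕ.* (z ℕ.* b)                     ≡⟨ *-assoc (u ℕ.∸ v) z b ⟨
      (u ℕ.∸ v) ℕ.* z ℕ.* b                       ∎))
    where
    open ≡.≡-Reasoning
    a = suc n C suc k
    b = suc n C k
    y = a ℕ.* (suc k ℕ.* (a ℕ.+ b))
    z = suc (suc k) ℕ.* (suc (suc n) C suc (suc k))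
    pascal : a ℕ.+ b ≡ suc (suc n) C suc k
    pascal = ≡.trans (+-comm a b) (nCk+nC[k+1]≡[n+1]C[k+1] (suc n) k)
    shuffle : ∀ u k a s → u ℕ.* (k ℕ.* a) ℕ.* s ≡ u ℕ.* (a ℕ.* (k ℕ.* s))
    shuffle = solve-∀
    y≡zb : y ≡ z ℕ.* b
    y≡zb = begin
      a ℕ.* (suc k ℕ.* (a ℕ.+ b))              ≡⟨ cong (λ t → a ℕ.* (suc k ℕ.* t)) pascal ⟩
      a ℕ.* (suc k ℕ.* (suc (suc n) C suc k))  ≡⟨ cong (a ℕ.*_) ([k+1]*[n+1]C[k+1]≡[n+1]*nCk (suc n) k) ⟩
      a ℕ.* (suc (suc n) ℕ.* b)                ≡⟨ *-assoc a (suc (suc n)) b ⟨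
      a ℕ.* suc (suc n) ℕ.* b                  ≡⟨ cong (ℕ._* b) (*-comm a (suc (suc n))) ⟩
      suc (suc n) ℕ.* a ℕ.* b                  ≡⟨ cong (ℕ._* b) ([k+1]*[n+1]C[k+1]≡[n+1]*nCk (suc n) (suc k)) ⟨
      z ℕ.* b                                  ∎

  -- Pascal's rule, used twice, makes each central coefficient at least twice the preceding one.
  2^n≤2nCn : ∀ n → 2 ℕ.^ n ℕ.≤ (n ℕ.+ n) C n
  2^n≤2nCn zero    = ≤-refl
  2^n≤2nCn (suc n) = begin
    2 ℕ.^ n ℕ.+ (2 ℕ.^ n ℕ.+ 0)                 ≡⟨ cong (2 ℕ.^ n ℕ.+_) (+-identityʳ _) ⟩
    2 ℕ.^ n ℕ.+ 2 ℕ.^ n                         ≤⟨ +-mono-≤ (≤-trans (2^n≤2nCn n) lower) (≤-trans (2^n≤2nCn n) upper) ⟩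
    suc (n ℕ.+ n) C n ℕ.+ suc (n ℕ.+ n) C suc n ≡⟨ nCk+nC[k+1]≡[n+1]C[k+1] (suc (n ℕ.+ n)) n ⟩
    suc (suc (n ℕ.+ n)) C suc n                 ≡⟨ cong (λ t → suc t C suc n) (+-suc n n) ⟨
    (suc n ℕ.+ suc n) C suc n                   ∎
    where
    open ≤-Reasoning
    upper : (n ℕ.+ n) C n ℕ.≤ suc (n ℕ.+ n) C suc n
    upper = ≤-trans (m≤m+n _ _) (≤-reflexive (nCk+nC[k+1]≡[n+1]C[k+1] (n ℕ.+ n) n))
    lower : (n ℕ.+ n) C n ℕ.≤ suc (n ℕ.+ n) C n
    lower = go n
      where
      go : ∀ k → (n ℕ.+ n) C k ℕ.≤ suc (n ℕ.+ n) C k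
      go zero    = ≤-refl
      go (suc k) = ≤-trans (m≤n+m _ _) (≤-reflexive (nCk+nC[k+1]≡[n+1]C[k+1] (n ℕ.+ n) k))

  -- Coprimality and prime powers

  coprime⇒*∣ : ∀ {m n o} → Coprime m n → m ∣ o → n ∣ o → m ℕ.* n ∣ o
  coprime⇒*∣ {m} {n} coprime (divides q o≡qm) n∣o
    rewrite o≡qm | *-comm q m = *-monoʳ-∣ m (coprime-divisor (Coprime.sym coprime) n∣o)

  prime∤⇒coprime : ∀ {p n} → Prime p → ¬ (p ∣ n) → Coprime p n
  prime∤⇒coprime pr p∤n (d∣p , d∣n) with prime⇒irreducible pr d∣p
  ... | inj₁ d≡1    = d≡1
  ... | inj₂ ≡.refl = contradiction d∣n p∤n

  coprime-* : ∀ {a b n} → Coprime a n → Coprime b n → Coprime (a ℕ.* b) n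
  coprime-* {a} {b} a⊥n b⊥n {d} (d∣ab , d∣n) =
    b⊥n (coprime-divisor {n = a} (λ (e∣d , e∣a) → a⊥n (e∣a , ∣-trans e∣d d∣n)) d∣ab , d∣n)

  coprime-^ : ∀ {a n} k → Coprime a n → Coprime (a ℕ.^ k) n
  coprime-^ zero    a⊥n = Coprime.1-coprimeTo _
  coprime-^ (suc k) a⊥n = coprime-* a⊥n (coprime-^ k a⊥n)

  primeDivisor : ∀ n → 1 ℕ.< n → ∃ λ p → Prime p × p ∣ n
  primeDivisor n 1<n with factorise n {{nonTrivial⇒nonZero n {{n>1⇒nonTrivial 1<n}}}}
  ... | record { factors = []     ; isFactorisation = ≡.refl } = contradiction 1<n (<-irrefl ≡.refl)
  ... | record { factors = p ∷ ps ; isFactorisation = eq ; factorsPrime = pr ∷ _ } =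
    p , pr , divides (product ps) (≡.trans eq (*-comm p (product ps)))

  splitPower : ∀ {p} n → 1 ℕ.< p → 0 ℕ.< n → ∃ λ k → ∃ λ m → n ≡ p ℕ.^ k ℕ.* m × ¬ (p ∣ m)
  splitPower {p} n 1<p = <-rec (λ n → 0 ℕ.< n → ∃ λ k → ∃ λ m → n ≡ p ℕ.^ k ℕ.* m × ¬ (p ∣ m)) step n
    where
    step : ∀ n → (∀ {n′} → n′ ℕ.< n → 0 ℕ.< n′ → ∃ λ k → ∃ λ m → n′ ≡ p ℕ.^ k ℕ.* m × ¬ (p ∣ m)) →
           0 ℕ.< n → ∃ λ k → ∃ λ m → n ≡ p ℕ.^ k ℕ.* m × ¬ (p ∣ m)
    step n rec 0<n with p ∣? n
    ... | no p∤n = 0 , n , ≡.sym (*-identityˡ n) , p∤n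
    ... | yes (divides zero n≡0) = contradiction 0<n (<-irrefl (≡.sym n≡0))
    ... | yes (divides (suc q) n≡) with rec {suc q} (subst (suc q ℕ.<_) (≡.sym n≡) (m<m*n (suc q) p 1<p)) (s≤s z≤n)
    ... | k , m , q≡ , p∤m = suc k , m , ≡.trans n≡ (≡.trans (cong (ℕ._* p) q≡) (lemma (p ℕ.^ k) m p)) , p∤m
      where
      lemma : ∀ a m p → a ℕ.* m ℕ.* p ≡ p ℕ.* a ℕ.* m
      lemma = solve-∀

  -- Induction that splits off the full power of one prime divisor: the cofactor is smaller and
  -- coprime to it. This reduces divisibility by every i ≤ N to a check on the prime powers up to N.
  primePowers∣⇒∣ : ∀ {D} n → 0 ℕ.< n → (∀ {p} k → Prime p → p ℕ.^ k ∣ n → p ℕ.^ k ∣ D) → n ∣ D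
  primePowers∣⇒∣ {D} = <-rec (λ n → 0 ℕ.< n → (∀ {p} k → Prime p → p ℕ.^ k ∣ n → p ℕ.^ k ∣ D) → n ∣ D) step
    where
    step : ∀ n → (∀ {m} → m ℕ.< n → 0 ℕ.< m → (∀ {p} k → Prime p → p ℕ.^ k ∣ m → p ℕ.^ k ∣ D) → m ∣ D) →
           0 ℕ.< n → (∀ {p} k → Prime p → p ℕ.^ k ∣ n → p ℕ.^ k ∣ D) → n ∣ D
    step 1 _ _ _ = 1∣ D
    step n@(suc (suc _)) rec 0<n powers
      with p , pr , p∣n ← primeDivisor n (s≤s (s≤s z≤n))
      with splitPower n (nonTrivial⇒n>1 p {{prime⇒nonTrivial pr}}) 0<n
    ... | zero , m , n≡m , p∤m = contradiction (subst (p ∣_) (≡.trans n≡m (*-identityˡ m)) p∣n) p∤m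
    ... | suc k , zero , n≡ , p∤m = contradiction (p ∣0) p∤m
    ... | suc k , m@(suc _) , n≡ , p∤m =
      subst (_∣ D) (≡.sym n≡) (coprime⇒*∣ (coprime-^ (suc k) (prime∤⇒coprime pr p∤m))
        (powers (suc k) pr (divides m (≡.trans n≡ (*-comm (p ℕ.^ suc k) m))))
        (rec m<n (s≤s z≤n) λ j pr′ q∣m → powers j pr′ (∣-trans q∣m (divides (p ℕ.^ suc k) n≡))))
      where
      1<p = nonTrivial⇒n>1 p {{prime⇒nonTrivial pr}}
      m<n : m ℕ.< n
      m<n = begin-strict
        m                      <⟨ m<m*n m p 1<p ⟩
        m ℕ.* p                ≤⟨ m≤m*n (m ℕ.* p) (p ℕ.^ k) {{m^n≢0 p k {{prime⇒nonZero pr}}}} ⟩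
        m ℕ.* p ℕ.* p ℕ.^ k    ≡⟨ *-assoc m p (p ℕ.^ k) ⟩
        m ℕ.* p ℕ.^ suc k      ≡⟨ *-comm m _ ⟩
        p ℕ.^ suc k ℕ.* m      ≡⟨ n≡ ⟨
        n                      ∎
        where open ≤-Reasoning

  largestPower : ∀ p N → 1 ℕ.< p → 1 ℕ.≤ N → ∃ λ e → p ℕ.^ e ℕ.≤ N × N ℕ.< p ℕ.^ suc e
  largestPower p 1 1<p _ = 0 , ≤-refl , ≤-trans 1<p (≤-reflexive (≡.sym (*-identityʳ p)))
  largestPower p (suc N@(suc _)) 1<p _ with largestPower p N 1<p (s≤s z≤n)
  ... | e , p^e≤N , N<p^1+e with suc N ℕₚ.<? p ℕ.^ suc e
  ...   | yes 1+N<p^1+e = e , m≤n⇒m≤1+n p^e≤N , 1+N<p^1+e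
  ...   | no  1+N≮p^1+e = suc e , ≮⇒≥ 1+N≮p^1+e , (begin-strict
      suc N            ≤⟨ N<p^1+e ⟩
      p ℕ.^ suc e      <⟨ m<m*n (p ℕ.^ suc e) p {{m^n≢0 p (suc e) {{>-nonZero (<-trans (s≤s z≤n) 1<p)}}}} 1<p ⟩
      p ℕ.^ suc e ℕ.* p ≡⟨ *-comm _ p ⟩
      p ℕ.^ suc (suc e) ∎)
      where open ≤-Reasoning

  -- Lists of primes and Chebyshev's lower bound

  primesUpTo : ℕ → List ℕ
  primesUpTo zero = []
  primesUpTo (suc n) with prime? (suc n)
  ... | yes _ = suc n ∷ primesUpTo n
  ... | no  _ = primesUpTo n

  primesUpTo-prime : ∀ n → All Prime (primesUpTo n)
  primesUpTo-prime zero = []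
  primesUpTo-prime (suc n) with prime? (suc n)
  ... | yes pr = pr ∷ primesUpTo-prime n
  ... | no  _  = primesUpTo-prime n

  primesUpTo-≤ : ∀ n → All (ℕ._≤ n) (primesUpTo n)
  primesUpTo-≤ zero = []
  primesUpTo-≤ (suc n) with prime? (suc n)
  ... | yes _ = ≤-refl ∷ All.map m≤n⇒m≤1+n (primesUpTo-≤ n)
  ... | no  _ = All.map m≤n⇒m≤1+n (primesUpTo-≤ n)

  primesUpTo-coprime : ∀ n → AllPairs Coprime (primesUpTo n)
  primesUpTo-coprime zero = []
  primesUpTo-coprime (suc n) with prime? (suc n)
  ... | yes pr = All.zipWith {R = Coprime (suc n)} (λ (pr′ , q≤n) → prime⇒coprime pr {{prime⇒nonZero pr′}} (s≤s q≤n))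
                   (primesUpTo-prime n , primesUpTo-≤ n) ∷ primesUpTo-coprime n
  ... | no  _  = primesUpTo-coprime n

  -- D is lcm(1, ..., N), built as the product over the primes p ≤ N of the largest power of p not
  -- exceeding N. Each of the π(N) factors is at most N, whence the bound. In `go` the limit N stays
  -- fixed while n runs through the primes.
  commonMultiple : ∀ N → 1 ℕ.≤ N → ∃ λ D → 0 ℕ.< D × D ℕ.≤ N ℕ.^ length (primesUpTo N) ×
                   (∀ {i} → 1 ℕ.≤ i → i ℕ.≤ N → i ∣ D)
  commonMultiple N 1≤N with go N
    where
    go : ∀ n → ∃ λ D → 0 ℕ.< D × D ℕ.≤ N ℕ.^ length (primesUpTo n) ×
         (∀ {p} k → Prime p → p ℕ.≤ n → p ℕ.^ k ℕ.≤ N → p ℕ.^ k ∣ D)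
    go zero = 1 , s≤s z≤n , ≤-refl , λ { k pr z≤n → contradiction pr ¬prime[0] }
    go (suc n) with prime? (suc n) | go n
    ... | no ¬pr | D , 0<D , D≤ , powers = D , 0<D , D≤ , powers′
      where
      powers′ : ∀ {p} k → Prime p → p ℕ.≤ suc n → p ℕ.^ k ℕ.≤ N → p ℕ.^ k ∣ D
      powers′ k pr p≤1+n with m≤n⇒m<n∨m≡n p≤1+n
      ... | inj₁ (s≤s p≤n) = powers k pr p≤n
      ... | inj₂ ≡.refl    = contradiction pr ¬pr
    ... | yes pr | D , 0<D , D≤ , powers with largestPower (suc n) N (nonTrivial⇒n>1 (suc n) {{prime⇒nonTrivial pr}}) 1≤N
    ...   | e , p^e≤N , N<p^1+e = suc n ℕ.^ e ℕ.* D , *-mono-≤ (m^n>0 (suc n) e) 0<D , *-mono-≤ p^e≤N D≤ , powers′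
      where
      powers′ : ∀ {p} k → Prime p → p ℕ.≤ suc n → p ℕ.^ k ℕ.≤ N → p ℕ.^ k ∣ suc n ℕ.^ e ℕ.* D
      powers′ k pr′ p≤1+n p^k≤N with m≤n⇒m<n∨m≡n p≤1+n
      ... | inj₁ (s≤s p≤n) = ∣-trans (powers k pr′ p≤n p^k≤N) (n∣m*n (suc n ℕ.^ e))
      ... | inj₂ ≡.refl with k ℕₚ.≤? e
      ...   | yes k≤e = ∣-trans (m≤n⇒m^n∣m^o k≤e) (m∣m*n D)
        where
        m≤n⇒m^n∣m^o : ∀ {k e} → k ℕ.≤ e → suc n ℕ.^ k ∣ suc n ℕ.^ e
        m≤n⇒m^n∣m^o {k} {e} k≤e = subst (λ t → suc n ℕ.^ k ∣ suc n ℕ.^ t) (m+[n∸m]≡n k≤e)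
          (subst (suc n ℕ.^ k ∣_) (≡.sym (^-distribˡ-+-* (suc n) k (e ℕ.∸ k))) (m∣m*n _))
      ...   | no  k≰e = contradiction (≤-trans N<p^1+e (≤-trans (^-monoʳ-≤ (suc n) (≰⇒> k≰e)) p^k≤N)) (<-irrefl ≡.refl)
  ... | D , 0<D , D≤ , powers = D , 0<D , D≤ , λ {i} 1≤i i≤N → primePowers∣⇒∣ i 1≤i λ k pr p^k∣i →
    let p^k≤N = ≤-trans (∣⇒≤ {{>-nonZero 1≤i}} p^k∣i) i≤N in prime-power k pr p^k≤N
    where
    prime-power : ∀ {p} k → Prime p → p ℕ.^ k ℕ.≤ N → p ℕ.^ k ∣ D
    prime-power zero    pr _     = 1∣ D
    prime-power {p} (suc k) pr p^k≤N = powers (suc k) pr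
      (≤-trans (m≤m*n p (p ℕ.^ k) {{m^n≢0 p k {{prime⇒nonZero pr}}}}) p^k≤N) p^k≤N

  -- Chebyshev's lower bound π(2n) ≥ n / log₂ 2n.
  n≤s*π[2n] : ∀ n s → 1 ℕ.≤ n → n ℕ.+ n ℕ.≤ 2 ℕ.^ s → n ℕ.≤ s ℕ.* length (primesUpTo (n ℕ.+ n))
  n≤s*π[2n] n@(suc n′) s _ 2n≤2^s
    with D , 0<D , D≤ , multiple ← commonMultiple (n ℕ.+ n) (s≤s z≤n) = ^-cancelʳ-≤ (begin
    2 ℕ.^ n                       ≤⟨ 2^n≤2nCn n ⟩
    (n ℕ.+ n) C n                 ≤⟨ m≤n*m ((n ℕ.+ n) C n) n ⟩
    n ℕ.* ((n ℕ.+ n) C n)         ≤⟨ ∣⇒≤ {{>-nonZero 0<D}} (k*nCk∣commonMultiple (n′ ℕ.+ n) n′ (m≤m+n n′ n) multiple) ⟩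
    D                             ≤⟨ D≤ ⟩
    (n ℕ.+ n) ℕ.^ K               ≤⟨ ^-monoˡ-≤ K 2n≤2^s ⟩
    (2 ℕ.^ s) ℕ.^ K               ≡⟨ ^-*-assoc 2 s K ⟩
    2 ℕ.^ (s ℕ.* K)               ∎)
    where
    open ≤-Reasoning
    K = length (primesUpTo (n ℕ.+ n))
    ^-cancelʳ-≤ : ∀ {a b} → 2 ℕ.^ a ℕ.≤ 2 ℕ.^ b → a ℕ.≤ b
    ^-cancelʳ-≤ {a} {b} le with a ℕₚ.≤? b
    ... | yes a≤b = a≤b
    ... | no  a≰b = contradiction (≤-trans (^-monoʳ-< 2 (s≤s (s≤s z≤n)) (≰⇒> a≰b)) le) (<-irrefl ≡.refl)

open PrimeCounting

-- Arithmetic and order in the real field, with a ring solver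

module OrderedField (ℝ : CompleteOrderedField) where

  open import Data.Integer.Base using (+_)
  open CompleteOrderedField ℝ
  open RingProperties ring using (-‿distribˡ-*; -‿distribʳ-*; -‿involutive; -0#≈0#)
  open AbelianGroupProperties +-abelianGroup using (⁻¹-∙-comm)
  open SemiringMult semiring using (×1-homo-*)
  open MonoidMult +-monoid using (×-homo-+)

  fromℕ-+ : ∀ m n → fromℕ (m ℕ.+ n) ≈ fromℕ m + fromℕ n
  fromℕ-+ = ×-homo-+ 1#

  fromℕ-* : ∀ m n → fromℕ (m ℕ.* n) ≈ fromℕ m * fromℕ n
  fromℕ-* = ×1-homo-*

  module ≈-Reasoning = Relation.Binary.Reasoning.Setoid setoid

  fromℤ-⊖ : ∀ m n → fromℤ (m ⊖ n) ≈ fromℕ m - fromℕ n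
  fromℤ-⊖ zero    zero    = sym (-‿inverseʳ 0#)
  fromℤ-⊖ zero    (suc n) = sym (+-identityˡ _)
  fromℤ-⊖ (suc m) zero    = sym (trans (+-congˡ -0#≈0#) (+-identityʳ _))
  fromℤ-⊖ (suc m) (suc n) = begin
    fromℤ (suc m ⊖ suc n)                     ≡⟨ cong fromℤ (ℤₚ.[1+m]⊖[1+n]≡m⊖n m n) ⟩
    fromℤ (m ⊖ n)                             ≈⟨ fromℤ-⊖ m n ⟩
    fromℕ m - fromℕ n                         ≈⟨ +-congʳ (trans (+-congˡ (-‿inverseʳ 1#)) (+-identityʳ _)) ⟨
    fromℕ m + (1# - 1#) - fromℕ n             ≈⟨ +-congʳ (+-assoc _ _ _) ⟨
    fromℕ m + 1# - 1# - fromℕ n               ≈⟨ +-assoc _ _ _ ⟩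
    fromℕ m + 1# + (- 1# - fromℕ n)           ≈⟨ +-cong (+-comm _ _) (⁻¹-∙-comm _ _) ⟩
    fromℕ (suc m) - fromℕ (suc n)             ∎
    where open ≈-Reasoning

  fromℤ-+ : ∀ i j → fromℤ (i ℤ.+ j) ≈ fromℤ i + fromℤ j
  fromℤ-+ (+ m)    (+ n)    = fromℕ-+ m n
  fromℤ-+ (+ m)    -[1+ n ] = fromℤ-⊖ m (suc n)
  fromℤ-+ -[1+ m ] (+ n)    = trans (fromℤ-⊖ n (suc m)) (+-comm _ _)
  fromℤ-+ -[1+ m ] -[1+ n ] = begin
    - fromℕ (suc (suc (m ℕ.+ n)))      ≡⟨ cong (λ k → - fromℕ (suc k)) (ℕₚ.+-suc m n) ⟨
    - fromℕ (suc m ℕ.+ suc n)          ≈⟨ -‿cong (fromℕ-+ (suc m) (suc n)) ⟩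
    - (fromℕ (suc m) + fromℕ (suc n))  ≈⟨ ⁻¹-∙-comm _ _ ⟨
    - fromℕ (suc m) - fromℕ (suc n)    ∎
    where open ≈-Reasoning

  fromℤ-neg : ∀ i → fromℤ (ℤ.- i) ≈ - fromℤ i
  fromℤ-neg (+ zero)  = sym -0#≈0#
  fromℤ-neg (+ suc n) = refl
  fromℤ-neg -[1+ n ]  = sym (-‿involutive _)

  fromℤ-+*+ : ∀ m n → fromℤ (+ m ℤ.* + n) ≈ fromℕ m * fromℕ n
  fromℤ-+*+ m n = trans (reflexive (cong fromℤ (≡.sym (ℤₚ.pos-* m n)))) (fromℕ-* m n)

  fromℤ-+* : ∀ m j → fromℤ (+ m ℤ.* j) ≈ fromℕ m * fromℤ j
  fromℤ-+* m (+ n) = fromℤ-+*+ m n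
  fromℤ-+* m -[1+ n ] = begin
    fromℤ (+ m ℤ.* -[1+ n ])          ≡⟨ cong fromℤ (ℤₚ.neg-distribʳ-* (+ m) (+ suc n)) ⟨
    fromℤ (ℤ.- (+ m ℤ.* + suc n))     ≈⟨ fromℤ-neg (+ m ℤ.* + suc n) ⟩
    - fromℤ (+ m ℤ.* + suc n)         ≈⟨ -‿cong (fromℤ-+*+ m (suc n)) ⟩
    - (fromℕ m * fromℕ (suc n))       ≈⟨ -‿distribʳ-* _ _ ⟩
    fromℕ m * - fromℕ (suc n)         ∎
    where open ≈-Reasoning

  fromℤ-* : ∀ i j → fromℤ (i ℤ.* j) ≈ fromℤ i * fromℤ j
  fromℤ-* (+ m) j = fromℤ-+* m j
  fromℤ-* -[1+ m ] j = begin
    fromℤ (-[1+ m ] ℤ.* j)            ≡⟨ cong fromℤ (ℤₚ.neg-distribˡ-* (+ suc m) j) ⟨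
    fromℤ (ℤ.- (+ suc m ℤ.* j))       ≈⟨ fromℤ-neg (+ suc m ℤ.* j) ⟩
    - fromℤ (+ suc m ℤ.* j)           ≈⟨ -‿cong (fromℤ-+* (suc m) j) ⟩
    - (fromℕ (suc m) * fromℤ j)       ≈⟨ -‿distribˡ-* _ _ ⟩
    - fromℕ (suc m) * fromℤ j         ∎
    where open ≈-Reasoning

  -- Unlike fromℤ, this maps 1 to 1# itself rather than to 1# + 0#, so that
  -- the solver's constant 1 denotes 1#.
  ⟦_⟧ : ℤ → Carrier
  ⟦ + 1 ⟧ = 1#
  ⟦ i   ⟧ = fromℤ i

  ⟦⟧≈fromℤ : ∀ i → ⟦ i ⟧ ≈ fromℤ i
  ⟦⟧≈fromℤ (+ 0)           = refl
  ⟦⟧≈fromℤ (+ 1)           = sym (+-identityʳ 1#)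
  ⟦⟧≈fromℤ (+ suc (suc n)) = refl
  ⟦⟧≈fromℤ -[1+ n ]        = refl

  ⟦⟧-morphism : ℤ.+-*-rawRing -Raw-AlmostCommutative⟶ fromCommutativeRing commutativeRing
  ⟦⟧-morphism = record
    { ⟦_⟧    = ⟦_⟧
    ; +-homo = λ i j → trans (⟦⟧≈fromℤ (i ℤ.+ j)) (trans (fromℤ-+ i j) (sym (+-cong (⟦⟧≈fromℤ i) (⟦⟧≈fromℤ j))))
    ; *-homo = λ i j → trans (⟦⟧≈fromℤ (i ℤ.* j)) (trans (fromℤ-* i j) (sym (*-cong (⟦⟧≈fromℤ i) (⟦⟧≈fromℤ j))))
    ; -‿homo = λ i → trans (⟦⟧≈fromℤ (ℤ.- i)) (trans (fromℤ-neg i) (sym (-‿cong (⟦⟧≈fromℤ i))))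
    ; 0-homo = refl
    ; 1-homo = refl
    }

  ⟦⟧-≟ : ∀ i j → Maybe (⟦ i ⟧ ≈ ⟦ j ⟧)
  ⟦⟧-≟ i j with i ℤₚ.≟ j
  ... | yes i≡j = just (reflexive (cong ⟦_⟧ i≡j))
  ... | no  _   = nothing

  open Algebra.Solver.Ring ℤ.+-*-rawRing (fromCommutativeRing commutativeRing) ⟦⟧-morphism ⟦⟧-≟ public
    using (solve; con; _:=_; _:+_; _:*_; _:-_; :-_; Polynomial)

  :0 :1 :2 :3 :4 :8 :10 : ∀ {n} → Polynomial n
  :0 = con (+ 0)
  :1 = con (+ 1)
  :2 = con (+ 2)
  :3 = con (+ 3)
  :4 = con (+ 4)
  :8 = con (+ 8)
  :10 = con (+ 10)

  poset : Poset _ _ _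
  poset = record { isPartialOrder = IsTotalOrder.isPartialOrder isTotalOrder }

  module ≤-Reasoning = Relation.Binary.Reasoning.PartialOrder poset

  ≤-by : ∀ {x y d} → 0# ≤ d → x + d ≈ y → x ≤ y
  ≤-by {x} {y} {d} 0≤d x+d≈y = ≤-respˡ-≈ (+-identityˡ x)
    (≤-respʳ-≈ (trans (+-comm d x) x+d≈y) (+-monoˡ-≤ x 0≤d))

  x≤y⇒0≤y-x : ∀ {x y} → x ≤ y → 0# ≤ y - x
  x≤y⇒0≤y-x {x} x≤y = ≤-respˡ-≈ (-‿inverseʳ x) (+-monoˡ-≤ (- x) x≤y)

  +-mono-≤ : ∀ {x y u v} → x ≤ y → u ≤ v → x + u ≤ y + v
  +-mono-≤ {x} {y} {u} {v} x≤y u≤v = ≤-trans (+-monoˡ-≤ u x≤y)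
    (≤-respˡ-≈ (+-comm u y) (≤-respʳ-≈ (+-comm v y) (+-monoˡ-≤ y u≤v)))

  +-monoʳ-≤ : ∀ {x y} z → x ≤ y → z + x ≤ z + y
  +-monoʳ-≤ z x≤y = +-mono-≤ ≤-refl x≤y

  +-nonNeg : ∀ {x y} → 0# ≤ x → 0# ≤ y → 0# ≤ x + y
  +-nonNeg 0≤x 0≤y = ≤-respˡ-≈ (+-identityˡ 0#) (+-mono-≤ 0≤x 0≤y)

  *-monoˡ-≤ : ∀ {x y z} → 0# ≤ z → x ≤ y → z * x ≤ z * y
  *-monoˡ-≤ {x} {y} {z} 0≤z x≤y = ≤-by (*-nonNeg 0≤z (x≤y⇒0≤y-x x≤y))
    (solve 3 (λ x y z → z :* x :+ z :* (y :- x) := z :* y) refl x y z)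

  *-monoʳ-≤ : ∀ {x y z} → 0# ≤ z → x ≤ y → x * z ≤ y * z
  *-monoʳ-≤ {x} {y} {z} 0≤z x≤y = ≤-respˡ-≈ (*-comm z x) (≤-respʳ-≈ (*-comm z y) (*-monoˡ-≤ 0≤z x≤y))

  *-mono-≤ : ∀ {x y u v} → 0# ≤ x → 0# ≤ v → x ≤ y → u ≤ v → x * u ≤ y * v
  *-mono-≤ 0≤x 0≤v x≤y u≤v = ≤-trans (*-monoˡ-≤ 0≤x u≤v) (*-monoʳ-≤ 0≤v x≤y)

  neg-nonNeg : ∀ {x} → x ≤ 0# → 0# ≤ - x
  neg-nonNeg {x} x≤0 = ≤-respʳ-≈ (+-identityˡ (- x)) (x≤y⇒0≤y-x x≤0)

  0≤x*x : ∀ x → 0# ≤ x * x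
  0≤x*x x with total 0# x
  ... | inj₁ 0≤x = *-nonNeg 0≤x 0≤x
  ... | inj₂ x≤0 = ≤-respʳ-≈ (solve 1 (λ x → (:- x) :* (:- x) := x :* x) refl x)
                     (*-nonNeg (neg-nonNeg x≤0) (neg-nonNeg x≤0))

  0≤1 : 0# ≤ 1#
  0≤1 = ≤-respʳ-≈ (*-identityˡ 1#) (0≤x*x 1#)

  <⇒≤ : ∀ {x y} → x < y → x ≤ y
  <⇒≤ = proj₁

  <⇒≱ : ∀ {x y} → x < y → ¬ (y ≤ x)
  <⇒≱ (x≤y , x≉y) y≤x = x≉y (antisym x≤y y≤x)

  ≰⇒> : ∀ {x y} → ¬ (x ≤ y) → y < x
  ≰⇒> {x} {y} x≰y with total x y
  ... | inj₁ x≤y = contradiction x≤y x≰y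
  ... | inj₂ y≤x = y≤x , λ y≈x → x≰y (≤-reflexive (sym y≈x))

  <-≤-trans : ∀ {x y z} → x < y → y ≤ z → x < z
  <-≤-trans x<y y≤z = ≤-trans (<⇒≤ x<y) y≤z , λ x≈z → <⇒≱ x<y (≤-respʳ-≈ (sym x≈z) y≤z)

  ≤-<-trans : ∀ {x y z} → x ≤ y → y < z → x < z
  ≤-<-trans x≤y y<z = ≤-trans x≤y (<⇒≤ y<z) , λ x≈z → <⇒≱ y<z (≤-respˡ-≈ x≈z x≤y)

  0<1 : 0# < 1#
  0<1 = 0≤1 , 0≉1

  >⇒≉0 : ∀ {x} → 0# < x → ¬ (x ≈ 0#)
  >⇒≉0 (_ , 0≉x) x≈0 = 0≉x (sym x≈0)

  ⁻¹-nonNeg : ∀ {x} → 0# < x → 0# ≤ x ⁻¹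
  ⁻¹-nonNeg {x} 0<x with total 0# (x ⁻¹)
  ... | inj₁ 0≤x⁻¹ = 0≤x⁻¹
  ... | inj₂ x⁻¹≤0 = contradiction
    (≤-respˡ-≈ (*-inverseʳ x (>⇒≉0 0<x)) (≤-respʳ-≈ (zeroʳ x) (*-monoˡ-≤ (<⇒≤ 0<x) x⁻¹≤0)))
    (<⇒≱ 0<1)

  *-inverseˡ : ∀ {x} → 0# < x → x ⁻¹ * x ≈ 1#
  *-inverseˡ 0<x = trans (*-comm _ _) (*-inverseʳ _ (>⇒≉0 0<x))

  *-cancelˡ-≤ : ∀ {x y z} → 0# < z → z * x ≤ z * y → x ≤ y
  *-cancelˡ-≤ {x} {y} {z} 0<z zx≤zy = ≤-respˡ-≈ (cancel x) (≤-respʳ-≈ (cancel y) (*-monoˡ-≤ (⁻¹-nonNeg 0<z) zx≤zy))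
    where
    cancel : ∀ w → z ⁻¹ * (z * w) ≈ w
    cancel w = trans (sym (*-assoc _ _ _)) (trans (*-congʳ (*-inverseˡ 0<z)) (*-identityˡ w))

  *-cancelˡ-< : ∀ {x y z} → 0# ≤ z → z * x < z * y → x < y
  *-cancelˡ-< 0≤z zx<zy = ≰⇒> λ y≤x → <⇒≱ zx<zy (*-monoˡ-≤ 0≤z y≤x)

  *-pos : ∀ {x y} → 0# < x → 0# < y → 0# < x * y
  *-pos {x} 0<x 0<y = ≰⇒> λ xy≤0 → <⇒≱ 0<y (*-cancelˡ-≤ 0<x (≤-respʳ-≈ (sym (zeroʳ x)) xy≤0))

  ⁻¹-pos : ∀ {x} → 0# < x → 0# < x ⁻¹
  ⁻¹-pos {x} 0<x = ⁻¹-nonNeg 0<x , λ 0≈x⁻¹ → 0≉1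
    (trans (sym (zeroʳ x)) (trans (*-congˡ 0≈x⁻¹) (*-inverseʳ x (>⇒≉0 0<x))))

  +-pos : ∀ {x y} → 0# < x → 0# ≤ y → 0# < x + y
  +-pos {x} 0<x 0≤y = <-≤-trans 0<x (≤-respˡ-≈ (+-identityʳ x) (+-monoʳ-≤ x 0≤y))

  fromℕ-nonNeg : ∀ n → 0# ≤ fromℕ n
  fromℕ-nonNeg zero    = ≤-refl
  fromℕ-nonNeg (suc n) = +-nonNeg 0≤1 (fromℕ-nonNeg n)

  fromℕ-pos : ∀ {n} → 0 ℕ.< n → 0# < fromℕ n
  fromℕ-pos {suc n} _ = +-pos 0<1 (fromℕ-nonNeg n)

  fromℕ-mono : ∀ {m n} → m ℕ.≤ n → fromℕ m ≤ fromℕ n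
  fromℕ-mono {n = n} z≤n   = fromℕ-nonNeg n
  fromℕ-mono (s≤s m≤n)     = +-monoʳ-≤ 1# (fromℕ-mono m≤n)

  x<1+x : ∀ x → x < 1# + x
  x<1+x x = ≰⇒> λ 1+x≤x → <⇒≱ 0<1 (≤-respˡ-≈ (solve 1 (λ x → :1 :+ x :- x := :1) refl x)
    (≤-respʳ-≈ (-‿inverseʳ x) (+-monoˡ-≤ (- x) 1+x≤x)))

  fromℕ-mono-< : ∀ {m n} → m ℕ.< n → fromℕ m < fromℕ n
  fromℕ-mono-< {m} m<n = <-≤-trans (x<1+x (fromℕ m)) (fromℕ-mono m<n)

  fromℕ-^ : ∀ m n → fromℕ (m ℕ.^ n) ≈ fromℕ m ^ n
  fromℕ-^ m zero    = +-identityʳ 1#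
  fromℕ-^ m (suc n) = trans (fromℕ-* m (m ℕ.^ n)) (*-congˡ (fromℕ-^ m n))

  ^-nonNeg : ∀ {x} n → 0# ≤ x → 0# ≤ x ^ n
  ^-nonNeg zero    0≤x = 0≤1
  ^-nonNeg (suc n) 0≤x = *-nonNeg 0≤x (^-nonNeg n 0≤x)

  ^-pos : ∀ {x} n → 0# < x → 0# < x ^ n
  ^-pos zero    0<x = 0<1
  ^-pos (suc n) 0<x = *-pos 0<x (^-pos n 0<x)

  ^-mono-≤ : ∀ {x y} n → 0# ≤ x → x ≤ y → x ^ n ≤ y ^ n
  ^-mono-≤ zero    0≤x x≤y = ≤-refl
  ^-mono-≤ (suc n) 0≤x x≤y = *-mono-≤ 0≤x (^-nonNeg n (≤-trans 0≤x x≤y)) x≤y (^-mono-≤ n 0≤x x≤y)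

  x≤y*z⇒x*y⁻¹≤z : ∀ {x y z} → 0# < y → x ≤ y * z → x * y ⁻¹ ≤ z
  x≤y*z⇒x*y⁻¹≤z {x} {y} {z} 0<y x≤yz = *-cancelˡ-≤ 0<y (≤-respˡ-≈ (sym lemma) x≤yz)
    where
    lemma : y * (x * y ⁻¹) ≈ x
    lemma = trans (solve 3 (λ x y i → y :* (x :* i) := x :* (y :* i)) refl x y (y ⁻¹))
              (trans (*-congˡ (*-inverseʳ y (>⇒≉0 0<y))) (*-identityʳ x))

-- Division with remainder, finite sums, periodic functions

module Summation (ℝ : CompleteOrderedField) where

  open CompleteOrderedField ℝ
  open OrderedField ℝ
  open SemiringSum semiring using (sum-cong-≋; sum-permute)

  infixl 7 _div_
  -- Total, with default 0, so that `M div p` can be written in definitions such as `proj` before p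
  -- is known to be positive.
  _div_ : ℕ → ℕ → ℕ
  m div zero    = 0
  m div (suc n) = m / suc n

  div-+* : ∀ {q} i a → 0 ℕ.< q → (i ℕ.+ a ℕ.* q) div q ≡ i div q ℕ.+ a
  div-+* {q@(suc _)} i a _ = ≡.trans (+-distrib-/-∣ʳ i (n∣m*n a)) (cong (i / q ℕ.+_) (m*n/n≡m a q))

  div-*+ : ∀ {q} a {r} → r ℕ.< q → (a ℕ.* q ℕ.+ r) div q ≡ a
  div-*+ {q@(suc _)} a {r} r<q = ≡.trans (cong (_div q) (ℕₚ.+-comm (a ℕ.* q) r))
    (≡.trans (div-+* r a (s≤s z≤n)) (cong (ℕ._+ a) (m<n⇒m/n≡0 r<q)))

  *-div : ∀ {m n} → 0 ℕ.< m → m ∣ n → m ℕ.* (n div m) ≡ n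
  *-div {suc _} _ m∣n = m*[n/m]≡n m∣n

  div-pos : ∀ {m n} → 0 ℕ.< m → m ∣ n → 0 ℕ.< n → 0 ℕ.< n div m
  div-pos {m} {n} 0<m m∣n 0<n = ℕₚ.n≢0⇒n>0 λ n/m≡0 → ℕₚ.<-irrefl
    (≡.trans (≡.sym (ℕₚ.*-zeroʳ m)) (≡.trans (cong (m ℕ.*_) (≡.sym n/m≡0)) (*-div 0<m m∣n))) 0<n

  div-div : ∀ i {m n} → 0 ℕ.< m → 0 ℕ.< n → i div m div n ≡ i div (m ℕ.* n)
  div-div i {m@(suc _)} {n@(suc _)} _ _ = m/n/o≡m/[n*o] i m n

  -- Sums over {0, …, n-1} and periodic functions

  Σ< : ℕ → (ℕ → Carrier) → Carrier
  Σ< zero    φ = 0#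
  Σ< (suc n) φ = φ 0 + Σ< n λ i → φ (suc i)

  Σ≡sum : ∀ n (φ : ℕ → Carrier) → Σ< n φ ≡ sum {n} λ i → φ (toℕ i)
  Σ≡sum zero    φ = ≡.refl
  Σ≡sum (suc n) φ = cong (φ 0 +_) (Σ≡sum n λ i → φ (suc i))

  Σ-cong< : ∀ n {φ ψ : ℕ → Carrier} → (∀ {i} → i ℕ.< n → φ i ≈ ψ i) → Σ< n φ ≈ Σ< n ψ
  Σ-cong< zero    φ≈ψ = refl
  Σ-cong< (suc n) φ≈ψ = +-cong (φ≈ψ (s≤s z≤n)) (Σ-cong< n λ i<n → φ≈ψ (s≤s i<n))

  Σ-cong : ∀ n {φ ψ : ℕ → Carrier} → (∀ i → φ i ≈ ψ i) → Σ< n φ ≈ Σ< n ψ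
  Σ-cong n φ≈ψ = Σ-cong< n λ {i} _ → φ≈ψ i

  Σ-mono< : ∀ n {φ ψ : ℕ → Carrier} → (∀ {i} → i ℕ.< n → φ i ≤ ψ i) → Σ< n φ ≤ Σ< n ψ
  Σ-mono< zero    _   = ≤-refl
  Σ-mono< (suc n) φ≤ψ = +-mono-≤ (φ≤ψ (s≤s z≤n)) (Σ-mono< n λ i<n → φ≤ψ (s≤s i<n))

  Σ-mono : ∀ n {φ ψ : ℕ → Carrier} → (∀ i → φ i ≤ ψ i) → Σ< n φ ≤ Σ< n ψ
  Σ-mono n φ≤ψ = Σ-mono< n λ {i} _ → φ≤ψ i

  Σ-+ : ∀ n (φ ψ : ℕ → Carrier) → Σ< n (λ i → φ i + ψ i) ≈ Σ< n φ + Σ< n ψ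
  Σ-+ zero    φ ψ = sym (+-identityˡ 0#)
  Σ-+ (suc n) φ ψ = trans (+-congˡ (Σ-+ n (λ i → φ (suc i)) λ i → ψ (suc i)))
    (solve 4 (λ a b c d → a :+ b :+ (c :+ d) := a :+ c :+ (b :+ d)) refl _ _ _ _)

  Σ-* : ∀ n c (φ : ℕ → Carrier) → Σ< n (λ i → c * φ i) ≈ c * Σ< n φ
  Σ-* zero    c φ = sym (zeroʳ c)
  Σ-* (suc n) c φ = trans (+-congˡ (Σ-* n c λ i → φ (suc i))) (sym (distribˡ c _ _))

  Σ-zero : ∀ n → Σ< n (λ _ → 0#) ≈ 0#
  Σ-zero zero    = refl
  Σ-zero (suc n) = trans (+-identityˡ _) (Σ-zero n)

  Σ-comm : ∀ m n (φ : ℕ → ℕ → Carrier) → Σ< m (λ i → Σ< n (φ i)) ≈ Σ< n (λ j → Σ< m (λ i → φ i j))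
  Σ-comm zero    n φ = sym (Σ-zero n)
  Σ-comm (suc m) n φ = trans (+-congˡ (Σ-comm m n λ i → φ (suc i))) (sym (Σ-+ n (φ 0) _))

  Σ-const : ∀ n c → Σ< n (λ _ → c) ≈ fromℕ n * c
  Σ-const zero    c = sym (zeroˡ c)
  Σ-const (suc n) c = trans (+-congˡ (Σ-const n c))
    (solve 2 (λ t c → c :+ t :* c := (:1 :+ t) :* c) refl (fromℕ n) c)

  Σ-neg : ∀ n (φ : ℕ → Carrier) → Σ< n (λ i → - φ i) ≈ - Σ< n φ
  Σ-neg n φ = trans (Σ-cong n λ i → solve 1 (λ x → :- x := (:- :1) :* x) refl (φ i))
    (trans (Σ-* n (- 1#) φ) (solve 1 (λ x → (:- :1) :* x := :- x) refl (Σ< n φ)))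

  Σ-nonNeg : ∀ n {φ : ℕ → Carrier} → (∀ i → 0# ≤ φ i) → 0# ≤ Σ< n φ
  Σ-nonNeg n 0≤φ = ≤-respˡ-≈ (Σ-zero n) (Σ-mono n 0≤φ)

  Σ-split : ∀ m n (φ : ℕ → Carrier) → Σ< (m ℕ.+ n) φ ≈ Σ< m φ + Σ< n (λ i → φ (m ℕ.+ i))
  Σ-split zero    n φ = sym (+-identityˡ _)
  Σ-split (suc m) n φ = trans (+-congˡ (Σ-split m n (λ i → φ (suc i)))) (sym (+-assoc _ _ _))

  Σ-block : ∀ a b (φ : ℕ → Carrier) → Σ< (a ℕ.* b) φ ≈ Σ< a (λ i → Σ< b (λ r → φ (i ℕ.* b ℕ.+ r)))
  Σ-block zero    b φ = refl
  Σ-block (suc a) b φ = trans (Σ-split b (a ℕ.* b) φ) (+-congˡ (trans (Σ-block a b λ i → φ (b ℕ.+ i))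
    (Σ-cong a λ i → Σ-cong b λ r → reflexive (cong φ (≡.sym (ℕₚ.+-assoc b (i ℕ.* b) r))))))

  Σ-div : ∀ a b (φ : ℕ → Carrier) → Σ< (a ℕ.* b) (λ i → φ (i div b)) ≈ fromℕ b * Σ< a φ
  Σ-div a b φ = begin
    Σ< (a ℕ.* b) (λ i → φ (i div b))                     ≈⟨ Σ-block a b (λ i → φ (i div b)) ⟩
    Σ< a (λ i → Σ< b (λ r → φ ((i ℕ.* b ℕ.+ r) div b)))  ≈⟨ Σ-cong a (λ i → Σ-cong< b λ r<b → reflexive (cong φ (div-*+ i r<b))) ⟩
    Σ< a (λ i → Σ< b (λ r → φ i))                        ≈⟨ Σ-cong a (λ i → Σ-const b (φ i)) ⟩
    Σ< a (λ i → fromℕ b * φ i)                           ≈⟨ Σ-* a (fromℕ b) φ ⟩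
    fromℕ b * Σ< a φ                                     ∎
    where open ≈-Reasoning

  Periodic : ℕ → (ℕ → Carrier) → Set
  Periodic m u = ∀ x → u (x ℕ.+ m) ≈ u x

  periodic-* : ∀ {m u} → Periodic m u → ∀ k → Periodic (k ℕ.* m) u
  periodic-* {m} {u} per zero    x = reflexive (cong u (ℕₚ.+-identityʳ x))
  periodic-* {m} {u} per (suc k) x = trans (reflexive (cong u (≡.sym (ℕₚ.+-assoc x m (k ℕ.* m)))))
    (trans (periodic-* {m} {u} per k (x ℕ.+ m)) (per x))

  periodic-% : ∀ {m u} .{{_ : NonZero m}} → Periodic m u → ∀ x → u x ≈ u (x % m)
  periodic-% {m} {u} per x = trans (reflexive (cong u (m≡m%n+[m/n]*n x m))) (periodic-* {m} {u} per (x / m) (x % m))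

  Σ-last : ∀ n (φ : ℕ → Carrier) → Σ< (suc n) φ ≈ Σ< n φ + φ n
  Σ-last zero    φ = +-comm _ _
  Σ-last (suc n) φ = trans (+-congˡ (Σ-last n (λ i → φ (suc i)))) (sym (+-assoc _ _ _))

  Σ-shift : ∀ {m u} → Periodic m u → ∀ s → Σ< m (λ x → u (x ℕ.+ s)) ≈ Σ< m u
  Σ-shift {m} {u} per zero    = Σ-cong m λ x → reflexive (cong u (ℕₚ.+-identityʳ x))
  Σ-shift {m} {u} per (suc s) = begin
    Σ< m (λ x → u (x ℕ.+ suc s))                 ≈⟨ Σ-cong m (λ x → reflexive (cong u (ℕₚ.+-suc x s))) ⟩
    Σ< m (λ x → w (suc x))                       ≈⟨ solve 2 (λ a b → b := a :+ b :- a) refl (w 0) _ ⟩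
    Σ< (suc m) w - w 0                           ≈⟨ +-congʳ (Σ-last m w) ⟩
    Σ< m w + w m - w 0                           ≈⟨ +-congʳ (+-congˡ (trans (reflexive (cong u (ℕₚ.+-comm m s))) (per s))) ⟩
    Σ< m w + w 0 - w 0                           ≈⟨ solve 2 (λ a b → b :+ a :- a := b) refl (w 0) _ ⟩
    Σ< m w                                       ≈⟨ Σ-shift {m} {u} per s ⟩
    Σ< m u                                       ∎
    where
    open ≈-Reasoning
    w : ℕ → Carrier
    w x = u (x ℕ.+ s)

  modularInverse : ∀ {d p} .{{_ : NonZero p}} → Coprime d p → ∃ λ e → (d ℕ.* e) % p ≡ 1 % p
  modularInverse {d} {p} d⊥p with coprime-Bézout d⊥p
  ... | Bézout.Identity.+- x y eq = x , (begin
    (d ℕ.* x) % p          ≡⟨ cong (_% p) (≡.trans (ℕₚ.*-comm d x) (≡.sym eq)) ⟩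
    (1 ℕ.+ y ℕ.* p) % p    ≡⟨ [m+kn]%n≡m%n 1 y p ⟩
    1 % p                  ∎)
    where open ≡.≡-Reasoning
  -- Here dx ≡ -1, so x(dx) is an inverse because (dx)² ≡ 1. Adding 2yp completes the square: (dx)²
  -- + 2(1 + dx) = 1 + (1 + dx)², which avoids subtraction.
  ... | Bézout.Identity.-+ x y eq = x ℕ.* (d ℕ.* x) , (begin
    (d ℕ.* (x ℕ.* (d ℕ.* x))) % p                       ≡⟨ [m+kn]%n≡m%n _ (2 ℕ.* y) p ⟨
    (d ℕ.* (x ℕ.* (d ℕ.* x)) ℕ.+ 2 ℕ.* y ℕ.* p) % p     ≡⟨ cong (_% p) square ⟩
    (1 ℕ.+ (y ℕ.* p ℕ.* y) ℕ.* p) % p                   ≡⟨ [m+kn]%n≡m%n 1 (y ℕ.* p ℕ.* y) p ⟩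
    1 % p                                               ∎)
    where
    open ≡.≡-Reasoning
    expand : ∀ d x → d ℕ.* (x ℕ.* (d ℕ.* x)) ℕ.+ 2 ℕ.* (1 ℕ.+ x ℕ.* d) ≡ 1 ℕ.+ (1 ℕ.+ x ℕ.* d) ℕ.* (1 ℕ.+ x ℕ.* d)
    expand = solve-∀
    square : d ℕ.* (x ℕ.* (d ℕ.* x)) ℕ.+ 2 ℕ.* y ℕ.* p ≡ 1 ℕ.+ (y ℕ.* p ℕ.* y) ℕ.* p
    square = begin
      d ℕ.* (x ℕ.* (d ℕ.* x)) ℕ.+ 2 ℕ.* y ℕ.* p            ≡⟨ cong (d ℕ.* (x ℕ.* (d ℕ.* x)) ℕ.+_) (≡.trans (ℕₚ.*-assoc 2 y p) (cong (2 ℕ.*_) (≡.sym eq))) ⟩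
      d ℕ.* (x ℕ.* (d ℕ.* x)) ℕ.+ 2 ℕ.* (1 ℕ.+ x ℕ.* d)    ≡⟨ expand d x ⟩
      1 ℕ.+ (1 ℕ.+ x ℕ.* d) ℕ.* (1 ℕ.+ x ℕ.* d)            ≡⟨ cong (λ t → 1 ℕ.+ t ℕ.* t) eq ⟩
      1 ℕ.+ (y ℕ.* p) ℕ.* (y ℕ.* p)                        ≡⟨ cong (1 ℕ.+_) (≡.sym (ℕₚ.*-assoc (y ℕ.* p) y p)) ⟩
      1 ℕ.+ (y ℕ.* p ℕ.* y) ℕ.* p                          ∎

  -- Multiplication by d permutes the residues modulo p; the inverse permutation is multiplication
  -- by a modular inverse of d.
  Σ-dilate : ∀ {p d φ} → 0 ℕ.< p → Periodic p φ → Coprime d p → Σ< p (λ j → φ (j ℕ.* d)) ≈ Σ< p φ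
  Σ-dilate {p@(suc _)} {d} {φ} _ per d⊥p with e , de≡1 ← modularInverse d⊥p = sym (begin
    Σ< p φ                            ≡⟨ Σ≡sum p φ ⟩
    sum {p} (λ i → φ (toℕ i))         ≈⟨ sum-permute {p} {p} (λ i → φ (toℕ i)) (permutation (times d) (times e) (inverse d e de≡1) (inverse e d (≡.trans (cong (_% p) (ℕₚ.*-comm e d)) de≡1))) ⟩
    sum {p} (λ i → φ (toℕ (times d i))) ≈⟨ sum-cong-≋ {p} (λ i → reflexive (cong φ (Finₚ.toℕ-fromℕ< (m%n<n (toℕ i ℕ.* d) p)))) ⟩
    sum {p} (λ i → φ ((toℕ i ℕ.* d) % p)) ≡⟨ Σ≡sum p (λ j → φ ((j ℕ.* d) % p)) ⟨
    Σ< p (λ j → φ ((j ℕ.* d) % p))    ≈⟨ Σ-cong p (λ j → periodic-% {p} {φ} per (j ℕ.* d)) ⟨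
    Σ< p (λ j → φ (j ℕ.* d))          ∎)
    where
    open ≈-Reasoning
    times : ℕ → Fin p → Fin p
    times c i = fromℕ< (m%n<n (toℕ i ℕ.* c) p)
    inverse : ∀ a b → (a ℕ.* b) % p ≡ 1 % p → ∀ i → times a (times b i) ≡ i
    inverse a b ab≡1 i = Finₚ.toℕ-injective (P.begin
      toℕ (times a (times b i))                            P.≡⟨ Finₚ.toℕ-fromℕ< (m%n<n (toℕ (times b i) ℕ.* a) p) ⟩
      (toℕ (times b i) ℕ.* a) % p                          P.≡⟨ cong (λ t → (t ℕ.* a) % p) (Finₚ.toℕ-fromℕ< (m%n<n (toℕ i ℕ.* b) p)) ⟩
      ((toℕ i ℕ.* b) % p ℕ.* a) % p                        P.≡⟨ %-*ˡ (toℕ i ℕ.* b) a ⟩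
      (toℕ i ℕ.* b ℕ.* a) % p                              P.≡⟨ cong (_% p) (≡.trans (ℕₚ.*-assoc (toℕ i) b a) (≡.trans (ℕₚ.*-comm (toℕ i) (b ℕ.* a)) (cong (ℕ._* toℕ i) (ℕₚ.*-comm b a)))) ⟩
      (a ℕ.* b ℕ.* toℕ i) % p                              P.≡⟨ %-*ˡ (a ℕ.* b) (toℕ i) ⟨
      ((a ℕ.* b) % p ℕ.* toℕ i) % p                        P.≡⟨ cong (λ t → (t ℕ.* toℕ i) % p) ab≡1 ⟩
      (1 % p ℕ.* toℕ i) % p                                P.≡⟨ %-*ˡ 1 (toℕ i) ⟩
      (1 ℕ.* toℕ i) % p                                    P.≡⟨ cong (_% p) (ℕₚ.*-identityˡ (toℕ i)) ⟩
      toℕ i % p                                            P.≡⟨ m<n⇒m%n≡m (Finₚ.toℕ<n i) ⟩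
      toℕ i                                                P.∎)
      where
      module P = ≡.≡-Reasoning
      %-*ˡ : ∀ m n → (m % p ℕ.* n) % p ≡ (m ℕ.* n) % p
      %-*ˡ m n = ≡.trans (%-distribˡ-* (m % p) n p) (≡.trans (cong (λ t → (t ℕ.* (n % p)) % p) (m%n%n≡m%n m p)) (≡.sym (%-distribˡ-* m n p)))

  Σ1/p² : List ℕ → Carrier
  Σ1/p² []       = 0#
  Σ1/p² (p ∷ ps) = fromℕ p ⁻¹ * fromℕ p ⁻¹ + Σ1/p² ps

  Σ1/p²-nonNeg : ∀ ps → 0# ≤ Σ1/p² ps
  Σ1/p²-nonNeg []       = ≤-refl
  Σ1/p²-nonNeg (p ∷ ps) = +-nonNeg (0≤x*x _) (Σ1/p²-nonNeg ps)

-- Functions on ℕ of period M stand for functions on ℤ/M.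
module SecondMoment (ℝ : CompleteOrderedField) (M : ℕ) where

  open CompleteOrderedField ℝ
  open OrderedField ℝ
  open Summation ℝ

  -- Averages, projections and their energies

  Divisor : ℕ → Set
  Divisor p = 0 ℕ.< p × p ∣ M

  -- The step s is a parameter because P_p is also used in the forms with step m/p, on functions of
  -- a smaller period m, and with step q(M/p) for q coprime to p; `avg-dilate` identifies them.
  avg : ℕ → ℕ → (ℕ → Carrier) → ℕ → Carrier
  avg p s u x = fromℕ p ⁻¹ * Σ< p λ j → u (x ℕ.+ j ℕ.* s)

  -- The orthogonal projection onto the functions of period M/p.
  proj : ℕ → (ℕ → Carrier) → ℕ → Carrier
  proj p = avg p (M div p)

  ‖_‖² : (ℕ → Carrier) → Carrier
  ‖ u ‖² = Σ< M λ x → u x * u x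

  infixl 6 _⊝_
  _⊝_ : (ℕ → Carrier) → (ℕ → Carrier) → ℕ → Carrier
  (u ⊝ v) x = u x - v x

  ‖‖²-cong : ∀ {u v : ℕ → Carrier} → (∀ x → u x ≈ v x) → ‖ u ‖² ≈ ‖ v ‖²
  ‖‖²-cong u≈v = Σ-cong M λ x → *-cong (u≈v x) (u≈v x)

  ‖‖²-nonNeg : ∀ u → 0# ≤ ‖ u ‖²
  ‖‖²-nonNeg u = Σ-nonNeg M λ x → 0≤x*x (u x)

  proj-cong : ∀ p {u v : ℕ → Carrier} → (∀ x → u x ≈ v x) → ∀ x → proj p u x ≈ proj p v x
  proj-cong p u≈v x = *-congˡ (Σ-cong p λ j → u≈v _)

  proj-⊝ : ∀ p u v x → proj p (u ⊝ v) x ≈ (proj p u ⊝ proj p v) x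
  proj-⊝ p u v x = trans (*-congˡ (trans (Σ-+ p _ _) (+-congˡ (Σ-neg p _))))
    (solve 3 (λ i a b → i :* (a :- b) := i :* a :- i :* b) refl (fromℕ p ⁻¹) _ _)

  proj-comm : ∀ p q u x → proj p (proj q u) x ≈ proj q (proj p u) x
  proj-comm p q u x = begin
    i * Σ< p (λ a → j * Σ< q (λ b → u (x ℕ.+ a ℕ.* s ℕ.+ b ℕ.* t)))    ≈⟨ *-congˡ (Σ-* p j _) ⟩
    i * (j * Σ< p (λ a → Σ< q (λ b → u (x ℕ.+ a ℕ.* s ℕ.+ b ℕ.* t))))  ≈⟨ *-congˡ (*-congˡ (Σ-comm p q λ a b → u (x ℕ.+ a ℕ.* s ℕ.+ b ℕ.* t))) ⟩
    i * (j * Σ< q (λ b → Σ< p (λ a → u (x ℕ.+ a ℕ.* s ℕ.+ b ℕ.* t))))  ≈⟨ solve 3 (λ i j z → i :* (j :* z) := j :* (i :* z)) refl i j _ ⟩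
    j * (i * Σ< q (λ b → Σ< p (λ a → u (x ℕ.+ a ℕ.* s ℕ.+ b ℕ.* t))))  ≈⟨ *-congˡ (*-congˡ (Σ-cong q λ b → Σ-cong p λ a → reflexive (cong u (swap x (a ℕ.* s) (b ℕ.* t))))) ⟩
    j * (i * Σ< q (λ b → Σ< p (λ a → u (x ℕ.+ b ℕ.* t ℕ.+ a ℕ.* s))))  ≈⟨ *-congˡ (Σ-* q i _) ⟨
    j * Σ< q (λ b → i * Σ< p (λ a → u (x ℕ.+ b ℕ.* t ℕ.+ a ℕ.* s)))    ∎
    where
    open ≈-Reasoning
    i = fromℕ p ⁻¹
    j = fromℕ q ⁻¹
    s = M div p
    t = M div q
    swap : ∀ x a b → x ℕ.+ a ℕ.+ b ≡ x ℕ.+ b ℕ.+ a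
    swap = solve-∀

  periodic-proj : ∀ {m} p {u} → Periodic m u → Periodic m (proj p u)
  periodic-proj {m} p {u} per x = *-congˡ (Σ-cong p λ j →
    trans (reflexive (cong u (swap x m (j ℕ.* (M div p))))) (per _))
    where
    swap : ∀ x a b → x ℕ.+ a ℕ.+ b ≡ x ℕ.+ b ℕ.+ a
    swap = solve-∀

  periodic-⊝ : ∀ {m u v} → Periodic m u → Periodic m v → Periodic m (u ⊝ v)
  periodic-⊝ pu pv x = +-cong (pu x) (-‿cong (pv x))

  periodic-translates : ∀ p s {u} x → Periodic (p ℕ.* s) u → Periodic p (λ j → u (x ℕ.+ j ℕ.* s))
  periodic-translates p s {u} x per j = trans (reflexive (cong u (expand x j p s))) (per _)
    where
    expand : ∀ x j p s → x ℕ.+ (j ℕ.+ p) ℕ.* s ≡ x ℕ.+ j ℕ.* s ℕ.+ p ℕ.* s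
    expand = solve-∀

  avg-periodic : ∀ p s {u} → Periodic (p ℕ.* s) u → Periodic s (avg p s u)
  avg-periodic p s {u} per x = *-congˡ (trans
    (Σ-cong p λ j → reflexive (cong u (regroup x s j)))
    (Σ-shift {p} {λ j → u (x ℕ.+ j ℕ.* s)} (periodic-translates p s {u} x per) 1))
    where
    regroup : ∀ x s j → x ℕ.+ s ℕ.+ j ℕ.* s ≡ x ℕ.+ (j ℕ.+ 1) ℕ.* s
    regroup = solve-∀

  proj-periodic : ∀ {p u} → Divisor p → Periodic M u → Periodic (M div p) (proj p u)
  proj-periodic {p} {u} (0<p , p∣M) per =
    avg-periodic p (M div p) {u} (subst (λ m → Periodic m u) (≡.sym (*-div 0<p p∣M)) per)

  -- Translation by a multiple of M/p fixes `w` and preserves sums over a full period, so all p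
  -- translates of `u` have the same inner product with `w`.
  Σ-proj : ∀ {p u w} → Divisor p → Periodic M u → Periodic (M div p) w →
           Σ< M (λ x → proj p u x * w x) ≈ Σ< M (λ x → u x * w x)
  Σ-proj {p} {u} {w} (0<p , p∣M) pu pw = begin
    Σ< M (λ x → i * Σ< p (λ j → u (x ℕ.+ j ℕ.* s)) * w x)   ≈⟨ Σ-cong M (λ x → trans (*-assoc _ _ _) (*-congˡ (trans (*-comm _ _) (sym (Σ-* p (w x) _))))) ⟩
    Σ< M (λ x → i * Σ< p (λ j → w x * u (x ℕ.+ j ℕ.* s)))   ≈⟨ Σ-* M i _ ⟩
    i * Σ< M (λ x → Σ< p (λ j → w x * u (x ℕ.+ j ℕ.* s)))   ≈⟨ *-congˡ (Σ-comm M p _) ⟩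
    i * Σ< p (λ j → Σ< M (λ x → w x * u (x ℕ.+ j ℕ.* s)))   ≈⟨ *-congˡ (Σ-cong p translate) ⟩
    i * Σ< p (λ j → Σ< M (λ x → u x * w x))                 ≈⟨ *-congˡ (Σ-const p _) ⟩
    i * (fromℕ p * Σ< M (λ x → u x * w x))                  ≈⟨ *-assoc _ _ _ ⟨
    i * fromℕ p * Σ< M (λ x → u x * w x)                    ≈⟨ *-congʳ (*-inverseˡ (fromℕ-pos 0<p)) ⟩
    1# * Σ< M (λ x → u x * w x)                             ≈⟨ *-identityˡ _ ⟩
    Σ< M (λ x → u x * w x)                                  ∎
    where
    open ≈-Reasoning
    i = fromℕ p ⁻¹
    s = M div p
    pwM : Periodic M w
    pwM = subst (λ m → Periodic m w) (*-div 0<p p∣M) (periodic-* {s} {w} pw p)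
    translate : ∀ j → Σ< M (λ x → w x * u (x ℕ.+ j ℕ.* s)) ≈ Σ< M (λ x → u x * w x)
    translate j = begin
      Σ< M (λ x → w x * u (x ℕ.+ j ℕ.* s))                ≈⟨ Σ-cong M (λ x → trans (*-comm _ _) (*-congˡ (sym (periodic-* {s} {w} pw j x)))) ⟩
      Σ< M (λ x → u (x ℕ.+ j ℕ.* s) * w (x ℕ.+ j ℕ.* s))  ≈⟨ Σ-shift {M} {λ x → u x * w x} (λ x → *-cong (pu x) (pwM x)) (j ℕ.* s) ⟩
      Σ< M (λ x → u x * w x)                              ∎

  -- `proj p u` has period M/p, so `Σ-proj` with w = `proj p u` makes it orthogonal to the
  -- remainder; the mixed term vanishes.
  pythagoras : ∀ {p u} → Divisor p → Periodic M u → ‖ u ‖² ≈ ‖ proj p u ‖² + ‖ u ⊝ proj p u ‖²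
  pythagoras {p} {u} pM per = begin
    Σ< M (λ x → u x * u x)
      ≈⟨ Σ-cong M (λ x → solve 2 (λ a b → a :* a := b :* b :+ (a :- b) :* (a :- b) :+ :2 :* (a :* b :- b :* b)) refl (u x) (v x)) ⟩
    Σ< M (λ x → v x * v x + (u x - v x) * (u x - v x) + fromℕ 2 * (u x * v x - v x * v x))
      ≈⟨ trans (Σ-+ M _ _) (+-cong (Σ-+ M _ _) (trans (Σ-* M (fromℕ 2) _) (*-congˡ (trans (Σ-+ M _ _) (+-congˡ (Σ-neg M _)))))) ⟩
    ‖ v ‖² + ‖ u ⊝ v ‖² + fromℕ 2 * (Σ< M (λ x → u x * v x) - ‖ v ‖²)
      ≈⟨ +-congˡ (*-congˡ (+-congʳ (sym (Σ-proj {p} {u} {v} pM per (proj-periodic pM per))))) ⟩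
    ‖ v ‖² + ‖ u ⊝ v ‖² + fromℕ 2 * (‖ v ‖² - ‖ v ‖²)
      ≈⟨ solve 2 (λ a b → a :+ b :+ :2 :* (a :- a) := a :+ b) refl _ _ ⟩
    ‖ v ‖² + ‖ u ⊝ v ‖² ∎
    where
    open ≈-Reasoning
    v = proj p u

  -- The sum of ‖ proj q₁ (⋯ (proj qₖ u)) ‖² over the k-element sublists of ps.
  energy : ℕ → List ℕ → (ℕ → Carrier) → Carrier
  energy zero    ps       u = ‖ u ‖²
  energy (suc k) []       u = 0#
  energy (suc k) (p ∷ ps) u = energy k ps (proj p u) + energy (suc k) ps u

  energy-cong : ∀ k ps {u v : ℕ → Carrier} → (∀ x → u x ≈ v x) → energy k ps u ≈ energy k ps v
  energy-cong zero    ps       u≈v = ‖‖²-cong u≈v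
  energy-cong (suc k) []       u≈v = refl
  energy-cong (suc k) (p ∷ ps) u≈v = +-cong (energy-cong k ps (proj-cong p u≈v)) (energy-cong (suc k) ps u≈v)

  proj-complement : ∀ p q u x → proj q (u ⊝ proj p u) x ≈ (proj q u ⊝ proj p (proj q u)) x
  proj-complement p q u x = trans (proj-⊝ q u (proj p u) x) (+-congˡ (-‿cong (proj-comm q p u x)))

  -- 1 - P_p is itself an orthogonal projection and commutes with every P_q, so it can only shorten
  -- the vectors whose norms are summed.
  energy-complement : ∀ k ps {p u} → Divisor p → Periodic M u → energy k ps (u ⊝ proj p u) ≤ energy k ps u
  energy-complement zero ps {p} {u} pM per =
    ≤-by (‖‖²-nonNeg (proj p u)) (trans (+-comm _ _) (sym (pythagoras pM per)))
  energy-complement (suc k) []       pM per = ≤-refl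
  energy-complement (suc k) (q ∷ ps) {p} {u} pM per = +-mono-≤
    (≤-respˡ-≈ (sym (energy-cong k ps (proj-complement p q u))) (energy-complement k ps pM (periodic-proj q per)))
    (energy-complement (suc k) ps pM per)

  -- Because the projections commute, the orthogonal splitting of u along P_p carries over to each
  -- P_q u.
  energy₁-pythagoras : ∀ ps {p u} → Divisor p → Periodic M u →
                       energy 1 ps u ≈ energy 1 ps (proj p u) + energy 1 ps (u ⊝ proj p u)
  energy₁-pythagoras []       pM per = sym (+-identityˡ 0#)
  energy₁-pythagoras (q ∷ ps) {p} {u} pM per = trans
    (+-cong (trans (pythagoras pM (periodic-proj q per))
               (+-cong (‖‖²-cong (proj-comm p q u)) (‖‖²-cong (λ x → sym (proj-complement p q u x)))))
      (energy₁-pythagoras ps pM per))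
    (solve 4 (λ a b c d → a :+ b :+ (c :+ d) := a :+ c :+ (b :+ d)) refl _ _ _ _)

  -- In spectral terms: a frequency lying in the range of ω of the projections
  -- contributes ω to the left-hand side and k + C(ω, k+1) ≥ ω to the right.
  energy₁≤ : ∀ k ps {u} → All Divisor ps → Periodic M u →
             energy 1 ps u ≤ fromℕ k * ‖ u ‖² + energy (suc k) ps u
  energy₁≤ zero ps _ _ = ≤-reflexive (sym (trans (+-congʳ (zeroˡ _)) (+-identityˡ _)))
  energy₁≤ (suc k) [] {u} _ _ = +-nonNeg (*-nonNeg (fromℕ-nonNeg (suc k)) (‖‖²-nonNeg u)) ≤-refl
  energy₁≤ (suc k) (p ∷ ps) {u} (pM ∷ psM) per = begin
    ‖ v ‖² + energy 1 ps u
      ≈⟨ +-congˡ (energy₁-pythagoras ps pM per) ⟩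
    ‖ v ‖² + (energy 1 ps v + energy 1 ps w)
      ≤⟨ +-monoʳ-≤ _ (+-mono-≤ (energy₁≤ k ps psM (periodic-proj p per)) (energy₁≤ (suc k) ps psM (periodic-⊝ {M} {u} {v} per (periodic-proj p per)))) ⟩
    ‖ v ‖² + (fromℕ k * ‖ v ‖² + energy (suc k) ps v + (fromℕ (suc k) * ‖ w ‖² + energy (suc (suc k)) ps w))
      ≤⟨ +-monoʳ-≤ _ (+-monoʳ-≤ _ (+-monoʳ-≤ _ (energy-complement (suc (suc k)) ps pM per))) ⟩
    ‖ v ‖² + (fromℕ k * ‖ v ‖² + energy (suc k) ps v + (fromℕ (suc k) * ‖ w ‖² + energy (suc (suc k)) ps u))
      ≈⟨ solve 5 (λ v w k a b → v :+ (k :* v :+ a :+ ((:1 :+ k) :* w :+ b)) := (:1 :+ k) :* (v :+ w) :+ (a :+ b)) refl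
           ‖ v ‖² ‖ w ‖² (fromℕ k) (energy (suc k) ps v) (energy (suc (suc k)) ps u) ⟩
    fromℕ (suc k) * (‖ v ‖² + ‖ w ‖²) + (energy (suc k) ps v + energy (suc (suc k)) ps u)
      ≈⟨ +-congʳ (*-congˡ (pythagoras pM per)) ⟨
    fromℕ (suc k) * ‖ u ‖² + (energy (suc k) ps v + energy (suc (suc k)) ps u) ∎
    where
    open ≤-Reasoning
    v = proj p u
    w = u ⊝ proj p u

  -- v bounds the increments of u, so a sum of v bounds the variation of u.
  Majorises : (v u : ℕ → Carrier) → Set
  Majorises v u = ∀ x → u (suc x) ≤ u x + v x × u x ≤ u (suc x) + v x

  -- Variation and decay under repeated projection

  Σ-avg : ∀ p s u → Σ< s (avg p s u) ≈ fromℕ p ⁻¹ * Σ< (p ℕ.* s) u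
  Σ-avg p s u = begin
    Σ< s (λ x → fromℕ p ⁻¹ * Σ< p (λ j → u (x ℕ.+ j ℕ.* s)))  ≈⟨ Σ-* s (fromℕ p ⁻¹) _ ⟩
    fromℕ p ⁻¹ * Σ< s (λ x → Σ< p (λ j → u (x ℕ.+ j ℕ.* s)))  ≈⟨ *-congˡ (Σ-comm s p _) ⟩
    fromℕ p ⁻¹ * Σ< p (λ j → Σ< s (λ x → u (x ℕ.+ j ℕ.* s)))  ≈⟨ *-congˡ (Σ-cong p λ j → Σ-cong s λ x → reflexive (cong u (ℕₚ.+-comm x _))) ⟩
    fromℕ p ⁻¹ * Σ< p (λ j → Σ< s (λ x → u (j ℕ.* s ℕ.+ x)))  ≈⟨ *-congˡ (Σ-block p s u) ⟨
    fromℕ p ⁻¹ * Σ< (p ℕ.* s) u                               ∎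
    where open ≈-Reasoning

  -- Modulo the period ps, the multiples of ds are those of s in another order. In `energy≤`, d is
  -- the product of the primes already projected out, and this lets P_p act on functions of period m
  -- = M/d as the average with step m/p.
  avg-dilate : ∀ {p d} s {u} → 0 ℕ.< p → Coprime d p → Periodic (p ℕ.* s) u → ∀ x →
               avg p (d ℕ.* s) u x ≈ avg p s u x
  avg-dilate {p} {d} s {u} 0<p d⊥p per x = *-congˡ (trans
    (Σ-cong p λ j → reflexive (cong (λ y → u (x ℕ.+ y)) (≡.sym (ℕₚ.*-assoc j d s))))
    (Σ-dilate {p} {d} {λ j → u (x ℕ.+ j ℕ.* s)} 0<p (periodic-translates p s {u} x per) d⊥p))

  majorises-avg : ∀ {p v u} s → 0 ℕ.< p → Majorises v u → Majorises (avg p s v) (avg p s u)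
  majorises-avg {p} {v} {u} s 0<p maj x =
    average (λ j → proj₁ (maj (x ℕ.+ j ℕ.* s))) , average (λ j → proj₂ (maj (x ℕ.+ j ℕ.* s)))
    where
    average : ∀ {φ ψ χ : ℕ → Carrier} → (∀ j → φ j ≤ ψ j + χ j) →
              fromℕ p ⁻¹ * Σ< p φ ≤ fromℕ p ⁻¹ * Σ< p ψ + fromℕ p ⁻¹ * Σ< p χ
    average {φ} {ψ} {χ} le = ≤-respʳ-≈ (trans (*-congˡ (Σ-+ p ψ χ)) (distribˡ _ _ _))
      (*-monoˡ-≤ (⁻¹-nonNeg (fromℕ-pos 0<p)) (Σ-mono p le))

  avg-nonNeg : ∀ {p v} s → 0 ℕ.< p → (∀ x → 0# ≤ v x) → ∀ x → 0# ≤ avg p s v x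
  avg-nonNeg {p} s 0<p 0≤v x = *-nonNeg (⁻¹-nonNeg (fromℕ-pos 0<p)) (Σ-nonNeg p λ j → 0≤v _)

  Σ-increase : ∀ {k m} {v : ℕ → Carrier} → k ℕ.≤ m → (∀ x → 0# ≤ v x) → Σ< k v ≤ Σ< m v
  Σ-increase {zero}  {m} z≤n       0≤v = Σ-nonNeg m 0≤v
  Σ-increase (s≤s k≤m) 0≤v = +-monoʳ-≤ _ (Σ-increase k≤m λ x → 0≤v (suc x))

  majorises-step : ∀ {v u} → Majorises v u → ∀ k x →
                   u (x ℕ.+ k) ≤ u x + Σ< k (λ i → v (i ℕ.+ x)) × u x ≤ u (x ℕ.+ k) + Σ< k (λ i → v (i ℕ.+ x))
  majorises-step {v} {u} maj zero x rewrite ℕₚ.+-identityʳ x =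
    ≤-reflexive (sym (+-identityʳ _)) , ≤-reflexive (sym (+-identityʳ _))
  majorises-step {v} {u} maj (suc k) x with majorises-step {v} {u} maj k (suc x) | maj x
  ... | up , down | up₁ , down₁ rewrite ℕₚ.+-suc x k = up′ , down′
    where
    shifted : Σ< k (λ i → v (i ℕ.+ suc x)) ≈ Σ< k (λ i → v (suc i ℕ.+ x))
    shifted = Σ-cong k λ i → reflexive (cong v (ℕₚ.+-suc i x))
    up′ : u (suc (x ℕ.+ k)) ≤ u x + (v x + Σ< k (λ i → v (suc i ℕ.+ x)))
    up′ = ≤-respʳ-≈ (trans (+-congˡ shifted) (+-assoc _ _ _)) (≤-trans up (+-monoˡ-≤ _ up₁))
    down′ : u x ≤ u (suc (x ℕ.+ k)) + (v x + Σ< k (λ i → v (suc i ℕ.+ x)))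
    down′ = ≤-respʳ-≈ (trans (+-congʳ (+-congˡ shifted)) (solve 3 (λ a b c → a :+ b :+ c := a :+ (c :+ b)) refl _ _ _))
      (≤-trans down₁ (+-monoˡ-≤ _ down))

  -- Within a period `u` changes by at most V, so every value is within V of the mean, which is 0.
  mean-zero⇒square≤ : ∀ {m u v V} → 0 ℕ.< m → Periodic m u → Periodic m v → Σ< m u ≈ 0# →
                      (∀ x → 0# ≤ v x) → Majorises v u → Σ< m v ≤ V → ∀ x → u x * u x ≤ V * V
  mean-zero⇒square≤ {m} {u} {v} {V} 0<m pu pv mean 0≤v maj Σv≤V x =
    ≤-by (*-nonNeg (x≤y⇒0≤y-x upper) lower) (solve 2 (λ u V → u :* u :+ (V :- u) :* (V :+ u) := V :* V) refl (u x) V)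
    where
    oscillation : ∀ {k} → k ℕ.< m → Σ< k (λ i → v (i ℕ.+ x)) ≤ V
    oscillation {k} k<m = ≤-trans (Σ-increase (ℕₚ.<⇒≤ k<m) λ i → 0≤v _) (≤-respˡ-≈ (sym (Σ-shift {m} {v} pv x)) Σv≤V)
    mean′ : Σ< m (λ k → u (x ℕ.+ k)) ≈ 0#
    mean′ = trans (Σ-cong m λ k → reflexive (cong u (ℕₚ.+-comm x k))) (trans (Σ-shift {m} {u} pu x) mean)
    upper : u x ≤ V
    upper = *-cancelˡ-≤ (fromℕ-pos 0<m) (begin
      fromℕ m * u x                        ≈⟨ Σ-const m (u x) ⟨
      Σ< m (λ k → u x)                     ≤⟨ Σ-mono< m (λ {k} k<m → ≤-trans (proj₂ (majorises-step {v} {u} maj k x)) (+-monoʳ-≤ _ (oscillation k<m))) ⟩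
      Σ< m (λ k → u (x ℕ.+ k) + V)         ≈⟨ Σ-+ m (λ k → u (x ℕ.+ k)) (λ _ → V) ⟩
      Σ< m (λ k → u (x ℕ.+ k)) + Σ< m (λ _ → V) ≈⟨ +-cong mean′ (Σ-const m V) ⟩
      0# + fromℕ m * V                     ≈⟨ +-identityˡ _ ⟩
      fromℕ m * V                          ∎)
      where open ≤-Reasoning
    lower : 0# ≤ V + u x
    lower = *-cancelˡ-≤ (fromℕ-pos 0<m) (begin
      fromℕ m * 0#                         ≈⟨ zeroʳ _ ⟩
      0#                                   ≈⟨ mean′ ⟨
      Σ< m (λ k → u (x ℕ.+ k))             ≤⟨ Σ-mono< m (λ {k} k<m → ≤-trans (proj₁ (majorises-step {v} {u} maj k x)) (≤-respʳ-≈ (+-comm _ _) (+-monoʳ-≤ _ (oscillation k<m)))) ⟩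
      Σ< m (λ k → V + u x)                 ≈⟨ Σ-const m _ ⟩
      fromℕ m * (V + u x)                  ∎)
      where open ≤-Reasoning

  majorises-cong : ∀ {v v′ u u′} → (∀ x → v x ≈ v′ x) → (∀ x → u x ≈ u′ x) → Majorises v u → Majorises v′ u′
  majorises-cong v≈ u≈ maj x =
      ≤-respˡ-≈ (u≈ (suc x)) (≤-respʳ-≈ (+-cong (u≈ x) (v≈ x)) (proj₁ (maj x)))
    , ≤-respˡ-≈ (u≈ x) (≤-respʳ-≈ (+-cong (u≈ (suc x)) (v≈ x)) (proj₂ (maj x)))

  -- Each projection divides both the period and the variation by p.
  energy≤ : ∀ k ps {d m u v V} → d ℕ.* m ≡ M → 0 ℕ.< m → Periodic m u → Periodic m v → Σ< m u ≈ 0# →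
            (∀ x → 0# ≤ v x) → Majorises v u → Σ< m v ≤ V →
            All Divisor ps → All (Coprime d) ps → AllPairs Coprime ps →
            energy k ps u ≤ fromℕ M * (V * V) * Σ1/p² ps ^ k
  energy≤ zero ps {u = u} {V = V} _ 0<m pu pv mean 0≤v maj Σv≤V _ _ _ = begin
    ‖ u ‖²                       ≤⟨ Σ-mono M (mean-zero⇒square≤ 0<m pu pv mean 0≤v maj Σv≤V) ⟩
    Σ< M (λ _ → V * V)           ≈⟨ Σ-const M (V * V) ⟩
    fromℕ M * (V * V)            ≈⟨ *-identityʳ _ ⟨
    fromℕ M * (V * V) * 1#       ∎
    where open ≤-Reasoning
  energy≤ (suc k) [] {V = V} _ _ _ _ _ _ _ _ _ _ _ =
    *-nonNeg (*-nonNeg (fromℕ-nonNeg M) (0≤x*x V)) (^-nonNeg (suc k) ≤-refl)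
  energy≤ (suc k) (p ∷ ps) {d} {m} {u} {v} {V} dm≡M 0<m pu pv mean 0≤v maj Σv≤V (pM@(0<p , p∣M) ∷ psM) (d⊥p ∷ d⊥ps) (p⊥ps ∷ ps⊥) = begin
    energy k ps (proj p u) + energy (suc k) ps u
      ≤⟨ +-mono-≤
           (energy≤ k ps {d ℕ.* p} {m′} {proj p u} {avg p m′ v} {i * V} dpm′≡M 0<m′
             (λ x → trans (proj≈ (x ℕ.+ m′)) (trans (avg-periodic p m′ {u} pu′ x) (sym (proj≈ x))))
             (avg-periodic p m′ {v} pv′)
             (trans (Σ-cong m′ proj≈) (trans (Σ-avg p m′ u) (trans (*-congˡ (trans (reflexive (cong (λ n → Σ< n u) pm′≡m)) mean)) (zeroʳ i))))
             (avg-nonNeg m′ 0<p 0≤v)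
             (majorises-cong (λ _ → refl) (λ x → sym (proj≈ x)) (majorises-avg {p} {v} {u} m′ 0<p maj))
             (≤-respˡ-≈ (sym (trans (Σ-avg p m′ v) (*-congˡ (reflexive (cong (λ n → Σ< n v) pm′≡m))))) (*-monoˡ-≤ (⁻¹-nonNeg (fromℕ-pos 0<p)) Σv≤V))
             psM (All.zipWith {P = Coprime d} {Q = Coprime p} {R = Coprime (d ℕ.* p)} (λ (d⊥q , p⊥q) → coprime-* d⊥q p⊥q) (d⊥ps , p⊥ps)) ps⊥)
           (energy≤ (suc k) ps dm≡M 0<m pu pv mean 0≤v maj Σv≤V psM d⊥ps ps⊥) ⟩
    fromℕ M * (i * V * (i * V)) * σ ^ k + fromℕ M * (V * V) * (σ * σ ^ k)
      ≈⟨ solve 5 (λ M V i σ z → M :* (i :* V :* (i :* V)) :* z :+ M :* (V :* V) :* (σ :* z) := M :* (V :* V) :* ((i :* i :+ σ) :* z)) refl (fromℕ M) V i σ (σ ^ k) ⟩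
    fromℕ M * (V * V) * ((i * i + σ) * σ ^ k)
      ≤⟨ *-monoˡ-≤ (*-nonNeg (fromℕ-nonNeg M) (0≤x*x V)) (*-monoˡ-≤ (Σ1/p²-nonNeg (p ∷ ps))
           (^-mono-≤ k (Σ1/p²-nonNeg ps) (≤-by (0≤x*x i) (+-comm _ _)))) ⟩
    fromℕ M * (V * V) * ((i * i + σ) * (i * i + σ) ^ k) ∎
    where
    open ≤-Reasoning
    i = fromℕ p ⁻¹
    σ = Σ1/p² ps
    p∣m : p ∣ m
    p∣m = coprime-divisor (Coprime.sym d⊥p) (subst (p ∣_) (≡.sym dm≡M) p∣M)
    m′ = m div p
    pm′≡m : p ℕ.* m′ ≡ m
    pm′≡m = *-div 0<p p∣m
    0<m′ : 0 ℕ.< m′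
    0<m′ = div-pos 0<p p∣m 0<m
    dpm′≡M : d ℕ.* p ℕ.* m′ ≡ M
    dpm′≡M = ≡.trans (ℕₚ.*-assoc d p m′) (≡.trans (cong (d ℕ.*_) pm′≡m) dm≡M)
    M/p≡dm′ : M div p ≡ d ℕ.* m′
    M/p≡dm′ = ℕₚ.*-cancelˡ-≡ _ _ p {{>-nonZero 0<p}} (≡.trans (*-div 0<p p∣M) (≡.trans (≡.sym dpm′≡M) (swap d p m′)))
      where
      swap : ∀ d p m → d ℕ.* p ℕ.* m ≡ p ℕ.* (d ℕ.* m)
      swap = solve-∀
    pu′ : Periodic (p ℕ.* m′) u
    pu′ = subst (λ n → Periodic n u) (≡.sym pm′≡m) pu
    pv′ : Periodic (p ℕ.* m′) v
    pv′ = subst (λ n → Periodic n v) (≡.sym pm′≡m) pv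
    proj≈ : ∀ x → proj p u x ≈ avg p m′ u x
    proj≈ x = trans (reflexive (cong (λ s → avg p s u x) M/p≡dm′)) (avg-dilate m′ {u} 0<p d⊥p pu′ x)

  -- Correlation of two dilates

  Σ-periods : ∀ a {m u} → Periodic m u → Σ< (a ℕ.* m) u ≈ fromℕ a * Σ< m u
  Σ-periods a {m} {u} per = trans (Σ-block a m u) (trans
    (Σ-cong a λ i → Σ-cong m λ r → trans (reflexive (cong u (ℕₚ.+-comm (i ℕ.* m) r))) (periodic-* {m} {u} per i r))
    (Σ-const a _))

  Σ-div-periodic : ∀ {φ} → Periodic M φ → ∀ p q {N} → N ≡ p ℕ.* M ℕ.* q →
                   Σ< N (λ i → φ (i div q)) ≈ fromℕ (p ℕ.* q) * Σ< M φ
  Σ-div-periodic {φ} per p q ≡.refl = begin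
    Σ< (p ℕ.* M ℕ.* q) (λ i → φ (i div q))  ≈⟨ Σ-div (p ℕ.* M) q φ ⟩
    fromℕ q * Σ< (p ℕ.* M) φ                ≈⟨ *-congˡ (Σ-periods p per) ⟩
    fromℕ q * (fromℕ p * Σ< M φ)            ≈⟨ solve 3 (λ q p s → q :* (p :* s) := p :* q :* s) refl (fromℕ q) (fromℕ p) _ ⟩
    fromℕ p * fromℕ q * Σ< M φ              ≈⟨ *-congʳ (fromℕ-* p q) ⟨
    fromℕ (p ℕ.* q) * Σ< M φ                ∎
    where open ≈-Reasoning

  -- Translating i by multiples of p M fixes w (i div p) and runs through all
  -- translates of f (i div q) by multiples of M / q.
  correlation-proj : ∀ {p q f w} → Divisor p → Divisor q → Coprime p q → Periodic M f → Periodic M w →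
    Σ< (M ℕ.* (p ℕ.* q)) (λ i → f (i div q) * w (i div p)) ≈
    Σ< (M ℕ.* (p ℕ.* q)) (λ i → proj q f (i div q) * w (i div p))
  correlation-proj {p} {q} {f} {w} (0<p , p∣M) (0<q , q∣M) p⊥q pf pw = sym (begin
    Σ< N (λ i → proj q f (i div q) * w (i div p))
      ≈⟨ Σ-cong N (λ i → trans (*-congʳ (sym (avg-dilate t {f} 0<q p⊥q pf′ (i div q))))
           (trans (*-assoc c _ _) (*-congˡ (trans (*-comm _ _) (sym (Σ-* q (w (i div p)) (λ j → f (i div q ℕ.+ j ℕ.* (p ℕ.* t))))))))) ⟩
    Σ< N (λ i → c * Σ< q (λ j → w (i div p) * f (i div q ℕ.+ j ℕ.* (p ℕ.* t))))
      ≈⟨ Σ-* N c _ ⟩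
    c * Σ< N (λ i → Σ< q (λ j → w (i div p) * f (i div q ℕ.+ j ℕ.* (p ℕ.* t))))
      ≈⟨ *-congˡ (Σ-comm N q _) ⟩
    c * Σ< q (λ j → Σ< N (λ i → w (i div p) * f (i div q ℕ.+ j ℕ.* (p ℕ.* t))))
      ≈⟨ *-congˡ (Σ-cong q translate) ⟩
    c * Σ< q (λ j → Σ< N Φ)
      ≈⟨ *-congˡ (Σ-const q _) ⟩
    c * (fromℕ q * Σ< N Φ)
      ≈⟨ *-assoc _ _ _ ⟨
    c * fromℕ q * Σ< N Φ
      ≈⟨ trans (*-congʳ (*-inverseˡ (fromℕ-pos 0<q))) (*-identityˡ _) ⟩
    Σ< N Φ ∎)
    where
    open ≈-Reasoning
    N = M ℕ.* (p ℕ.* q)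
    c = fromℕ q ⁻¹
    t = M div q
    qt≡M : q ℕ.* t ≡ M
    qt≡M = *-div 0<q q∣M
    pf′ : Periodic (q ℕ.* t) f
    pf′ = subst (λ m → Periodic m f) (≡.sym qt≡M) pf
    Φ : ℕ → Carrier
    Φ i = f (i div q) * w (i div p)
    perΦ : Periodic N Φ
    perΦ i = *-cong
      (trans (reflexive (cong f (≡.trans (cong (λ n → (i ℕ.+ n) div q) (lemma₁ M p q)) (div-+* i (p ℕ.* M) 0<q)))) (periodic-* {M} {f} pf p (i div q)))
      (trans (reflexive (cong w (≡.trans (cong (λ n → (i ℕ.+ n) div p) (lemma₂ M p q)) (div-+* i (q ℕ.* M) 0<p)))) (periodic-* {M} {w} pw q (i div p)))
      where
      lemma₁ : ∀ M p q → M ℕ.* (p ℕ.* q) ≡ p ℕ.* M ℕ.* q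
      lemma₁ = solve-∀
      lemma₂ : ∀ M p q → M ℕ.* (p ℕ.* q) ≡ q ℕ.* M ℕ.* p
      lemma₂ = solve-∀
    translate : ∀ j → Σ< N (λ i → w (i div p) * f (i div q ℕ.+ j ℕ.* (p ℕ.* t))) ≈ Σ< N Φ
    translate j = trans (Σ-cong N λ i → trans (*-comm _ _) (*-cong
        (reflexive (cong f (≡.sym (≡.trans (cong (λ n → (i ℕ.+ n) div q) lemma₁) (div-+* i (j ℕ.* (p ℕ.* t)) 0<q)))))
        (trans (sym (periodic-* {M} {w} pw j (i div p)))
          (reflexive (cong w (≡.sym (≡.trans (cong (λ n → (i ℕ.+ n) div p) (≡.sym (ℕₚ.*-assoc j M p))) (div-+* i (j ℕ.* M) 0<p))))))))
      (Σ-shift {N} {Φ} perΦ (j ℕ.* (M ℕ.* p)))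
      where
      lemma : ∀ j q t p → j ℕ.* (q ℕ.* t ℕ.* p) ≡ j ℕ.* (p ℕ.* t) ℕ.* q
      lemma = solve-∀
      lemma₁ : j ℕ.* (M ℕ.* p) ≡ j ℕ.* (p ℕ.* t) ℕ.* q
      lemma₁ = ≡.trans (cong (λ n → j ℕ.* (n ℕ.* p)) (≡.sym qt≡M)) (lemma j q t p)

  -- Two uses of `correlation-proj`, with p and q exchanged in between, project both factors. Then
  -- 2ab ≤ a² + b² is preferred to Cauchy-Schwarz: a bound additive in p and q can be summed over
  -- all pairs.
  correlation≤ : ∀ {p q f} → Divisor p → Divisor q → Coprime p q → Periodic M f →
    fromℕ 2 * Σ< (M ℕ.* (p ℕ.* q)) (λ i → f (i div q) * f (i div p)) ≤
    fromℕ (p ℕ.* q) * (‖ proj p f ‖² + ‖ proj q f ‖²)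
  correlation≤ {p} {q} {f} pM qM p⊥q pf = begin
    fromℕ 2 * Σ< N (λ i → f (i div q) * f (i div p))
      ≈⟨ *-congˡ (correlation-proj pM qM p⊥q pf pf) ⟩
    fromℕ 2 * Σ< N (λ i → g (i div q) * f (i div p))
      ≈⟨ *-congˡ (trans (Σ-cong N λ _ → *-comm _ _) (reflexive (cong (λ n → Σ< n (λ i → f (i div p) * g (i div q))) (cong (M ℕ.*_) (ℕₚ.*-comm p q))))) ⟩
    fromℕ 2 * Σ< (M ℕ.* (q ℕ.* p)) (λ i → f (i div p) * g (i div q))
      ≈⟨ *-congˡ (correlation-proj qM pM (Coprime.sym p⊥q) pf (periodic-proj q pf)) ⟩
    fromℕ 2 * Σ< (M ℕ.* (q ℕ.* p)) (λ i → h (i div p) * g (i div q))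
      ≈⟨ Σ-* (M ℕ.* (q ℕ.* p)) (fromℕ 2) _ ⟨
    Σ< (M ℕ.* (q ℕ.* p)) (λ i → fromℕ 2 * (h (i div p) * g (i div q)))
      ≤⟨ Σ-mono (M ℕ.* (q ℕ.* p)) (λ i → ≤-by (0≤x*x (h (i div p) - g (i div q)))
           (solve 2 (λ a b → :2 :* (a :* b) :+ (a :- b) :* (a :- b) := a :* a :+ b :* b) refl (h (i div p)) (g (i div q)))) ⟩
    Σ< (M ℕ.* (q ℕ.* p)) (λ i → h (i div p) * h (i div p) + g (i div q) * g (i div q))
      ≈⟨ Σ-+ (M ℕ.* (q ℕ.* p)) _ _ ⟩
    Σ< (M ℕ.* (q ℕ.* p)) (λ i → h (i div p) * h (i div p)) + Σ< (M ℕ.* (q ℕ.* p)) (λ i → g (i div q) * g (i div q))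
      ≈⟨ +-cong (Σ-div-periodic {λ x → h x * h x} (λ x → *-cong (periodic-proj p pf x) (periodic-proj p pf x)) q p (lemma₁ M p q))
                (Σ-div-periodic {λ x → g x * g x} (λ x → *-cong (periodic-proj q pf x) (periodic-proj q pf x)) p q (lemma₂ M p q)) ⟩
    fromℕ (q ℕ.* p) * ‖ h ‖² + fromℕ (p ℕ.* q) * ‖ g ‖²
      ≈⟨ trans (+-congʳ (*-congʳ (reflexive (cong fromℕ (ℕₚ.*-comm q p))))) (sym (distribˡ _ _ _)) ⟩
    fromℕ (p ℕ.* q) * (‖ h ‖² + ‖ g ‖²) ∎
    where
    open ≤-Reasoning
    N = M ℕ.* (p ℕ.* q)
    g = proj q f
    h = proj p f
    lemma₁ : ∀ M p q → M ℕ.* (q ℕ.* p) ≡ q ℕ.* M ℕ.* p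
    lemma₁ = solve-∀
    lemma₂ : ∀ M p q → M ℕ.* (q ℕ.* p) ≡ p ℕ.* M ℕ.* q
    lemma₂ = solve-∀

  ΣL : List ℕ → (ℕ → Carrier) → Carrier
  ΣL []       φ = 0#
  ΣL (p ∷ ps) φ = φ p + ΣL ps φ

  -- Variance of a sum of dilates and Chebyshev's inequality

  module Variance {Q} (0<Q : 0 ℕ.< Q) {f} (pf : Periodic M f) where

    -- If α lies in the i-th cell of the grid of mesh 1/(MQ) and p ∣ Q, then the
    -- cell of pα in the grid of mesh 1/M has index i div (Q div p) modulo M.
    dilate : ℕ → ℕ → Carrier
    dilate p i = f (i div (Q div p))

    N = M ℕ.* Q

    dilate-‖‖² : ∀ {p} → 0 ℕ.< p → p ∣ Q → Σ< N (λ i → dilate p i * dilate p i) ≈ fromℕ Q * ‖ f ‖²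
    dilate-‖‖² {p} 0<p p∣Q = trans
      (Σ-div-periodic {λ x → f x * f x} (λ x → *-cong (pf x) (pf x)) p (Q div p)
        (≡.trans (cong (M ℕ.*_) (≡.sym (*-div 0<p p∣Q))) (lemma M p (Q div p))))
      (*-congʳ (reflexive (cong fromℕ (*-div 0<p p∣Q))))
      where
      lemma : ∀ M p r → M ℕ.* (p ℕ.* r) ≡ p ℕ.* M ℕ.* r
      lemma = solve-∀

    dilate-correlation≤ : ∀ {p q} → Divisor p → Divisor q → p ∣ Q → q ∣ Q → Coprime p q →
      fromℕ 2 * Σ< N (λ i → dilate p i * dilate q i) ≤ fromℕ Q * (‖ proj p f ‖² + ‖ proj q f ‖²)
    dilate-correlation≤ {p} {q} pM@(0<p , _) qM@(0<q , _) p∣Q q∣Q p⊥q = begin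
      fromℕ 2 * Σ< N (λ i → dilate p i * dilate q i)
        ≈⟨ *-congˡ (Σ-cong N λ i → *-cong (reflexive (cong f (index p q 0<p 0<q i Q≡pqS))) (reflexive (cong f (index q p 0<q 0<p i (≡.trans Q≡pqS (cong (ℕ._* S) (ℕₚ.*-comm p q))))))) ⟩
      fromℕ 2 * Σ< N (λ i → Φ (i div S))
        ≈⟨ *-congˡ (trans (reflexive (cong (λ n → Σ< n (λ i → Φ (i div S))) (≡.trans (cong (M ℕ.*_) Q≡pqS) (≡.sym (ℕₚ.*-assoc M (p ℕ.* q) S)))))
             (Σ-div (M ℕ.* (p ℕ.* q)) S Φ)) ⟩
      fromℕ 2 * (fromℕ S * Σ< (M ℕ.* (p ℕ.* q)) Φ)
        ≈⟨ solve 2 (λ s z → :2 :* (s :* z) := s :* (:2 :* z)) refl (fromℕ S) _ ⟩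
      fromℕ S * (fromℕ 2 * Σ< (M ℕ.* (p ℕ.* q)) Φ)
        ≤⟨ *-monoˡ-≤ (fromℕ-nonNeg S) (correlation≤ pM qM p⊥q pf) ⟩
      fromℕ S * (fromℕ (p ℕ.* q) * (‖ proj p f ‖² + ‖ proj q f ‖²))
        ≈⟨ trans (sym (*-assoc _ _ _)) (*-congʳ (trans (*-comm _ _) (trans (sym (fromℕ-* (p ℕ.* q) S)) (reflexive (cong fromℕ (≡.sym Q≡pqS)))))) ⟩
      fromℕ Q * (‖ proj p f ‖² + ‖ proj q f ‖²) ∎
      where
      open ≤-Reasoning
      -- Both dilates are constant on blocks of S cells, which form the grid of `correlation≤`.
      -- Since Q/p = Sq, the dilation by p turns into division by q there.
      S = Q div (p ℕ.* q)
      Φ : ℕ → Carrier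
      Φ i = f (i div q) * f (i div p)
      pq∣Q : p ℕ.* q ∣ Q
      pq∣Q = coprime⇒*∣ p⊥q p∣Q q∣Q
      0<pq : 0 ℕ.< p ℕ.* q
      0<pq = ℕₚ.*-mono-≤ 0<p 0<q
      Q≡pqS : Q ≡ p ℕ.* q ℕ.* S
      Q≡pqS = ≡.sym (*-div 0<pq pq∣Q)
      0<S : 0 ℕ.< S
      0<S = div-pos 0<pq pq∣Q 0<Q
      index : ∀ p q → 0 ℕ.< p → 0 ℕ.< q → ∀ i → Q ≡ p ℕ.* q ℕ.* S → i div (Q div p) ≡ i div S div q
      index p q 0<p 0<q i Q≡ = ≡.trans (cong (i div_) Q/p≡Sq) (≡.sym (div-div i 0<S 0<q))
        where
        p∣Q′ : p ∣ Q
        p∣Q′ = divides (q ℕ.* S) (≡.trans Q≡ (≡.trans (ℕₚ.*-assoc p q S) (ℕₚ.*-comm p (q ℕ.* S))))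
        Q/p≡Sq : Q div p ≡ S ℕ.* q
        Q/p≡Sq = ℕₚ.*-cancelˡ-≡ _ _ p {{>-nonZero 0<p}} (≡.trans (*-div 0<p p∣Q′) (≡.trans Q≡
          (≡.trans (ℕₚ.*-assoc p q S) (cong (p ℕ.*_) (ℕₚ.*-comm q S)))))

    cross≤ : ∀ {p} ps → Divisor p → p ∣ Q → All Divisor ps → All (_∣ Q) ps → All (Coprime p) ps →
      fromℕ 2 * Σ< N (λ i → dilate p i * ΣL ps (λ q → dilate q i)) ≤
      fromℕ Q * (fromℕ (length ps) * ‖ proj p f ‖² + energy 1 ps f)
    cross≤ {p} [] _ _ _ _ _ = ≤-reflexive (trans
      (*-congˡ (trans (Σ-cong N λ i → zeroʳ (dilate p i)) (Σ-zero N)))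
      (solve 2 (λ Q a → :2 :* :0 := Q :* (:0 :* a :+ :0)) refl (fromℕ Q) ‖ proj p f ‖²))
    cross≤ {p} (q ∷ ps) pM p∣Q (qM ∷ psM) (q∣Q ∷ ps∣Q) (p⊥q ∷ p⊥ps) = begin
      fromℕ 2 * Σ< N (λ i → dilate p i * (dilate q i + ΣL ps (λ r → dilate r i)))
        ≈⟨ *-congˡ (trans (Σ-cong N λ i → distribˡ _ _ _) (Σ-+ N _ _)) ⟩
      fromℕ 2 * (Σ< N (λ i → dilate p i * dilate q i) + Σ< N (λ i → dilate p i * ΣL ps (λ r → dilate r i)))
        ≈⟨ distribˡ _ _ _ ⟩
      fromℕ 2 * Σ< N (λ i → dilate p i * dilate q i) + fromℕ 2 * Σ< N (λ i → dilate p i * ΣL ps (λ r → dilate r i))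
        ≤⟨ +-mono-≤ (dilate-correlation≤ pM qM p∣Q q∣Q p⊥q) (cross≤ ps pM p∣Q psM ps∣Q p⊥ps) ⟩
      fromℕ Q * (‖ proj p f ‖² + ‖ proj q f ‖²) + fromℕ Q * (fromℕ (length ps) * ‖ proj p f ‖² + energy 1 ps f)
        ≈⟨ solve 5 (λ Q a b l e → Q :* (a :+ b) :+ Q :* (l :* a :+ e) := Q :* ((:1 :+ l) :* a :+ (b :+ e))) refl
             (fromℕ Q) ‖ proj p f ‖² ‖ proj q f ‖² (fromℕ (length ps)) (energy 1 ps f) ⟩
      fromℕ Q * (fromℕ (suc (length ps)) * ‖ proj p f ‖² + (‖ proj q f ‖² + energy 1 ps f)) ∎
      where open ≤-Reasoning

    -- Each of the K primes meets K - 1 others and a pair is charged additively, so the cross terms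
    -- cost at most K - 1 times the sum of the ‖P_p f‖². Rounding K - 1 up to K accounts for the
    -- spare term in the last step of the induction.
    variance≤ : ∀ ps → All Divisor ps → All (_∣ Q) ps → AllPairs Coprime ps →
      Σ< N (λ i → ΣL ps (λ p → dilate p i) * ΣL ps (λ p → dilate p i)) ≤
      fromℕ Q * (fromℕ (length ps) * (‖ f ‖² + energy 1 ps f))
    variance≤ [] _ _ _ = ≤-reflexive (trans (trans (Σ-cong N λ i → zeroˡ 0#) (Σ-zero N))
      (sym (trans (*-congˡ (zeroˡ _)) (zeroʳ _))))
    variance≤ (p ∷ ps) (pM ∷ psM) (p∣Q ∷ ps∣Q) (p⊥ps ∷ ps⊥) = begin
      Σ< N (λ i → (dilate p i + W i) * (dilate p i + W i))
        ≈⟨ Σ-cong N (λ i → solve 2 (λ a w → (a :+ w) :* (a :+ w) := a :* a :+ (:2 :* (a :* w) :+ w :* w)) refl (dilate p i) (W i)) ⟩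
      Σ< N (λ i → dilate p i * dilate p i + (fromℕ 2 * (dilate p i * W i) + W i * W i))
        ≈⟨ trans (Σ-+ N _ _) (+-congˡ (trans (Σ-+ N _ _) (+-congʳ (Σ-* N (fromℕ 2) _)))) ⟩
      Σ< N (λ i → dilate p i * dilate p i) + (fromℕ 2 * Σ< N (λ i → dilate p i * W i) + Σ< N (λ i → W i * W i))
        ≤⟨ +-mono-≤ (≤-reflexive (dilate-‖‖² (proj₁ pM) p∣Q)) (+-mono-≤ (cross≤ ps pM p∣Q psM ps∣Q p⊥ps) (variance≤ ps psM ps∣Q ps⊥)) ⟩
      fromℕ Q * F + (fromℕ Q * (l * a + e) + fromℕ Q * (l * (F + e)))
        ≤⟨ ≤-by (*-nonNeg (fromℕ-nonNeg Q) (‖‖²-nonNeg (proj p f)))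
             (solve 5 (λ Q F l a e → Q :* F :+ (Q :* (l :* a :+ e) :+ Q :* (l :* (F :+ e))) :+ Q :* a := Q :* ((:1 :+ l) :* (F :+ (a :+ e)))) refl
               (fromℕ Q) F l a e) ⟩
      fromℕ Q * (fromℕ (suc (length ps)) * (F + (a + e))) ∎
      where
      open ≤-Reasoning
      W : ℕ → Carrier
      W i = ΣL ps (λ q → dilate q i)
      F = ‖ f ‖²
      a = ‖ proj p f ‖²
      e = energy 1 ps f
      l = fromℕ (length ps)

  -- Chebyshev's inequality: on a bad cell every g(pα) vanishes, so Σ_p f(pα) = -Kμ, whose square is
  -- compared with the variance. In units of Mμ the factor k + 2 is made up of 1 for ‖f‖², k from
  -- `energy₁≤` and 1 for the last energy, which the smallness hypothesis controls.
  exceptional≤ : ∀ {Q g v μ V b} k ps → 0 ℕ.< M → 0 ℕ.< Q →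
    All Divisor ps → All (_∣ Q) ps → AllPairs Coprime ps → 0 ℕ.< length ps →
    Periodic M g → (∀ x → g x * g x ≈ g x) → fromℕ M * μ ≈ Σ< M g → 0# < μ →
    Periodic M v → (∀ x → 0# ≤ v x) → Majorises v g → Σ< M v ≤ V → V * V * Σ1/p² ps ^ suc k ≤ μ →
    (∀ i → b i ≈ 0# ⊎ (b i ≤ 1# × All (λ p → g (i div (Q div p)) ≈ 0#) ps)) →
    Σ< (M ℕ.* Q) b * (fromℕ (length ps) * μ) ≤ fromℕ (M ℕ.* Q) * fromℕ (suc (suc k))
  exceptional≤ {Q} {g} {v} {μ} {V} {b} k ps 0<M 0<Q psM ps∣Q ps⊥ 0<K pg idem mean 0<μ pv 0≤v maj Σv≤V small bad =
    *-cancelˡ-≤ (*-pos (fromℕ-pos 0<K) 0<μ) (begin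
      K * μ * (Σ< N b * (K * μ))                              ≈⟨ solve 2 (λ a s → a :* (s :* a) := a :* a :* s) refl (K * μ) _ ⟩
      K * μ * (K * μ) * Σ< N b                                ≈⟨ Σ-* N (K * μ * (K * μ)) b ⟨
      Σ< N (λ i → K * μ * (K * μ) * b i)                      ≤⟨ Σ-mono N bad≤ ⟩
      Σ< N (λ i → W i * W i)                                  ≤⟨ variance≤ ps psM ps∣Q ps⊥ ⟩
      fromℕ Q * (K * (‖ f ‖² + energy 1 ps f))                ≤⟨ *-monoˡ-≤ (fromℕ-nonNeg Q) (*-monoˡ-≤ (fromℕ-nonNeg (length ps)) total≤) ⟩
      fromℕ Q * (K * (m * μ + (fromℕ k * (m * μ) + m * μ)))   ≈⟨ solve 5 (λ Q K m μ k → Q :* (K :* (m :* μ :+ (k :* (m :* μ) :+ m :* μ))) := K :* μ :* (m :* Q :* (:1 :+ (:1 :+ k)))) refl (fromℕ Q) K m μ (fromℕ k) ⟩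
      K * μ * (m * fromℕ Q * fromℕ (suc (suc k)))             ≈⟨ *-congˡ (*-congʳ (fromℕ-* M Q)) ⟨
      K * μ * (fromℕ N * fromℕ (suc (suc k)))                 ∎)
    where
    open ≤-Reasoning
    f : ℕ → Carrier
    f x = g x - μ
    pf : Periodic M f
    pf x = +-congʳ (pg x)
    open Variance 0<Q {f} pf hiding (N)
    N = M ℕ.* Q
    K = fromℕ (length ps)
    m = fromℕ M
    W : ℕ → Carrier
    W i = ΣL ps (λ p → dilate p i)
    all-zero : ∀ ps i → All (λ p → g (i div (Q div p)) ≈ 0#) ps → ΣL ps (λ p → dilate p i) ≈ - (fromℕ (length ps) * μ)
    all-zero [] i _ = solve 1 (λ μ → :0 := :- (:0 :* μ)) refl μ
    all-zero (p ∷ ps) i (gp≈0 ∷ gps≈0) = trans (+-cong (+-congʳ gp≈0) (all-zero ps i gps≈0))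
      (solve 2 (λ l μ → :0 :- μ :+ (:- (l :* μ)) := :- ((:1 :+ l) :* μ)) refl (fromℕ (length ps)) μ)
    bad≤ : ∀ i → K * μ * (K * μ) * b i ≤ W i * W i
    bad≤ i with bad i
    ... | inj₁ b≈0 = ≤-respˡ-≈ (sym (trans (*-congˡ b≈0) (zeroʳ _))) (0≤x*x (W i))
    ... | inj₂ (b≤1 , zeros) = begin
      K * μ * (K * μ) * b i          ≤⟨ *-monoˡ-≤ (0≤x*x (K * μ)) b≤1 ⟩
      K * μ * (K * μ) * 1#           ≈⟨ solve 1 (λ a → a :* a :* :1 := (:- a) :* (:- a)) refl (K * μ) ⟩
      - (K * μ) * - (K * μ)          ≈⟨ *-cong (all-zero ps i zeros) (all-zero ps i zeros) ⟨
      W i * W i                      ∎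
    ‖f‖²≤ : ‖ f ‖² ≤ m * μ
    ‖f‖²≤ = ≤-by (*-nonNeg (fromℕ-nonNeg M) (0≤x*x μ)) (trans (+-congʳ (begin-equality
      Σ< M (λ x → (g x - μ) * (g x - μ))
        ≈⟨ Σ-cong M (λ x → trans (solve 2 (λ g μ → (g :- μ) :* (g :- μ) := g :* g :+ ((:- (:2 :* μ)) :* g :+ μ :* μ)) refl (g x) μ) (+-congʳ (idem x))) ⟩
      Σ< M (λ x → g x + (- (fromℕ 2 * μ) * g x + μ * μ))
        ≈⟨ trans (Σ-+ M _ _) (+-congˡ (trans (Σ-+ M _ _) (+-cong (Σ-* M _ g) (Σ-const M _)))) ⟩
      Σ< M g + (- (fromℕ 2 * μ) * Σ< M g + m * (μ * μ))
        ≈⟨ +-cong (sym mean) (+-congʳ (*-congˡ (sym mean))) ⟩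
      m * μ + (- (fromℕ 2 * μ) * (m * μ) + m * (μ * μ)) ∎))
      (solve 2 (λ m μ → m :* μ :+ ((:- (:2 :* μ)) :* (m :* μ) :+ m :* (μ :* μ)) :+ m :* (μ :* μ) := m :* μ) refl m μ))
    mean-zero : Σ< M f ≈ 0#
    mean-zero = trans (Σ-+ M g _) (trans (+-cong (sym mean) (Σ-const M (- μ)))
      (solve 2 (λ m μ → m :* μ :+ m :* (:- μ) := :0) refl m μ))
    maj-f : Majorises v f
    maj-f x = ≤-respʳ-≈ (swap (g x) (v x)) (+-monoˡ-≤ (- μ) (proj₁ (maj x)))
            , ≤-respʳ-≈ (swap (g (suc x)) (v x)) (+-monoˡ-≤ (- μ) (proj₂ (maj x)))
      where
      swap : ∀ a c → a + c - μ ≈ a - μ + c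
      swap a c = solve 3 (λ a c μ → a :+ c :- μ := a :- μ :+ c) refl a c μ
    total≤ : ‖ f ‖² + energy 1 ps f ≤ m * μ + (fromℕ k * (m * μ) + m * μ)
    total≤ = +-mono-≤ ‖f‖²≤ (≤-trans (energy₁≤ k ps psM pf) (+-mono-≤ (*-monoˡ-≤ (fromℕ-nonNeg k) ‖f‖²≤) (begin
      energy (suc k) ps f                       ≤⟨ energy≤ (suc k) ps {1} {M} {f} {v} {V} (ℕₚ.*-identityˡ M) 0<M pf pv mean-zero 0≤v maj-f Σv≤V psM
                                                     (All.map {P = Divisor} {Q = Coprime 1} (λ _ → Coprime.1-coprimeTo _) psM) ps⊥ ⟩
      m * (V * V) * Σ1/p² ps ^ suc k            ≈⟨ *-assoc _ _ _ ⟩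
      m * (V * V * Σ1/p² ps ^ suc k)            ≤⟨ *-monoˡ-≤ (fromℕ-nonNeg M) small ⟩
      m * μ                                     ∎)))

-- Indicators, covers, grids and the final estimates

module Approximation (em : ExcludedMiddle 0ℓ) (ℝ : CompleteOrderedField) where

  open CompleteOrderedField ℝ
  open UnitInterval ℝ
  open OrderedField ℝ
  open SemiringExp semiring using (^-assocʳ)
  open Summation ℝ

  ind : {P : Set} → Dec P → Carrier
  ind (yes _) = 1#
  ind (no  _) = 0#

  𝟙 : Set → Carrier
  𝟙 P = ind (em {P})

  𝟙-yes : ∀ {P} → P → 𝟙 P ≈ 1#
  𝟙-yes {P} p with em {P}
  ... | yes _  = refl
  ... | no  ¬p = contradiction p ¬p

  𝟙-no : ∀ {P} → ¬ P → 𝟙 P ≈ 0#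
  𝟙-no {P} ¬p with em {P}
  ... | yes p = contradiction p ¬p
  ... | no  _ = refl

  0≤𝟙 : ∀ P → 0# ≤ 𝟙 P
  0≤𝟙 P with em {P}
  ... | yes _ = 0≤1
  ... | no  _ = ≤-refl

  𝟙-idem : ∀ P → 𝟙 P * 𝟙 P ≈ 𝟙 P
  𝟙-idem P with em {P}
  ... | yes _ = *-identityˡ 1#
  ... | no  _ = zeroˡ 0#

  𝟙≤ : ∀ {P x} → 0# ≤ x → (P → 1# ≤ x) → 𝟙 P ≤ x
  𝟙≤ {P} 0≤x 1≤x with em {P}
  ... | yes p = 1≤x p
  ... | no  _ = 0≤x

  1≤𝟙+𝟙 : ∀ {P Q} → P ⊎ Q → 1# ≤ 𝟙 P + 𝟙 Q
  1≤𝟙+𝟙 {P} {Q} (inj₁ p) = ≤-by (0≤𝟙 Q) (+-congʳ (sym (𝟙-yes p)))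
  1≤𝟙+𝟙 {P} {Q} (inj₂ q) = ≤-by (0≤𝟙 P) (trans (+-comm _ _) (+-congˡ (sym (𝟙-yes q))))

  term≤Σ : ∀ {n k} {φ : ℕ → Carrier} → (∀ i → 0# ≤ φ i) → k ℕ.< n → φ k ≤ Σ< n φ
  term≤Σ {suc n} {zero}  {φ} 0≤φ _         = ≤-by (Σ-nonNeg n λ i → 0≤φ (suc i)) refl
  term≤Σ {suc n} {suc k} {φ} 0≤φ (s≤s k<n) = ≤-trans (term≤Σ (λ i → 0≤φ (suc i)) k<n) (≤-by (0≤φ 0) (+-comm _ _))

  Σ𝟙≡≤1 : ∀ n c → Σ< n (λ j → 𝟙 (j ≡ c)) ≤ 1#
  Σ𝟙≡≤1 zero    c = 0≤1
  Σ𝟙≡≤1 (suc n) zero = ≤-respˡ-≈ (sym (+-cong (𝟙-yes {0 ≡ 0} ≡.refl) (trans (Σ-cong n λ i → 𝟙-no {suc i ≡ 0} λ ()) (Σ-zero n)))) (≤-reflexive (+-identityʳ 1#))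
  Σ𝟙≡≤1 (suc n) (suc c) = ≤-respˡ-≈ (sym (trans (+-congʳ (𝟙-no {0 ≡ suc c} λ ())) (+-identityˡ _)))
    (≤-trans (Σ-mono n λ i → 𝟙≤ {suc i ≡ suc c} (0≤𝟙 _) λ eq → ≤-reflexive (sym (𝟙-yes (ℕₚ.suc-injective eq)))) (Σ𝟙≡≤1 n c))

  -- Covers by finitely many intervals

  Interval : Set
  Interval = Carrier × Carrier

  len : Interval → Carrier
  len (a , b) = b - a

  Around : Carrier → Interval → Set
  Around x (a , b) = a < x × x < b

  Ordered : Interval → Set
  Ordered (a , b) = a ≤ b

  total-len : List Interval → Carrier
  total-len []      = 0#
  total-len (I ∷ l) = len I + total-len l

  total-len-nonNeg : ∀ {l} → All Ordered l → 0# ≤ total-len l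
  total-len-nonNeg []             = ≤-refl
  total-len-nonNeg (a≤b ∷ ordered) = +-nonNeg (x≤y⇒0≤y-x a≤b) (total-len-nonNeg ordered)

  total-len-applyUpTo : ∀ n (f : ℕ → Interval) → total-len (applyUpTo f n) ≡ Σ< n (λ i → len (f i))
  total-len-applyUpTo zero    f = ≡.refl
  total-len-applyUpTo (suc n) f = cong (len (f 0) +_) (total-len-applyUpTo n λ i → f (suc i))

  -- Finite lists can be strung end to end, so countably many such covers form a single sequence;
  -- infinite covers would have to be interleaved.
  FiniteCover : Subset → Carrier → Set
  FiniteCover S t = ∃ λ l → All Ordered l × (∀ x → x ∈ S → Any (Around x) l) × total-len l ≤ t

  FiniteCover-⊆ : ∀ {S T t u} → S ⊆ T → t ≤ u → FiniteCover T t → FiniteCover S u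
  FiniteCover-⊆ S⊆T t≤u (l , ordered , covers , len≤t) = l , ordered , (λ x x∈S → covers x (S⊆T x∈S)) , ≤-trans len≤t t≤u

  -- An empty interval is emitted after each list, so that empty lists do no harm.
  concatenate : (ℕ → List Interval) → List Interval → ℕ → Interval
  concatenate c []      zero    = 0# , 0#
  concatenate c []      (suc n) = concatenate (λ k → c (suc k)) (c 0) n
  concatenate c (I ∷ l) zero    = I
  concatenate c (I ∷ l) (suc n) = concatenate c l n

  concatenate-ordered : ∀ c l → (∀ k → All Ordered (c k)) → All Ordered l → ∀ n → Ordered (concatenate c l n)
  concatenate-ordered c []      oc _         zero    = ≤-refl
  concatenate-ordered c []      oc _         (suc n) = concatenate-ordered _ (c 0) (λ k → oc (suc k)) (oc 0) n
  concatenate-ordered c (I ∷ l) oc (oI ∷ ol) zero    = oI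
  concatenate-ordered c (I ∷ l) oc (oI ∷ ol) (suc n) = concatenate-ordered c l oc ol n

  -- Every list uses up at least one index, its closing empty interval, so the first n intervals
  -- come from `l` and the first n lists.
  concatenate-len : ∀ c l → (∀ k → All Ordered (c k)) → All Ordered l → ∀ n →
                    Σ< n (λ i → len (concatenate c l i)) ≤ total-len l + Σ< n (λ k → total-len (c k))
  concatenate-len c l oc ol zero = +-nonNeg (total-len-nonNeg ol) ≤-refl
  concatenate-len c [] oc _ (suc n) = +-mono-≤ (≤-reflexive (-‿inverseʳ 0#)) (concatenate-len _ (c 0) (λ k → oc (suc k)) (oc 0) n)
  concatenate-len c (I ∷ l) oc (_ ∷ ol) (suc n) = ≤-trans (+-monoʳ-≤ (len I) (concatenate-len c l oc ol n))
    (≤-respˡ-≈ (+-assoc _ _ _) (+-monoʳ-≤ _ increase))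
    where
    increase : Σ< n (λ k → total-len (c k)) ≤ Σ< (suc n) (λ k → total-len (c k))
    increase = ≤-respʳ-≈ (sym (Σ-last n _)) (≤-by (total-len-nonNeg (oc n)) refl)

  concatenate-here : ∀ {P : Interval → Set} c l → Any P l → ∃ λ n → P (concatenate c l n)
  concatenate-here c (I ∷ l) (here p)  = 0 , p
  concatenate-here c (I ∷ l) (there p) with n , q ← concatenate-here c l p = suc n , q

  concatenate-there : ∀ {P : Interval → Set} c l k → Any P (c k) → ∃ λ n → P (concatenate c l n)
  concatenate-there c []      zero    p with n , q ← concatenate-here (λ k → c (suc k)) (c 0) p = suc n , q
  concatenate-there c []      (suc k) p with n , q ← concatenate-there (λ k → c (suc k)) (c 0) k p = suc n , q
  concatenate-there c (I ∷ l) k       p with n , q ← concatenate-there c l k p = suc n , q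

  -- Countable subadditivity; the series of the bounds enters through its partial sums.
  coverable : ∀ {S T t} (U : ℕ → Subset) → (∀ x → x ∈ S → ∃ λ k → x ∈ U k) →
              (∀ k → FiniteCover (U k) (t k)) → (∀ n → Σ< n t ≤ T) → CoverableWithin S T
  coverable {S} {T} {t} U S⊆⋃U covers Σt≤T =
    (λ n → proj₁ (seq n)) , (λ n → proj₂ (seq n)) , concatenate-ordered c [] (λ k → proj₁ (proj₂ (covers k))) [] , cover , short
    where
    c : ℕ → List Interval
    c k = proj₁ (covers k)
    seq : ℕ → Interval
    seq = concatenate c []
    cover : ∀ x → x ∈ S → ∃ λ n → Around x (seq n)
    cover x x∈S with k , x∈Uk ← S⊆⋃U x x∈S = concatenate-there c [] k (proj₁ (proj₂ (proj₂ (covers k))) x x∈Uk)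
    short : ∀ n → sum {n} (λ i → len (seq (toℕ i))) ≤ T
    short n = ≤-respˡ-≈ (reflexive (Σ≡sum n (λ i → len (seq i))))
      (≤-trans (concatenate-len c [] (λ k → proj₁ (proj₂ (covers k))) [] n)
        (≤-respˡ-≈ (sym (+-identityˡ _)) (≤-trans (Σ-mono n λ k → proj₂ (proj₂ (proj₂ (covers k)))) (Σt≤T n))))

  ℙ≤ : ∀ {S t} → FiniteCover (S ∩ [0,1⟩) t → ℙ S ≤ t
  ℙ≤ {S} {t} cover = proj₁ (proj₂ (ℙ-infimum S)) t (coverable {t = bound} U (λ x x∈S → 0 , x∈S) covers short)
    where
    U : ℕ → Subset
    U zero    = S ∩ [0,1⟩
    U (suc _) = λ _ → ⊥
    bound : ℕ → Carrier
    bound zero    = t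
    bound (suc _) = 0#
    covers : ∀ k → FiniteCover (U k) (bound k)
    covers zero    = cover
    covers (suc _) = [] , [] , (λ _ ()) , ≤-refl
    0≤t : 0# ≤ t
    0≤t = ≤-trans (total-len-nonNeg (proj₁ (proj₂ cover))) (proj₂ (proj₂ (proj₂ cover)))
    short : ∀ n → Σ< n bound ≤ t
    short zero    = 0≤t
    short (suc n) = ≤-reflexive (trans (+-congˡ (Σ-zero n)) (+-identityʳ t))

  -- Grids

  InCell : ℕ → ℕ → Carrier → Set
  InCell N i x = fromℕ i ≤ fromℕ N * x × fromℕ N * x < fromℕ (suc i)

  floor : ∀ N {y} → 0# ≤ y → y < fromℕ N → ∃ λ i → i ℕ.< N × fromℕ i ≤ y × y < fromℕ (suc i)
  floor zero    0≤y y<0 = contradiction 0≤y (<⇒≱ y<0)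
  floor (suc N) {y} 0≤y y<1+N with em {fromℕ N ≤ y}
  ... | yes N≤y = N , ℕₚ.≤-refl , N≤y , y<1+N
  ... | no  N≰y with i , i<N , i≤y , y<1+i ← floor N 0≤y (≰⇒> N≰y) = i , ℕₚ.m≤n⇒m≤1+n i<N , i≤y , y<1+i

  cell : ∀ {N x} → 0 ℕ.< N → x ∈ [0,1⟩ → ∃ λ i → i ℕ.< N × InCell N i x
  cell {N} {x} 0<N (0≤x , x<1) = floor N (*-nonNeg (fromℕ-nonNeg N) 0≤x)
    (≰⇒> λ N≤Nx → <⇒≱ x<1 (*-cancelˡ-≤ (fromℕ-pos 0<N) (≤-respˡ-≈ (sym (*-identityʳ _)) N≤Nx)))

  -- The i-th cell [i/N , (i+1)/N) is covered by ((i-1)/N , (i+1)/N).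
  cellCover : ∀ {S N} (P : ℕ → Set) → 0 ℕ.< N → S ⊆ [0,1⟩ →
              (∀ {x i} → x ∈ S → i ℕ.< N → InCell N i x → P i) →
              FiniteCover S (fromℕ 2 * fromℕ N ⁻¹ * Σ< N (λ i → 𝟙 (P i)))
  cellCover {S} {N} P 0<N S⊆ meets = applyUpTo I N , Allₚ.applyUpTo⁺₂ I N ordered , covers , ≤-reflexive (trans
      (reflexive (total-len-applyUpTo N I))
      (trans (Σ-cong N λ i → solve 3 (λ i e c → (i :+ e) :* c :- (i :- e) :* c := :2 :* c :* e) refl (fromℕ i) (𝟙 (P i)) N⁻¹) (Σ-* N _ _)))
    where
    N⁻¹ = fromℕ N ⁻¹
    0<N′ = fromℕ-pos 0<N
    I : ℕ → Interval
    I i = (fromℕ i - 𝟙 (P i)) * N⁻¹ , (fromℕ i + 𝟙 (P i)) * N⁻¹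
    ordered : ∀ i → Ordered (I i)
    ordered i = *-monoʳ-≤ (⁻¹-nonNeg 0<N′) (≤-by (+-nonNeg (0≤𝟙 (P i)) (0≤𝟙 (P i)))
      (solve 2 (λ i e → i :- e :+ (e :+ e) := i :+ e) refl (fromℕ i) (𝟙 (P i))))
    scale : ∀ z → fromℕ N * (z * N⁻¹) ≈ z
    scale z = trans (solve 3 (λ n z c → n :* (z :* c) := z :* (n :* c)) refl (fromℕ N) z N⁻¹)
      (trans (*-congˡ (*-inverseʳ _ (>⇒≉0 0<N′))) (*-identityʳ z))
    covers : ∀ x → x ∈ S → Any (Around x) (applyUpTo I N)
    covers x x∈S with i , i<N , i≤Nx , Nx<1+i ← cell 0<N (S⊆ x∈S) = Anyₚ.applyUpTo⁺ I
      ( *-cancelˡ-< (<⇒≤ 0<N′) (<-≤-trans (≤-<-trans (≤-reflexive (trans (scale _) (+-congˡ (-‿cong 𝟙≈1)))) i-1<i) i≤Nx)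
      , *-cancelˡ-< (<⇒≤ 0<N′) (<-≤-trans Nx<1+i (≤-reflexive (trans (+-comm _ _) (sym (trans (scale _) (+-congˡ 𝟙≈1)))))))
      i<N
      where
      𝟙≈1 : 𝟙 (P i) ≈ 1#
      𝟙≈1 = 𝟙-yes (meets x∈S i<N (i≤Nx , Nx<1+i))
      i-1<i : fromℕ i - 1# < fromℕ i
      i-1<i = ≰⇒> λ i≤i-1 → <⇒≱ 0<1 (≤-respˡ-≈ (solve 1 (λ i → i :+ (:1 :- i) := :1) refl (fromℕ i))
        (≤-respʳ-≈ (solve 1 (λ i → i :- :1 :+ (:1 :- i) := :0) refl (fromℕ i)) (+-monoˡ-≤ (1# - fromℕ i) i≤i-1)))

  -- Approximating a union of intervals by cells

  extremes : (P : ℕ → Set) → ∀ N → (∀ {j} → j ℕ.< N → ¬ P j) ⊎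
    ∃₂ λ c d → d ℕ.< N × P c × P d × (∀ {j} → j ℕ.< N → P j → c ℕ.≤ j × j ℕ.≤ d)
  extremes P zero = inj₁ λ ()
  extremes P (suc N) with em {P N} | extremes P N
  ... | no ¬p | inj₁ none = inj₁ λ { (s≤s j≤N) Pj → none′ j≤N Pj }
    where
    none′ : ∀ {j} → j ℕ.≤ N → ¬ P j
    none′ j≤N Pj with ℕₚ.m≤n⇒m<n∨m≡n j≤N
    ... | inj₁ j<N    = none j<N Pj
    ... | inj₂ ≡.refl = ¬p Pj
  ... | no ¬p | inj₂ (c , d , d<N , Pc , Pd , between) = inj₂ (c , d , ℕₚ.m≤n⇒m≤1+n d<N , Pc , Pd , between′)
    where
    between′ : ∀ {j} → j ℕ.< suc N → P j → c ℕ.≤ j × j ℕ.≤ d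
    between′ (s≤s j≤N) Pj with ℕₚ.m≤n⇒m<n∨m≡n j≤N
    ... | inj₁ j<N    = between j<N Pj
    ... | inj₂ ≡.refl = contradiction Pj ¬p
  ... | yes p | inj₁ none = inj₂ (N , N , ℕₚ.≤-refl , p , p , between′)
    where
    between′ : ∀ {j} → j ℕ.< suc N → P j → N ℕ.≤ j × j ℕ.≤ N
    between′ (s≤s j≤N) Pj with ℕₚ.m≤n⇒m<n∨m≡n j≤N
    ... | inj₁ j<N    = contradiction Pj (none j<N)
    ... | inj₂ ≡.refl = ℕₚ.≤-refl , ℕₚ.≤-refl
  ... | yes p | inj₂ (c , d , d<N , Pc , Pd , between) = inj₂ (c , N , ℕₚ.≤-refl , Pc , p , between′)
    where
    between′ : ∀ {j} → j ℕ.< suc N → P j → c ℕ.≤ j × j ℕ.≤ N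
    between′ (s≤s j≤N) Pj with ℕₚ.m≤n⇒m<n∨m≡n j≤N
    ... | inj₁ j<N    = proj₁ (between j<N Pj) , j≤N
    ... | inj₂ ≡.refl = ℕₚ.≤-trans (proj₁ (between d<N Pd)) (ℕₚ.<⇒≤ d<N) , ℕₚ.≤-refl

  cell-< : ∀ {M i j x y} → 0 ℕ.< M → i ℕ.< j → InCell M i x → InCell M j y → x ≤ y
  cell-< {M} {i} {j} 0<M i<j (_ , Mx<1+i) (j≤My , _) =
    *-cancelˡ-≤ (fromℕ-pos 0<M) (≤-trans (<⇒≤ Mx<1+i) (≤-trans (fromℕ-mono i<j) j≤My))

  -- c and d are the first and the last cell that meet I. A cell strictly between them lies between
  -- two points of I, hence in I by convexity. Only the two end cells stay undecided.
  intervalCells : ∀ {I M} → 0 ℕ.< M → IsInterval I → ∃₂ λ c d → d ℕ.< M ×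
    (∀ {x j} → x ∈ I → j ℕ.< M → InCell M j x → (c ℕ.< j × j ℕ.< d) ⊎ (j ≡ c ⊎ j ≡ d)) ×
    (∀ {x j} → c ℕ.< j → j ℕ.< d → InCell M j x → x ∈ I)
  intervalCells {I} {M} 0<M convex with extremes (λ j → ∃ λ x → x ∈ I × InCell M j x) M
  -- No cell meets I: with the default c = d = 0 no cell lies strictly between.
  ... | inj₁ none = 0 , 0 , 0<M , (λ x∈I j<M inCell → contradiction (_ , x∈I , inCell) (none j<M)) , λ _ ()
  ... | inj₂ (c , d , d<M , (x₀ , x₀∈I , x₀-cell) , (x₁ , x₁∈I , x₁-cell) , between) =
    c , d , d<M , inside , λ c<j j<d inCell → convex x₀∈I x₁∈I (cell-< 0<M c<j x₀-cell inCell) (cell-< 0<M j<d inCell x₁-cell)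
    where
    inside : ∀ {x j} → x ∈ I → j ℕ.< M → InCell M j x → (c ℕ.< j × j ℕ.< d) ⊎ (j ≡ c ⊎ j ≡ d)
    inside x∈I j<M inCell with c≤j , j≤d ← between j<M (_ , x∈I , inCell)
      with ℕₚ.m≤n⇒m<n∨m≡n c≤j | ℕₚ.m≤n⇒m<n∨m≡n j≤d
    ... | inj₂ c≡j | _        = inj₂ (inj₁ (≡.sym c≡j))
    ... | inj₁ _   | inj₂ j≡d = inj₂ (inj₂ j≡d)
    ... | inj₁ c<j | inj₁ j<d = inj₁ (c<j , j<d)

  suc-% : ∀ x M .{{_ : NonZero M}} → suc x % M ≡ suc (x % M) % M
  suc-% x M = ≡.trans (cong (λ y → suc y % M) (m≡m%n+[m/n]*n x M)) ([m+kn]%n≡m%n (suc (x % M)) (x / M) M)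

  module Cells {M : ℕ} .{{M≢0 : NonZero M}} (n : ℕ) (c d : ℕ → ℕ) (d<M : ∀ k → d k ℕ.< M) where
    open SecondMoment ℝ M using (Majorises)

    Inside : ℕ → Set
    Inside j = ∃ λ k → k ℕ.< n × c k ℕ.< j × j ℕ.< d k

    -- `g` is an inner approximation: its cells contain only points of the set. It can change from x
    -- to x + 1 only on leaving a first cell (x = c k) or on reaching a last one (x + 1 = d k);
    -- these are the steps counted by `v`.
    g v : ℕ → Carrier
    g x = 𝟙 (Inside (x % M))
    v x = Σ< n λ k → 𝟙 (x % M ≡ c k) + 𝟙 (suc x % M ≡ d k)

    boundary : ℕ → Carrier
    boundary j = Σ< n λ k → 𝟙 (j ≡ c k) + 𝟙 (j ≡ d k)

    g-periodic : Periodic M g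
    g-periodic x = reflexive (cong (λ y → 𝟙 (Inside y)) ([m+n]%n≡m%n x M))

    v-periodic : Periodic M v
    v-periodic x = reflexive (cong₂ (λ y z → Σ< n λ k → 𝟙 (y ≡ c k) + 𝟙 (z ≡ d k)) ([m+n]%n≡m%n x M) ([m+n]%n≡m%n (suc x) M))

    v-nonNeg : ∀ x → 0# ≤ v x
    v-nonNeg x = Σ-nonNeg n λ k → +-nonNeg (0≤𝟙 _) (0≤𝟙 _)

    Σ-%≤1 : ∀ e → Σ< M (λ x → 𝟙 (x % M ≡ e)) ≤ 1#
    Σ-%≤1 e = ≤-respˡ-≈ (Σ-cong< M λ x<M → reflexive (cong (λ y → 𝟙 (y ≡ e)) (≡.sym (m<n⇒m%n≡m x<M)))) (Σ𝟙≡≤1 M e)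

    double-count : ∀ {φ ψ : ℕ → ℕ → Carrier} → (∀ k → Σ< M (λ x → φ x k) ≤ 1#) → (∀ k → Σ< M (λ x → ψ x k) ≤ 1#) →
                   Σ< M (λ x → Σ< n (λ k → φ x k + ψ x k)) ≤ fromℕ n * fromℕ 2
    double-count {φ} {ψ} φ≤1 ψ≤1 = begin
      Σ< M (λ x → Σ< n (λ k → φ x k + ψ x k))                ≈⟨ Σ-comm M n _ ⟩
      Σ< n (λ k → Σ< M (λ x → φ x k + ψ x k))                ≈⟨ Σ-cong n (λ k → Σ-+ M _ _) ⟩
      Σ< n (λ k → Σ< M (λ x → φ x k) + Σ< M (λ x → ψ x k))   ≤⟨ Σ-mono n (λ k → +-mono-≤ (φ≤1 k) (ψ≤1 k)) ⟩
      Σ< n (λ k → 1# + 1#)                                   ≈⟨ Σ-const n _ ⟩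
      fromℕ n * (1# + 1#)                                    ≈⟨ *-congˡ (+-congˡ (sym (+-identityʳ 1#))) ⟩
      fromℕ n * fromℕ 2                                      ∎
      where open ≤-Reasoning

    Σv≤ : Σ< M v ≤ fromℕ n * fromℕ 2
    Σv≤ = double-count (λ k → Σ-%≤1 (c k)) λ k → ≤-respˡ-≈ (trans
        (sym (Σ-shift {M} {λ x → 𝟙 (x % M ≡ d k)} (λ x → reflexive (cong (λ y → 𝟙 (y ≡ d k)) ([m+n]%n≡m%n x M))) 1))
        (Σ-cong M λ x → reflexive (cong (λ y → 𝟙 (y % M ≡ d k)) (ℕₚ.+-comm x 1))))
      (Σ-%≤1 (d k))

    Σboundary≤ : Σ< M boundary ≤ fromℕ n * fromℕ 2
    Σboundary≤ = double-count (λ k → Σ𝟙≡≤1 M (c k)) (λ k → Σ𝟙≡≤1 M (d k))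

    1≤v : ∀ {x k} → k ℕ.< n → x % M ≡ c k ⊎ suc x % M ≡ d k → 1# ≤ v x
    1≤v {x} {k} k<n at = ≤-trans (1≤𝟙+𝟙 at) (term≤Σ {n} {k} {λ k → 𝟙 (x % M ≡ c k) + 𝟙 (suc x % M ≡ d k)} (λ i → +-nonNeg (0≤𝟙 _) (0≤𝟙 _)) k<n)

    majorises : Majorises v g
    majorises x = 𝟙≤ (+-nonNeg (0≤𝟙 _) (v-nonNeg x)) enter , 𝟙≤ (+-nonNeg (0≤𝟙 _) (v-nonNeg x)) leave
      where
      step : ∀ {a b} → 1# ≤ a ⊎ 1# ≤ b → 0# ≤ a → 0# ≤ b → 1# ≤ a + b
      step (inj₁ 1≤a) 0≤a 0≤b = ≤-trans 1≤a (≤-by 0≤b refl)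
      step (inj₂ 1≤b) 0≤a 0≤b = ≤-trans 1≤b (≤-by 0≤a (+-comm _ _))
      enter : Inside (suc x % M) → 1# ≤ g x + v x
      enter (k , k<n , c<y , y<d) = step one (0≤𝟙 _) (v-nonNeg x)
        where
        y≡ : suc x % M ≡ suc (x % M)
        y≡ with ℕₚ.m≤n⇒m<n∨m≡n (m%n<n x M)
        ... | inj₁ lt = ≡.trans (suc-% x M) (m<n⇒m%n≡m lt)
        -- At the wrap-around the new residue is 0, which is never strictly to the right of c.
        ... | inj₂ eq = contradiction (subst (c k ℕ.<_) (≡.trans (suc-% x M) (≡.trans (cong (_% M) eq) (n%n≡0 M))) c<y) λ ()
        one : 1# ≤ g x ⊎ 1# ≤ v x
        one with ℕₚ.m≤n⇒m<n∨m≡n (ℕₚ.≤-pred (subst (c k ℕ.<_) y≡ c<y))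
        ... | inj₁ c<x = inj₁ (≤-reflexive (sym (𝟙-yes (k , k<n , c<x , ℕₚ.<-trans (ℕₚ.n<1+n _) (subst (ℕ._< d k) y≡ y<d)))))
        ... | inj₂ c≡x = inj₂ (1≤v k<n (inj₁ (≡.sym c≡x)))
      leave : Inside (x % M) → 1# ≤ g (suc x) + v x
      leave (k , k<n , c<x , x<d) = step one (0≤𝟙 _) (v-nonNeg x)
        where
        y≡ : suc x % M ≡ suc (x % M)
        y≡ = ≡.trans (suc-% x M) (m<n⇒m%n≡m (ℕₚ.≤-<-trans x<d (d<M k)))
        one : 1# ≤ g (suc x) ⊎ 1# ≤ v x
        one with ℕₚ.m≤n⇒m<n∨m≡n x<d
        ... | inj₁ y<d = inj₁ (≤-reflexive (sym (𝟙-yes (k , k<n , subst (c k ℕ.<_) (≡.sym y≡) (ℕₚ.<-trans c<x (ℕₚ.n<1+n _)) , subst (ℕ._< d k) (≡.sym y≡) y<d))))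
        ... | inj₂ y≡d = inj₂ (1≤v k<n (inj₂ (≡.trans y≡ y≡d)))

    -- The inner cells and two boundary cells per interval cover R. The leading 2 is due to
    -- `cellCover`, whose intervals are twice as long as the cells.
    ℙ≤cells : ∀ {R} (J : ℕ → Subset) → (∀ {x} → x ∈ R → ∃ λ k → k ℕ.< n × x ∈ J k) →
              (∀ {k x j} → x ∈ J k → j ℕ.< M → InCell M j x → (c k ℕ.< j × j ℕ.< d k) ⊎ (j ≡ c k ⊎ j ≡ d k)) →
              ℙ R ≤ fromℕ 2 * fromℕ M ⁻¹ * (Σ< M g + fromℕ n * fromℕ 2)
    ℙ≤cells {R} J split inside = ≤-trans (ℙ≤ (cellCover Met 0<M proj₂ met)) (*-monoˡ-≤
        (*-nonNeg (fromℕ-nonNeg 2) (⁻¹-nonNeg (fromℕ-pos 0<M)))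
        (≤-trans (Σ-mono< M met≤) (≤-respˡ-≈ (sym (Σ-+ M _ _)) (+-monoʳ-≤ _ Σboundary≤))))
      where
      0<M : 0 ℕ.< M
      0<M = ℕ.>-nonZero⁻¹ M
      Met : ℕ → Set
      Met j = Inside j ⊎ ∃ λ k → k ℕ.< n × (j ≡ c k ⊎ j ≡ d k)
      met : ∀ {x i} → x ∈ R ∩ [0,1⟩ → i ℕ.< M → InCell M i x → Met i
      met (x∈R , _) i<M inCell with k , k<n , x∈J ← split x∈R with inside x∈J i<M inCell
      ... | inj₁ (c<i , i<d) = inj₁ (k , k<n , c<i , i<d)
      ... | inj₂ i≡          = inj₂ (k , k<n , i≡)
      boundary-nonNeg : ∀ j → 0# ≤ boundary j
      boundary-nonNeg j = Σ-nonNeg n λ k → +-nonNeg (0≤𝟙 _) (0≤𝟙 _)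
      met≤ : ∀ {j} → j ℕ.< M → 𝟙 (Met j) ≤ g j + boundary j
      met≤ {j} j<M = 𝟙≤ (+-nonNeg (0≤𝟙 _) (boundary-nonNeg j)) λ where
          (inj₁ i) → ≤-by (boundary-nonNeg j) (+-congʳ (sym (𝟙-yes (subst Inside (≡.sym (m<n⇒m%n≡m j<M)) i))))
          (inj₂ (k , k<n , j≡)) → ≤-trans (≤-trans (1≤𝟙+𝟙 j≡) (term≤Σ {n} {k} {λ k → 𝟙 (j ≡ c k) + 𝟙 (j ≡ d k)} (λ i → +-nonNeg (0≤𝟙 _) (0≤𝟙 _)) k<n)) (≤-by (0≤𝟙 _) (+-comm _ _))

  div-bounds : ∀ i {r} → 0 ℕ.< r → r ℕ.* (i div r) ℕ.≤ i × suc i ℕ.≤ r ℕ.* suc (i div r)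
  div-bounds i {r@(suc _)} _ = subst (ℕ._≤ i) (ℕₚ.*-comm (i / r) r) (m/n*n≤m i r) , (begin
    suc i                        ≡⟨ cong suc (m≡m%n+[m/n]*n i r) ⟩
    suc (i % r) ℕ.+ i / r ℕ.* r  ≤⟨ ℕₚ.+-monoˡ-≤ _ (m%n<n i r) ⟩
    r ℕ.+ i / r ℕ.* r            ≡⟨ cong (r ℕ.+_) (ℕₚ.*-comm (i / r) r) ⟩
    r ℕ.+ r ℕ.* (i / r)          ≡⟨ ℕₚ.*-suc r (i / r) ⟨
    r ℕ.* suc (i / r)            ∎)
    where open ℕₚ.≤-Reasoning

  cell-dilate : ∀ {M Q i p α} .{{_ : NonZero M}} → 0 ℕ.< p → 0 ℕ.< Q → p ∣ Q → InCell (M ℕ.* Q) i α →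
                ∃ λ y → IsFractionalPart (fromℕ p * α) y × InCell M ((i div (Q div p)) % M) y
  cell-dilate {M} {Q} {i} {p} {α} 0<p 0<Q p∣Q (i≤Nα , Nα<1+i) =
    y , ((0≤y , y<1) , ℤ.+ (T / M) , solve 2 (λ z w → z := w :+ (z :- w)) refl (fromℕ p * α) (fromℕ (T / M))) , lower , upper
    where
    r = Q div p
    pr≡Q : p ℕ.* r ≡ Q
    pr≡Q = *-div 0<p p∣Q
    0<r : 0 ℕ.< r
    0<r = div-pos 0<p p∣Q 0<Q
    -- T is the index of the cell of pα on the whole line: its quotient by M is the integer part of
    -- pα, its remainder the cell of the fractional part.
    T = i div r
    m = fromℕ M
    y = fromℕ p * α - fromℕ (T / M)
    Nα≈ : fromℕ (M ℕ.* Q) * α ≈ fromℕ r * (m * (fromℕ p * α))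
    Nα≈ = trans (*-congʳ (trans (fromℕ-* M Q) (*-congˡ (trans (reflexive (cong fromℕ (≡.sym pr≡Q))) (fromℕ-* p r)))))
      (solve 4 (λ m p r α → m :* (p :* r) :* α := r :* (m :* (p :* α))) refl m (fromℕ p) (fromℕ r) α)
    T≤ : fromℕ T ≤ m * (fromℕ p * α)
    T≤ = *-cancelˡ-≤ (fromℕ-pos 0<r) (≤-respˡ-≈ (fromℕ-* r T) (≤-respʳ-≈ Nα≈ (≤-trans (fromℕ-mono (proj₁ (div-bounds i 0<r))) i≤Nα)))
    <1+T : m * (fromℕ p * α) < fromℕ (suc T)
    <1+T = *-cancelˡ-< (fromℕ-nonNeg r) (≤-<-trans (≤-reflexive (sym Nα≈)) (<-≤-trans Nα<1+i
      (≤-respʳ-≈ (fromℕ-* r (suc T)) (fromℕ-mono (proj₂ (div-bounds i 0<r))))))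
    T≈ : fromℕ T ≈ fromℕ (T % M) + fromℕ (T / M) * m
    T≈ = trans (reflexive (cong fromℕ (m≡m%n+[m/n]*n T M))) (trans (fromℕ-+ (T % M) (T / M ℕ.* M)) (+-congˡ (fromℕ-* (T / M) M)))
    my≈ : m * y ≈ m * (fromℕ p * α) - fromℕ (T / M) * m
    my≈ = solve 3 (λ m z w → m :* (z :- w) := m :* z :- w :* m) refl m (fromℕ p * α) (fromℕ (T / M))
    lower : fromℕ (T % M) ≤ m * y
    lower = ≤-respˡ-≈ (trans (+-congʳ T≈) (solve 2 (λ a b → a :+ b :- b := a) refl _ _)) (≤-respʳ-≈ (sym my≈) (+-monoˡ-≤ _ T≤))
    upper : m * y < fromℕ (suc (T % M))
    upper = ≰⇒> λ le → <⇒≱ <1+T (≤-respˡ-≈ (trans (+-assoc _ _ _) (+-congˡ (sym T≈)))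
      (≤-respʳ-≈ (trans (+-congʳ my≈) (solve 2 (λ a b → a :- b :+ b := a) refl _ _)) (+-monoˡ-≤ (fromℕ (T / M) * m) le)))
    0<m : 0# < m
    0<m = fromℕ-pos (ℕ.>-nonZero⁻¹ M)
    0≤y : 0# ≤ y
    0≤y = *-cancelˡ-≤ 0<m (≤-respˡ-≈ (sym (zeroʳ m)) (≤-trans (fromℕ-nonNeg (T % M)) lower))
    y<1 : y < 1#
    y<1 = *-cancelˡ-< (<⇒≤ 0<m) (<-≤-trans upper (≤-respʳ-≈ (sym (*-identityʳ m)) (fromℕ-mono (m%n<n T M))))

  -- Covering the α whose multiples miss R

  record UnionOfIntervals (n : ℕ) (R : Subset) : Set₁ where
    field
      part     : ℕ → Subset
      convex   : ∀ k → IsInterval (part k)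
      split    : ∀ {x} → x ∈ R → ∃ λ k → k ℕ.< n × x ∈ part k
      includes : ∀ {k x} → x ∈ part k → x ∈ R

  unionOfIntervals : ∀ {N R} → IsDisjointUnionOfIntervals≤ N R → ∃ λ n → fromℕ n ≤ N × UnionOfIntervals n R
  unionOfIntervals (n , I , n≤N , convex , _ , R⊆⋃ , ⋃⊆R) = n , n≤N , record
    -- The parts from n on are empty; indexing by ℕ agrees with `Σ<` and with the end cells in
    -- `Cells`.
    { part     = λ k x → Σ (k ℕ.< n) λ k<n → x ∈ I (fromℕ< k<n)
    ; convex   = λ k (k<n , x∈) (_ , z∈) x≤y y≤z → k<n , convex (fromℕ< k<n) x∈ z∈ x≤y y≤z
    ; split    = λ {x} x∈R → let i , x∈I = R⊆⋃ x∈R in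
                   toℕ i , Finₚ.toℕ<n i , Finₚ.toℕ<n i , subst (λ j → x ∈ I j) (≡.sym (Finₚ.fromℕ<-toℕ i (Finₚ.toℕ<n i))) x∈I
    ; includes = λ (k<n , x∈) → ⋃⊆R (fromℕ< k<n , x∈)
    }

  Hit : Subset → Carrier → ℕ → Set
  Hit R α h = ∃ λ y → IsFractionalPart (fromℕ h * α) y × y ∈ R

  Missed : ℕ → Subset → Subset
  Missed H R α = α ∈ [0,1⟩ × ¬ ∃ λ h → 1 ℕ.≤ h × h ℕ.≤ H × Hit R α h

  -- The boundary cells contribute 4n/m, and 8n ≤ mδ makes this at most δ/2, which is absorbed on
  -- the left. So the inner cells alone have density μ ≥ δ/4.
  density≤ : ∀ {m S n δ} → 0# < m → δ ≤ fromℕ 2 * m ⁻¹ * (S + n * fromℕ 2) → fromℕ 8 * n ≤ m * δ →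
             δ ≤ fromℕ 4 * (m ⁻¹ * S)
  density≤ {m} {S} {n} {δ} 0<m δ≤ fine = *-cancelˡ-≤ 0<m (≤-respˡ-≈ (solve 1 (λ x → :2 :* x :- x := x) refl (m * δ))
    (≤-respʳ-≈ (solve 2 (λ x y → y :+ x :- x := y) refl (m * δ) _) (+-monoˡ-≤ (- (m * δ)) (begin
      fromℕ 2 * (m * δ)
        ≤⟨ *-monoˡ-≤ (fromℕ-nonNeg 2) (*-monoˡ-≤ (<⇒≤ 0<m) δ≤) ⟩
      fromℕ 2 * (m * (fromℕ 2 * m ⁻¹ * (S + n * fromℕ 2)))
        ≈⟨ solve 4 (λ m i S n → :2 :* (m :* (:2 :* i :* (S :+ n :* :2))) := m :* (:4 :* (i :* S)) :+ m :* i :* (:8 :* n)) refl m (m ⁻¹) S n ⟩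
      m * (fromℕ 4 * (m ⁻¹ * S)) + m * m ⁻¹ * (fromℕ 8 * n)
        ≈⟨ +-congˡ (trans (*-congʳ (*-inverseʳ m (>⇒≉0 0<m))) (*-identityˡ _)) ⟩
      m * (fromℕ 4 * (m ⁻¹ * S)) + fromℕ 8 * n
        ≤⟨ +-monoʳ-≤ _ fine ⟩
      m * (fromℕ 4 * (m ⁻¹ * S)) + m * δ ∎))))
    where open ≤-Reasoning

  -- The 8 is 2 · 4: the doubled length of the intervals in `cellCover` and the loss in δ ≤ 4μ. The
  -- density of the primes enters as ν ≤ sK.
  length≤ : ∀ {N S ν s K μ δ k} → 0# < N → 0# ≤ S → 0# ≤ ν → 0# ≤ s → 0# ≤ μ →
            ν ≤ s * K → δ ≤ fromℕ 4 * μ → S * (K * μ) ≤ N * k →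
            fromℕ 2 * N ⁻¹ * S * (ν * δ) ≤ fromℕ 8 * (s * k)
  length≤ {N} {S} {ν} {s} {K} {μ} {δ} {k} 0<N 0≤S 0≤ν 0≤s 0≤μ ν≤sK δ≤4μ le = begin
    fromℕ 2 * N ⁻¹ * S * (ν * δ)
      ≤⟨ *-monoˡ-≤ (*-nonNeg (*-nonNeg (fromℕ-nonNeg 2) 0≤N⁻¹) 0≤S) (*-mono-≤ 0≤ν (*-nonNeg (fromℕ-nonNeg 4) 0≤μ) ν≤sK δ≤4μ) ⟩
    fromℕ 2 * N ⁻¹ * S * (s * K * (fromℕ 4 * μ))
      ≈⟨ solve 5 (λ i S s K μ → :2 :* i :* S :* (s :* K :* (:4 :* μ)) := :8 :* s :* i :* (S :* (K :* μ))) refl (N ⁻¹) S s K μ ⟩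
    fromℕ 8 * s * N ⁻¹ * (S * (K * μ))
      ≤⟨ *-monoˡ-≤ (*-nonNeg (*-nonNeg (fromℕ-nonNeg 8) 0≤s) 0≤N⁻¹) le ⟩
    fromℕ 8 * s * N ⁻¹ * (N * k)
      ≈⟨ solve 5 (λ e s i n k → e :* s :* i :* (n :* k) := (i :* n) :* (e :* (s :* k))) refl (fromℕ 8) s (N ⁻¹) N k ⟩
    N ⁻¹ * N * (fromℕ 8 * (s * k))
      ≈⟨ trans (*-congʳ (*-inverseˡ 0<N)) (*-identityˡ _) ⟩
    fromℕ 8 * (s * k) ∎
    where
    open ≤-Reasoning
    0≤N⁻¹ : 0# ≤ N ⁻¹
    0≤N⁻¹ = ⁻¹-nonNeg 0<N

  -- R is approximated from both sides: δ ≤ 4μ rests on a cover by inner and boundary cells, whereas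
  -- a missed α must keep every pα out of the inner cells, all of whose points belong to R. The
  -- dilations ask for p ∣ Q and the projections for p ∣ M, hence Q ∣ M.
  missedCover-grid : ∀ {R n δ M Q H ν} .{{_ : NonZero M}} (union : UnionOfIntervals n R) (c d : ℕ → ℕ) (ps : List ℕ) s k →
    let open UnionOfIntervals union in
    (d<M : ∀ i → d i ℕ.< M) →
    (∀ {i x j} → x ∈ part i → j ℕ.< M → InCell M j x → (c i ℕ.< j × j ℕ.< d i) ⊎ (j ≡ c i ⊎ j ≡ d i)) →
    (∀ {i x j} → c i ℕ.< j → j ℕ.< d i → InCell M j x → x ∈ part i) →
    0 ℕ.< Q → Q ∣ M → All (λ p → 0 ℕ.< p × p ℕ.≤ H × p ∣ Q) ps → AllPairs Coprime ps →
    1 ℕ.≤ ν → ν ℕ.≤ s ℕ.* length ps →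
    0# < δ → δ ≤ ℙ R → fromℕ 8 * fromℕ n ≤ fromℕ M * δ →
    fromℕ 4 * (fromℕ n * fromℕ 2 * (fromℕ n * fromℕ 2) * Σ1/p² ps ^ suc k) ≤ δ →
    ∃ λ t → FiniteCover (Missed H R) t × t * (fromℕ ν * δ) ≤ fromℕ 8 * (fromℕ s * fromℕ (suc (suc k)))
  missedCover-grid {R} {n} {δ} {M} {Q} {H} {ν} union c d ps s k d<M inside includes′ 0<Q Q∣M facts coprime 1≤ν ν≤sK 0<δ δ≤ℙ fine decay =
    fromℕ 2 * fromℕ (M ℕ.* Q) ⁻¹ * Σ< (M ℕ.* Q) b , cellCover Bad 0<N proj₁ bad ,
    length≤ (fromℕ-pos 0<N) (Σ-nonNeg (M ℕ.* Q) λ i → 0≤𝟙 _) (fromℕ-nonNeg ν) (fromℕ-nonNeg s) (<⇒≤ 0<μ)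
      (≤-respʳ-≈ (fromℕ-* s (length ps)) (fromℕ-mono ν≤sK)) δ≤4μ exceptional
    where
    open UnionOfIntervals union
    open Cells {M} n c d d<M
    0<M : 0 ℕ.< M
    0<M = ℕ.>-nonZero⁻¹ M
    0<N : 0 ℕ.< M ℕ.* Q
    0<N = ℕₚ.*-mono-≤ 0<M 0<Q
    0<m : 0# < fromℕ M
    0<m = fromℕ-pos 0<M
    μ : Carrier
    μ = fromℕ M ⁻¹ * Σ< M g
    mμ≈ : fromℕ M * μ ≈ Σ< M g
    mμ≈ = trans (sym (*-assoc _ _ _)) (trans (*-congʳ (*-inverseʳ _ (>⇒≉0 0<m))) (*-identityˡ _))
    δ≤4μ : δ ≤ fromℕ 4 * μ
    δ≤4μ = density≤ 0<m (≤-trans δ≤ℙ (ℙ≤cells part split inside)) fine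
    0<μ : 0# < μ
    0<μ = *-cancelˡ-< (fromℕ-nonNeg 4) (≤-<-trans (≤-reflexive (zeroʳ (fromℕ 4))) (<-≤-trans 0<δ δ≤4μ))
    small : fromℕ n * fromℕ 2 * (fromℕ n * fromℕ 2) * Σ1/p² ps ^ suc k ≤ μ
    small = *-cancelˡ-≤ (fromℕ-pos {4} (s≤s z≤n)) (≤-trans decay δ≤4μ)
    0<K : 0 ℕ.< length ps
    0<K = ℕₚ.n≢0⇒n>0 λ K≡0 → ℕₚ.<-irrefl ≡.refl (ℕₚ.≤-trans 1≤ν (ℕₚ.≤-trans ν≤sK (ℕₚ.≤-reflexive (≡.trans (cong (s ℕ.*_) K≡0) (ℕₚ.*-zeroʳ s)))))
    Bad : ℕ → Set
    Bad i = All (λ p → ¬ Inside ((i div (Q div p)) % M)) ps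
    bad : ∀ {α i} → α ∈ Missed H R → i ℕ.< M ℕ.* Q → InCell (M ℕ.* Q) i α → Bad i
    bad {α} {i} (_ , miss) _ inCell = All.map avoids facts
      where
      avoids : ∀ {p} → 0 ℕ.< p × p ℕ.≤ H × p ∣ Q → ¬ Inside ((i div (Q div p)) % M)
      avoids {p} (0<p , p≤H , p∣Q) (_ , _ , c<j , j<d) =
        let y , isFrac , y-cell = cell-dilate {M} {Q} {i} {p} {α} 0<p 0<Q p∣Q inCell
        in miss (p , 0<p , p≤H , y , isFrac , includes (includes′ c<j j<d y-cell))
    b : ℕ → Carrier
    b i = 𝟙 (Bad i)
    b-cases : ∀ i → b i ≈ 0# ⊎ (b i ≤ 1# × All (λ p → g (i div (Q div p)) ≈ 0#) ps)
    b-cases i with em {Bad i}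
    ... | yes bad-i = inj₂ (≤-refl , All.map 𝟙-no bad-i)
    ... | no  _     = inj₁ refl
    exceptional : Σ< (M ℕ.* Q) b * (fromℕ (length ps) * μ) ≤ fromℕ (M ℕ.* Q) * fromℕ (suc (suc k))
    exceptional = SecondMoment.exceptional≤ ℝ M {Q} {g} {v} {μ} {fromℕ n * fromℕ 2} {b} k ps 0<M 0<Q
      (All.map (λ (0<p , _ , p∣Q) → 0<p , ∣-trans p∣Q Q∣M) facts)
      (All.map (λ (_ , _ , p∣Q) → p∣Q) facts) coprime 0<K
      g-periodic (λ x → 𝟙-idem _) mμ≈ 0<μ v-periodic v-nonNeg majorises Σv≤ small b-cases

  prime-facts : ∀ H → All (λ p → 0 ℕ.< p × p ℕ.≤ H × p ∣ H !) (primesUpTo H)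
  prime-facts H = All.zipWith (λ (pr , p≤H) → facts pr p≤H) (primesUpTo-prime H , primesUpTo-≤ H)
    where
    facts : ∀ {p} → Prime p → p ℕ.≤ H → 0 ℕ.< p × p ℕ.≤ H × p ∣ H !
    facts {suc p′} pr p≤H = s≤s z≤n , p≤H , ∣-trans (m∣m*n (p′ !)) (m≤n⇒m!∣n! p≤H)
    facts {zero}   pr _   = contradiction pr ¬prime[0]

  missedCover : ∀ {R n δ} ν s k M′ → UnionOfIntervals n R → 0# < δ → δ ≤ ℙ R →
    1 ℕ.≤ ν → ν ℕ.+ ν ℕ.≤ 2 ℕ.^ s → 0 ℕ.< M′ →
    fromℕ 8 * fromℕ n ≤ fromℕ M′ * δ →
    fromℕ 4 * (fromℕ n * fromℕ 2 * (fromℕ n * fromℕ 2) * Σ1/p² (primesUpTo (ν ℕ.+ ν)) ^ suc k) ≤ δ →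
    ∃ λ t → FiniteCover (Missed (ν ℕ.+ ν) R) t × t * (fromℕ ν * δ) ≤ fromℕ 8 * (fromℕ s * fromℕ (suc (suc k)))
  missedCover {R} {n} {δ} ν s k M′ union 0<δ δ≤ℙ 1≤ν 2ν≤2^s 0<M′ fine decay =
    missedCover-grid {M = Q ℕ.* M′} {{>-nonZero 0<M}} union (λ i → proj₁ (cells i)) (λ i → proj₁ (proj₂ (cells i))) (primesUpTo (ν ℕ.+ ν)) s k
      (λ i → proj₁ (proj₂ (proj₂ (cells i))))
      (λ {i} → proj₁ (proj₂ (proj₂ (proj₂ (cells i)))))
      (λ {i} → proj₂ (proj₂ (proj₂ (proj₂ (cells i)))))
      0<Q (m∣m*n M′) (prime-facts (ν ℕ.+ ν)) (primesUpTo-coprime (ν ℕ.+ ν)) 1≤ν (n≤s*π[2n] ν s 1≤ν 2ν≤2^s)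
      0<δ δ≤ℙ (≤-trans fine (*-monoʳ-≤ (<⇒≤ 0<δ) (fromℕ-mono (ℕₚ.m≤n*m M′ Q {{>-nonZero 0<Q}})))) decay
    where
    -- The factorial is a common multiple of all primes up to 2ν, so one grid serves every dilation;
    -- the factor M′ supplies the fineness.
    Q : ℕ
    Q = (ν ℕ.+ ν) !
    0<Q : 0 ℕ.< Q
    0<Q = ℕₚ.1≤n! (ν ℕ.+ ν)
    0<M : 0 ℕ.< Q ℕ.* M′
    0<M = ℕₚ.*-mono-≤ 0<Q 0<M′
    cells : ∀ i → ∃₂ λ c d → d ℕ.< Q ℕ.* M′ ×
      (∀ {x j} → x ∈ UnionOfIntervals.part union i → j ℕ.< Q ℕ.* M′ → InCell (Q ℕ.* M′) j x → (c ℕ.< j × j ℕ.< d) ⊎ (j ≡ c ⊎ j ≡ d)) ×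
      (∀ {x j} → c ℕ.< j → j ℕ.< d → InCell (Q ℕ.* M′) j x → x ∈ UnionOfIntervals.part union i)
    cells i = intervalCells 0<M (UnionOfIntervals.convex union i)

  -- Asymptotics

  -- A least upper bound s of ℕ would give the smaller upper bound s - 1.
  above : ∀ x → ∃ λ n → x ≤ fromℕ n
  above x with em {∃ λ n → x ≤ fromℕ n}
  ... | yes found = found
  ... | no  none  = contradiction (s-least (s - 1#) s-1-upper) (<⇒≱ s-1<s)
    where
    bounded : ∀ y → (∃ λ n → y ≈ fromℕ n) → y ≤ x
    bounded y (n , y≈n) with total y x
    ... | inj₁ y≤x = y≤x
    ... | inj₂ x≤y = contradiction (n , ≤-respʳ-≈ y≈n x≤y) none
    sup = supremum (λ y → ∃ λ n → y ≈ fromℕ n) (0# , 0 , refl) (x , bounded)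
    s = proj₁ sup
    s-upper = proj₁ (proj₂ sup)
    s-least = proj₂ (proj₂ sup)
    s-1-upper : ∀ y → (∃ λ n → y ≈ fromℕ n) → y ≤ s - 1#
    s-1-upper y (n , y≈n) = ≤-respˡ-≈ (trans (solve 1 (λ t → :1 :+ t :- :1 := t) refl (fromℕ n)) (sym y≈n))
      (+-monoˡ-≤ (- 1#) (s-upper (fromℕ (suc n)) (suc n , refl)))
    s-1<s : s - 1# < s
    s-1<s = <-≤-trans (x<1+x (s - 1#)) (≤-reflexive (solve 1 (λ s → :1 :+ (s :- :1) := s) refl s))

  bernoulli : ∀ {η} → 0# ≤ η → ∀ n → 1# + fromℕ n * η ≤ (1# + η) ^ n
  bernoulli {η} 0≤η zero    = ≤-reflexive (trans (+-congˡ (zeroˡ η)) (+-identityʳ 1#))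
  bernoulli {η} 0≤η (suc n) = ≤-trans
    (≤-by (*-nonNeg (fromℕ-nonNeg n) (0≤x*x η))
      (solve 2 (λ n e → :1 :+ (:1 :+ n) :* e :+ n :* (e :* e) := (:1 :+ e) :* (:1 :+ n :* e)) refl (fromℕ n) η))
    (*-monoˡ-≤ (+-nonNeg 0≤1 0≤η) (bernoulli 0≤η n))

  x≈x*y⁻¹*y : ∀ {x y} → 0# < y → x ≈ x * y ⁻¹ * y
  x≈x*y⁻¹*y {x} 0<y = sym (trans (*-assoc _ _ _) (trans (*-congˡ (*-inverseˡ 0<y)) (*-identityʳ x)))

  -- Cubing (1+η)^m ≥ mη gives a cubic lower bound at L = 3m, while C L² = 9Cm² is only quadratic;
  -- any m with mη³ ≥ 9C will do.
  growth : ∀ {η} → 0# < η → ∀ C L₀ → ∃ λ L → L₀ ℕ.≤ L × 1 ℕ.≤ L × C * (fromℕ L * fromℕ L) ≤ (1# + η) ^ L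
  growth {η} 0<η C L₀ = m ℕ.* 3 , ℕₚ.≤-trans L₀≤m (ℕₚ.m≤m*n m 3) , s≤s z≤n , (begin
    C * (fromℕ (m ℕ.* 3) * fromℕ (m ℕ.* 3))  ≈⟨ *-congˡ (*-cong (fromℕ-* m 3) (fromℕ-* m 3)) ⟩
    C * (fromℕ m * fromℕ 3 * (fromℕ m * fromℕ 3)) ≈⟨ solve 3 (λ C m t → C :* (m :* t :* (m :* t)) := t :* t :* C :* (m :* m)) refl C (fromℕ m) (fromℕ 3) ⟩
    fromℕ 3 * fromℕ 3 * C * (fromℕ m * fromℕ m) ≤⟨ *-monoʳ-≤ (0≤x*x (fromℕ m)) 9C≤me ⟩
    fromℕ m * e * (fromℕ m * fromℕ m)        ≈⟨ solve 2 (λ m η → m :* (η :* (η :* η)) :* (m :* m) := m :* η :* (m :* η :* (m :* η :* :1))) refl (fromℕ m) η ⟩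
    (fromℕ m * η) ^ 3                        ≤⟨ ^-mono-≤ 3 (*-nonNeg (fromℕ-nonNeg m) (<⇒≤ 0<η)) mη≤ ⟩
    ((1# + η) ^ m) ^ 3                       ≈⟨ ^-assocʳ (1# + η) m 3 ⟩
    (1# + η) ^ (m ℕ.* 3)                     ∎)
    where
    open ≤-Reasoning
    e = η * (η * η)
    0<e : 0# < e
    0<e = *-pos 0<η (*-pos 0<η 0<η)
    n = proj₁ (above (fromℕ 3 * fromℕ 3 * C * e ⁻¹))
    m = suc (L₀ ℕ.+ n)
    L₀≤m : L₀ ℕ.≤ m
    L₀≤m = ℕₚ.m≤n⇒m≤1+n (ℕₚ.m≤m+n L₀ n)
    9C≤me : fromℕ 3 * fromℕ 3 * C ≤ fromℕ m * e
    9C≤me = ≤-respˡ-≈ (sym (x≈x*y⁻¹*y 0<e)) (*-monoʳ-≤ (<⇒≤ 0<e)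
      (≤-trans (proj₂ (above (fromℕ 3 * fromℕ 3 * C * e ⁻¹))) (fromℕ-mono (ℕₚ.m≤n⇒m≤1+n (ℕₚ.m≤n+m n L₀)))))
    mη≤ : fromℕ m * η ≤ (1# + η) ^ m
    mη≤ = ≤-trans (≤-by 0≤1 (+-comm _ _)) (bernoulli (<⇒≤ 0<η) m)

  -- The sum of 1/p² and the choice of k

  inv : ℕ → Carrier
  inv n = fromℕ n ⁻¹

  inv-nonNeg : ∀ n → 0# ≤ inv (suc n)
  inv-nonNeg n = ⁻¹-nonNeg (fromℕ-pos {suc n} (s≤s z≤n))

  -- 3/4 arises as 1/4 + Σ 1/(n(n-1)) over n ≥ 3. What matters is that it is below 1, so that the
  -- bound of `energy≤` decays geometrically in k.
  θ : Carrier
  θ = fromℕ 3 * inv 4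

  4*inv4≈1 : fromℕ 4 * inv 4 ≈ 1#
  4*inv4≈1 = *-inverseʳ _ (>⇒≉0 (fromℕ-pos {4} (s≤s z≤n)))

  -- The telescoping step 1/(n+1) - 1/(n+2) = 1/((n+1)(n+2)) ≥ 1/(n+2)².
  inv-square≤ : ∀ n → inv (suc (suc n)) * inv (suc (suc n)) + inv (suc (suc n)) ≤ inv (suc n)
  inv-square≤ n = ≤-respʳ-≈ (sym a≈) (≤-respˡ-≈ (+-comm _ _) (+-monoʳ-≤ b (*-monoʳ-≤ 0≤b b≤a)))
    where
    a = inv (suc n)
    b = inv (suc (suc n))
    0≤a : 0# ≤ a
    0≤a = inv-nonNeg n
    0≤b : 0# ≤ b
    0≤b = inv-nonNeg (suc n)
    a≈ : a ≈ b + a * b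
    a≈ = begin
      a                                        ≈⟨ *-identityʳ a ⟨
      a * 1#                                   ≈⟨ *-congˡ (*-inverseʳ _ (>⇒≉0 (fromℕ-pos {suc (suc n)} (s≤s z≤n)))) ⟨
      a * ((1# + fromℕ (suc n)) * b)           ≈⟨ solve 3 (λ a b n → a :* ((:1 :+ n) :* b) := (a :* n) :* b :+ a :* b) refl a b (fromℕ (suc n)) ⟩
      a * fromℕ (suc n) * b + a * b            ≈⟨ +-congʳ (trans (*-congʳ (*-inverseˡ (fromℕ-pos {suc n} (s≤s z≤n)))) (*-identityˡ b)) ⟩
      b + a * b                                ∎
      where open ≈-Reasoning
    b≤a : b ≤ a
    b≤a = ≤-by (*-nonNeg 0≤a 0≤b) (sym a≈)

  Σ1/p²-suc : ∀ n → Σ1/p² (primesUpTo (suc n)) ≤ inv (suc n) * inv (suc n) + Σ1/p² (primesUpTo n)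
  Σ1/p²-suc n with prime? (suc n)
  ... | yes _ = ≤-refl
  ... | no  _ = ≤-by (0≤x*x _) (+-comm _ _)

  -- Compare with Σ 1 / (n (n - 1)) from n = 3 on.
  Σ1/p²+inv≤θ : ∀ n → Σ1/p² (primesUpTo (suc (suc n))) + inv (suc (suc n)) ≤ θ
  Σ1/p²+inv≤θ zero = ≤-reflexive (begin
    inv 2 * inv 2 + 0# + inv 2                           ≈⟨ solve 1 (λ h → h :* h :+ :0 :+ h := (h :* h) :* :1 :+ h :* :1 :* :1) refl (inv 2) ⟩
    inv 2 * inv 2 * 1# + inv 2 * 1# * 1#                 ≈⟨ +-cong (*-congˡ 4*inv4≈1) (*-cong (*-congˡ 2*inv2≈1) 4*inv4≈1) ⟨
    inv 2 * inv 2 * (fromℕ 4 * inv 4) + inv 2 * (fromℕ 2 * inv 2) * (fromℕ 4 * inv 4)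
      ≈⟨ solve 2 (λ h q → h :* h :* (:4 :* q) :+ h :* (:2 :* h) :* (:4 :* q) := (:1 :+ :2) :* q :* ((:2 :* h) :* (:2 :* h))) refl (inv 2) (inv 4) ⟩
    (1# + fromℕ 2) * inv 4 * (fromℕ 2 * inv 2 * (fromℕ 2 * inv 2)) ≈⟨ *-congˡ (trans (*-cong 2*inv2≈1 2*inv2≈1) (*-identityˡ 1#)) ⟩
    fromℕ 3 * inv 4 * 1#                                 ≈⟨ *-identityʳ _ ⟩
    fromℕ 3 * inv 4                                      ∎)
    where
    open ≈-Reasoning
    2*inv2≈1 : fromℕ 2 * inv 2 ≈ 1#
    2*inv2≈1 = *-inverseʳ _ (>⇒≉0 (fromℕ-pos {2} (s≤s z≤n)))
  Σ1/p²+inv≤θ (suc n) = begin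
    Σ1/p² (primesUpTo (3 ℕ.+ n)) + inv (3 ℕ.+ n)                                  ≤⟨ +-monoˡ-≤ _ (Σ1/p²-suc (2 ℕ.+ n)) ⟩
    inv (3 ℕ.+ n) * inv (3 ℕ.+ n) + Σ1/p² (primesUpTo (2 ℕ.+ n)) + inv (3 ℕ.+ n)  ≈⟨ solve 3 (λ a b c → a :+ b :+ c := b :+ (a :+ c)) refl _ _ _ ⟩
    Σ1/p² (primesUpTo (2 ℕ.+ n)) + (inv (3 ℕ.+ n) * inv (3 ℕ.+ n) + inv (3 ℕ.+ n)) ≤⟨ +-monoʳ-≤ _ (inv-square≤ (suc n)) ⟩
    Σ1/p² (primesUpTo (2 ℕ.+ n)) + inv (2 ℕ.+ n)                                  ≤⟨ Σ1/p²+inv≤θ n ⟩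
    θ                                                                             ∎
    where open ≤-Reasoning

  Σ1/p²≤θ : ∀ n → 2 ℕ.≤ n → Σ1/p² (primesUpTo n) ≤ θ
  Σ1/p²≤θ (suc (suc n)) _ = ≤-trans (≤-by (inv-nonNeg (suc n)) refl) (Σ1/p²+inv≤θ n)
  Σ1/p²≤θ (suc zero) (s≤s ())

  0≤θ : 0# ≤ θ
  0≤θ = *-nonNeg (fromℕ-nonNeg 3) (inv-nonNeg 3)

  θ≤1 : θ ≤ 1#
  θ≤1 = ≤-respʳ-≈ 4*inv4≈1 (*-monoʳ-≤ (inv-nonNeg 3) (fromℕ-mono {3} {4} (s≤s (s≤s (s≤s z≤n)))))

  -- Three more projections at least halve the bound, as 27/64 < 1/2; this is why k is taken as a
  -- multiple of 3. The 10 in the proof is 4³ - 2 · 3³.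
  2θ³≤1 : fromℕ 2 * θ ^ 3 ≤ 1#
  2θ³≤1 = begin
    fromℕ 2 * (fromℕ 3 * q * (fromℕ 3 * q * (fromℕ 3 * q * 1#)))
      ≤⟨ ≤-by (*-nonNeg (fromℕ-nonNeg 10) (^-nonNeg 3 (inv-nonNeg 3)))
           (solve 1 (λ q → :2 :* (:3 :* q :* (:3 :* q :* (:3 :* q :* :1))) :+ :10 :* (q :* (q :* (q :* :1))) := (:4 :* q) :* ((:4 :* q) :* (:4 :* q))) refl q) ⟩
    fromℕ 4 * q * (fromℕ 4 * q * (fromℕ 4 * q))  ≈⟨ *-cong 4*inv4≈1 (*-cong 4*inv4≈1 4*inv4≈1) ⟩
    1# * (1# * 1#)                               ≈⟨ trans (*-identityˡ _) (*-identityˡ _) ⟩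
    1#                                           ∎
    where
    open ≤-Reasoning
    q = inv 4

  2^w*θ^3w≤1 : ∀ w → fromℕ (2 ℕ.^ w) * θ ^ (3 ℕ.* w) ≤ 1#
  2^w*θ^3w≤1 w = ≤-respˡ-≈ (*-cong (sym (fromℕ-^ 2 w)) (^-assocʳ θ 3 w)) (go w)
    where
    go : ∀ w → fromℕ 2 ^ w * (θ ^ 3) ^ w ≤ 1#
    go zero    = ≤-reflexive (*-identityˡ 1#)
    go (suc w) = ≤-respˡ-≈ (solve 4 (λ a b c d → a :* c :* (b :* d) := a :* b :* (c :* d)) refl (fromℕ 2) (fromℕ 2 ^ w) (θ ^ 3) ((θ ^ 3) ^ w))
      (≤-respʳ-≈ (*-identityˡ 1#) (*-mono-≤ (*-nonNeg (fromℕ-nonNeg 2) (^-nonNeg 3 0≤θ)) 0≤1 2θ³≤1 (go w)))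

  -- The crude n ≤ 2^n stands in for a logarithm: it turns the bounds a^L and b^L into powers of 2
  -- with exponents linear in L.
  n^L≤2^[nL] : ∀ n L → n ℕ.^ L ℕ.≤ 2 ℕ.^ (n ℕ.* L)
  n^L≤2^[nL] n L = ℕₚ.≤-trans (ℕₚ.^-monoˡ-≤ L (n≤2^n n)) (ℕₚ.≤-reflexive (ℕₚ.^-*-assoc 2 n L))
    where
    n≤2^n : ∀ n → n ℕ.≤ 2 ℕ.^ n
    n≤2^n zero    = z≤n
    n≤2^n (suc n) = ℕₚ.+-mono-≤ (ℕₚ.m^n>0 2 n) (ℕₚ.≤-trans (n≤2^n n) (ℕₚ.≤-reflexive (≡.sym (ℕₚ.+-identityʳ _))))

  -- The only cell of the grid N = 1 is covered by (-1, 1), whence 2 instead of 1.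
  ℙ≤2 : ∀ S → ℙ S ≤ fromℕ 2
  ℙ≤2 S = ≤-trans (ℙ≤ (cellCover {N = 1} (λ _ → ⊤) (s≤s z≤n) proj₂ λ _ _ _ → tt)) (≤-reflexive (begin
    fromℕ 2 * fromℕ 1 ⁻¹ * (𝟙 ⊤ + 0#)  ≈⟨ *-congˡ (+-congʳ (𝟙-yes tt)) ⟩
    fromℕ 2 * fromℕ 1 ⁻¹ * fromℕ 1      ≈⟨ x≈x*y⁻¹*y (fromℕ-pos {1} (s≤s z≤n)) ⟨
    fromℕ 2                             ∎))
    where open ≈-Reasoning

  -- ν is the integer part of X/2, because the prime count is for even limits 2ν. From 4 ≤ X follows
  -- ν ≥ 1, so rounding costs no more than X < 2(ν+1) ≤ 4ν.
  halve : ∀ {X} → fromℕ 4 ≤ X → ∃ λ ν → 1 ℕ.≤ ν × fromℕ (ν ℕ.+ ν) ≤ X × X ≤ fromℕ 4 * fromℕ ν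
  halve {X} 4≤X = choose (floor (suc n) (≤-trans (fromℕ-nonNeg 2) 2≤Y) (≤-<-trans Y≤n (x<1+x (fromℕ n))))
    where
    h = inv 2
    0<2 : 0# < fromℕ 2
    0<2 = fromℕ-pos {2} (s≤s z≤n)
    Y = h * X
    2Y≈X : fromℕ 2 * Y ≈ X
    2Y≈X = trans (sym (*-assoc _ _ _)) (trans (*-congʳ (*-inverseʳ _ (>⇒≉0 0<2))) (*-identityˡ X))
    2≤Y : fromℕ 2 ≤ Y
    2≤Y = *-cancelˡ-≤ 0<2 (≤-respʳ-≈ (sym 2Y≈X) (≤-respˡ-≈ (fromℕ-* 2 2) 4≤X))
    n = proj₁ (above Y)
    Y≤n : Y ≤ fromℕ n
    Y≤n = proj₂ (above Y)
    choose : (∃ λ i → i ℕ.< suc n × fromℕ i ≤ Y × Y < fromℕ (suc i)) →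
             ∃ λ ν → 1 ℕ.≤ ν × fromℕ (ν ℕ.+ ν) ≤ X × X ≤ fromℕ 4 * fromℕ ν
    choose (zero , _ , _ , Y<1) = contradiction (≤-trans (fromℕ-mono {1} {2} (s≤s z≤n)) 2≤Y) (<⇒≱ Y<1)
    choose (ν@(suc ν′) , _ , ν≤Y , Y<1+ν) = ν , s≤s z≤n
      , ≤-respʳ-≈ 2Y≈X (≤-respˡ-≈ (sym (trans (fromℕ-+ ν ν) (solve 1 (λ x → x :+ x := :2 :* x) refl (fromℕ ν)))) (*-monoˡ-≤ (<⇒≤ 0<2) ν≤Y))
      , ≤-respˡ-≈ 2Y≈X (≤-trans (*-monoˡ-≤ (<⇒≤ 0<2) (<⇒≤ Y<1+ν))
          (≤-by (*-nonNeg (<⇒≤ 0<2) (fromℕ-nonNeg ν′))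
            (solve 1 (λ x → :2 :* (:1 :+ (:1 :+ x)) :+ :2 :* x := :4 :* (:1 :+ x)) refl (fromℕ ν′))))

  -- The left side is at most 16 a^(2L) θ^(3w), where 16 = 4 · 2 · 2 and w is the bracket in the
  -- exponent. Multiplying by b^L δ ≥ 1 brings in δ, and w is chosen so that 16 a^(2L) b^L ≤ 2^w,
  -- which θ^(3w) then outweighs.
  decay≤ : ∀ {n σ δ} a b L → fromℕ n ≤ fromℕ (a ℕ.^ L) → 1# ≤ fromℕ (b ℕ.^ L) * δ → 0# ≤ δ → 0# ≤ σ → σ ≤ θ →
           fromℕ 4 * (fromℕ n * fromℕ 2 * (fromℕ n * fromℕ 2) * σ ^ suc (3 ℕ.* (4 ℕ.+ (a ℕ.* L ℕ.+ (a ℕ.* L ℕ.+ b ℕ.* L))))) ≤ δ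
  decay≤ {n} {σ} {δ} a b L n≤ 1≤ 0≤δ 0≤σ σ≤θ = begin
    fromℕ 4 * (fromℕ n * fromℕ 2 * (fromℕ n * fromℕ 2) * σ ^ suc (3 ℕ.* w))
      ≈⟨ solve 2 (λ n s → :4 :* (n :* :2 :* (n :* :2) :* s) := (:2 :* :8) :* (n :* n) :* s) refl (fromℕ n) (σ ^ suc (3 ℕ.* w)) ⟩
    fromℕ 2 * fromℕ 8 * (fromℕ n * fromℕ n) * σ ^ suc (3 ℕ.* w)
      ≤⟨ *-mono-≤ (*-nonNeg 0≤16 (0≤x*x _)) (^-nonNeg (3 ℕ.* w) 0≤θ)
           (*-monoˡ-≤ 0≤16 (*-mono-≤ (fromℕ-nonNeg n) (fromℕ-nonNeg (a ℕ.^ L)) n≤ n≤))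
           (≤-trans (^-mono-≤ (suc (3 ℕ.* w)) 0≤σ σ≤θ) (≤-respʳ-≈ (*-identityˡ _) (*-monoʳ-≤ (^-nonNeg (3 ℕ.* w) 0≤θ) θ≤1))) ⟩
    fromℕ 2 * fromℕ 8 * (x * x) * θ′
      ≈⟨ *-identityʳ _ ⟨
    fromℕ 2 * fromℕ 8 * (x * x) * θ′ * 1#
      ≤⟨ *-monoˡ-≤ (*-nonNeg (*-nonNeg 0≤16 (0≤x*x x)) (^-nonNeg (3 ℕ.* w) 0≤θ)) 1≤ ⟩
    fromℕ 2 * fromℕ 8 * (x * x) * θ′ * (y * δ)
      ≈⟨ solve 5 (λ c x y t d → c :* (x :* x) :* t :* (y :* d) := (c :* (x :* (x :* y))) :* t :* d) refl (fromℕ 2 * fromℕ 8) x y θ′ δ ⟩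
    fromℕ 2 * fromℕ 8 * (x * (x * y)) * θ′ * δ
      ≤⟨ *-monoʳ-≤ 0≤δ (*-monoʳ-≤ (^-nonNeg (3 ℕ.* w) 0≤θ) (≤-respˡ-≈ cast (fromℕ-mono big))) ⟩
    fromℕ (2 ℕ.^ w) * θ′ * δ
      ≤⟨ *-monoʳ-≤ 0≤δ (2^w*θ^3w≤1 w) ⟩
    1# * δ
      ≈⟨ *-identityˡ δ ⟩
    δ ∎
    where
    open ≤-Reasoning
    w = 4 ℕ.+ (a ℕ.* L ℕ.+ (a ℕ.* L ℕ.+ b ℕ.* L))
    x = fromℕ (a ℕ.^ L)
    y = fromℕ (b ℕ.^ L)
    θ′ = θ ^ (3 ℕ.* w)
    0≤16 : 0# ≤ fromℕ 2 * fromℕ 8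
    0≤16 = *-nonNeg (fromℕ-nonNeg 2) (fromℕ-nonNeg 8)
    big : 16 ℕ.* (a ℕ.^ L ℕ.* (a ℕ.^ L ℕ.* b ℕ.^ L)) ℕ.≤ 2 ℕ.^ w
    big = ℕₚ.≤-trans (ℕₚ.*-monoʳ-≤ 16 (ℕₚ.*-mono-≤ (n^L≤2^[nL] a L) (ℕₚ.*-mono-≤ (n^L≤2^[nL] a L) (n^L≤2^[nL] b L))))
      (ℕₚ.≤-reflexive (≡.sym (≡.trans (ℕₚ.^-distribˡ-+-* 2 4 (a ℕ.* L ℕ.+ (a ℕ.* L ℕ.+ b ℕ.* L))) (cong (16 ℕ.*_)
        (≡.trans (ℕₚ.^-distribˡ-+-* 2 (a ℕ.* L) (a ℕ.* L ℕ.+ b ℕ.* L)) (cong (2 ℕ.^ (a ℕ.* L) ℕ.*_) (ℕₚ.^-distribˡ-+-* 2 (a ℕ.* L) (b ℕ.* L))))))))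
    cast : fromℕ (16 ℕ.* (a ℕ.^ L ℕ.* (a ℕ.^ L ℕ.* b ℕ.^ L))) ≈ fromℕ 2 * fromℕ 8 * (x * (x * y))
    cast = trans (fromℕ-* 16 (a ℕ.^ L ℕ.* (a ℕ.^ L ℕ.* b ℕ.^ L))) (*-cong (fromℕ-* 2 8) (trans (fromℕ-* (a ℕ.^ L) (a ℕ.^ L ℕ.* b ℕ.^ L)) (*-congˡ (fromℕ-* (a ℕ.^ L) (b ℕ.^ L)))))

  -- The bad set at a single level L

  Good : (η : Carrier) → ℕ → Subset → Subset
  Good η L R α = ∃ λ h → 1 ℕ.≤ h × fromℕ h ≤ ((1# + η) ^ L) * (ℙ R) ⁻¹ × Hit R α h

  -- 32 is 4 · 8, from X ≤ 4ν and from `length≤`. The other factors bound s/L and (k+2)/L, where s =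
  -- (1+b)L and k = 12 + 3(2a+b)L; the 14 is 12 + 2.
  constant : ℕ → ℕ → ℕ
  constant a b = 32 ℕ.* ((1 ℕ.+ b) ℕ.* (14 ℕ.+ 3 ℕ.* (a ℕ.+ (a ℕ.+ b))))

  -- With the division cleared, the length t is O(L²)(1+η)^(-L), uniformly in R for given a and b.
  -- The hypothesis 8 ≤ (1+η)^L gives X ≥ 4, as ℙ R ≤ 2, so that there is room for primes below X.
  levelCover : ∀ {R n a b L η} → UnionOfIntervals n R → fromℕ n ≤ fromℕ (a ℕ.^ L) → 1# ≤ fromℕ (b ℕ.^ L) * ℙ R → 0# < ℙ R →
    1 ℕ.≤ a → 1 ℕ.≤ b → 1 ℕ.≤ L → 0# ≤ η → η ≤ 1# → fromℕ 8 ≤ (1# + η) ^ L →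
    ∃ λ t → FiniteCover (λ α → α ∈ [0,1⟩ × ¬ Good η L R α) t × t * (1# + η) ^ L ≤ fromℕ (constant a b) * (fromℕ L * fromℕ L)
  levelCover {R} {n} {a} {b} {L} {η} union n≤ 1≤ 0<δ 1≤a 1≤b 1≤L 0≤η η≤1 8≤ = finish (halve 4≤X)
    where
    δ = ℙ R
    E = (1# + η) ^ L
    X = E * δ ⁻¹
    0≤E : 0# ≤ E
    0≤E = ^-nonNeg L (+-nonNeg 0≤1 0≤η)
    Xδ≈E : X * δ ≈ E
    Xδ≈E = sym (x≈x*y⁻¹*y 0<δ)
    4≤X : fromℕ 4 ≤ X
    4≤X = *-cancelˡ-≤ 0<δ (begin
      δ * fromℕ 4         ≤⟨ *-monoʳ-≤ (fromℕ-nonNeg 4) (ℙ≤2 R) ⟩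
      fromℕ 2 * fromℕ 4   ≈⟨ fromℕ-* 2 4 ⟨
      fromℕ 8             ≤⟨ 8≤ ⟩
      E                   ≈⟨ Xδ≈E ⟨
      X * δ               ≈⟨ *-comm X δ ⟩
      δ * X               ∎)
      where open ≤-Reasoning
    -- η ≤ 1 gives E ≤ 2^L, and 1/δ ≤ b^L ≤ 2^(bL). So s bounds the binary logarithm of X, which is
    -- the loss in the prime count.
    s = L ℕ.+ b ℕ.* L
    w = 4 ℕ.+ (a ℕ.* L ℕ.+ (a ℕ.* L ℕ.+ b ℕ.* L))
    X≤2^s : X ≤ fromℕ (2 ℕ.^ s)
    X≤2^s = begin
      E * δ ⁻¹                                ≤⟨ *-mono-≤ 0≤E (fromℕ-nonNeg (b ℕ.^ L)) E≤ (≤-respˡ-≈ (*-identityˡ _) (x≤y*z⇒x*y⁻¹≤z 0<δ (≤-respʳ-≈ (*-comm _ _) 1≤))) ⟩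
      fromℕ (2 ℕ.^ L) * fromℕ (b ℕ.^ L)       ≈⟨ fromℕ-* (2 ℕ.^ L) (b ℕ.^ L) ⟨
      fromℕ (2 ℕ.^ L ℕ.* b ℕ.^ L)             ≤⟨ fromℕ-mono (ℕₚ.≤-trans (ℕₚ.*-monoʳ-≤ (2 ℕ.^ L) (n^L≤2^[nL] b L)) (ℕₚ.≤-reflexive (≡.sym (ℕₚ.^-distribˡ-+-* 2 L (b ℕ.* L))))) ⟩
      fromℕ (2 ℕ.^ s)                         ∎
      where
      open ≤-Reasoning
      E≤ : E ≤ fromℕ (2 ℕ.^ L)
      E≤ = ≤-respʳ-≈ (sym (fromℕ-^ 2 L)) (^-mono-≤ L (+-nonNeg 0≤1 0≤η) (+-monoʳ-≤ 1# (≤-respʳ-≈ (sym (+-identityʳ 1#)) η≤1)))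
    -- The factors are the 8 of `density≤`, a bound for the number of intervals and a bound for 1/δ.
    M′ = 8 ℕ.* (a ℕ.^ L ℕ.* b ℕ.^ L)
    0<M′ : 0 ℕ.< M′
    0<M′ = ℕₚ.*-mono-≤ {1} {8} (s≤s z≤n) (ℕₚ.*-mono-≤ (ℕₚ.m^n>0 a {{>-nonZero 1≤a}} L) (ℕₚ.m^n>0 b {{>-nonZero 1≤b}} L))
    fine : fromℕ 8 * fromℕ n ≤ fromℕ M′ * δ
    fine = begin
      fromℕ 8 * fromℕ n                                  ≤⟨ *-monoˡ-≤ (fromℕ-nonNeg 8) n≤ ⟩
      fromℕ 8 * fromℕ (a ℕ.^ L)                          ≈⟨ *-identityʳ _ ⟨
      fromℕ 8 * fromℕ (a ℕ.^ L) * 1#                     ≤⟨ *-monoˡ-≤ (*-nonNeg (fromℕ-nonNeg 8) (fromℕ-nonNeg (a ℕ.^ L))) 1≤ ⟩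
      fromℕ 8 * fromℕ (a ℕ.^ L) * (fromℕ (b ℕ.^ L) * δ)  ≈⟨ solve 4 (λ e x y d → e :* x :* (y :* d) := e :* (x :* y) :* d) refl (fromℕ 8) (fromℕ (a ℕ.^ L)) (fromℕ (b ℕ.^ L)) δ ⟩
      fromℕ 8 * (fromℕ (a ℕ.^ L) * fromℕ (b ℕ.^ L)) * δ  ≈⟨ *-congʳ (trans (fromℕ-* 8 (a ℕ.^ L ℕ.* b ℕ.^ L)) (*-congˡ (fromℕ-* (a ℕ.^ L) (b ℕ.^ L)))) ⟨
      fromℕ M′ * δ                                       ∎
      where open ≤-Reasoning
    count : s ℕ.* suc (suc (3 ℕ.* w)) ℕ.≤ (1 ℕ.+ b) ℕ.* (14 ℕ.+ 3 ℕ.* (a ℕ.+ (a ℕ.+ b))) ℕ.* (L ℕ.* L)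
    count = begin
      s ℕ.* suc (suc (3 ℕ.* w))                                             ≡⟨ lemma₁ a b L ⟩
      (1 ℕ.+ b) ℕ.* L ℕ.* (14 ℕ.* 1 ℕ.+ 3 ℕ.* (a ℕ.+ (a ℕ.+ b)) ℕ.* L)      ≤⟨ ℕₚ.*-monoʳ-≤ ((1 ℕ.+ b) ℕ.* L) (ℕₚ.+-monoˡ-≤ _ (ℕₚ.*-monoʳ-≤ 14 1≤L)) ⟩
      (1 ℕ.+ b) ℕ.* L ℕ.* (14 ℕ.* L ℕ.+ 3 ℕ.* (a ℕ.+ (a ℕ.+ b)) ℕ.* L)      ≡⟨ lemma₂ a b L ⟩
      (1 ℕ.+ b) ℕ.* (14 ℕ.+ 3 ℕ.* (a ℕ.+ (a ℕ.+ b))) ℕ.* (L ℕ.* L)          ∎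
      where
      open ℕₚ.≤-Reasoning
      lemma₁ : ∀ a b L → (L ℕ.+ b ℕ.* L) ℕ.* suc (suc (3 ℕ.* (4 ℕ.+ (a ℕ.* L ℕ.+ (a ℕ.* L ℕ.+ b ℕ.* L))))) ≡
               (1 ℕ.+ b) ℕ.* L ℕ.* (14 ℕ.* 1 ℕ.+ 3 ℕ.* (a ℕ.+ (a ℕ.+ b)) ℕ.* L)
      lemma₁ = solve-∀
      lemma₂ : ∀ a b L → (1 ℕ.+ b) ℕ.* L ℕ.* (14 ℕ.* L ℕ.+ 3 ℕ.* (a ℕ.+ (a ℕ.+ b)) ℕ.* L) ≡
               (1 ℕ.+ b) ℕ.* (14 ℕ.+ 3 ℕ.* (a ℕ.+ (a ℕ.+ b))) ℕ.* (L ℕ.* L)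
      lemma₂ = solve-∀
    finish : (∃ λ ν → 1 ℕ.≤ ν × fromℕ (ν ℕ.+ ν) ≤ X × X ≤ fromℕ 4 * fromℕ ν) →
             ∃ λ t → FiniteCover (λ α → α ∈ [0,1⟩ × ¬ Good η L R α) t × t * E ≤ fromℕ (constant a b) * (fromℕ L * fromℕ L)
    finish (ν , 1≤ν , 2ν≤X , X≤4ν) =
      proj₁ cover , FiniteCover-⊆ missed ≤-refl (proj₁ (proj₂ cover)) , bound (proj₁ cover) 0≤t (proj₂ (proj₂ cover))
      where
      2ν≤2^s : ν ℕ.+ ν ℕ.≤ 2 ℕ.^ s
      2ν≤2^s = ℕₚ.≮⇒≥ λ lt → <⇒≱ (fromℕ-mono-< lt) (≤-trans 2ν≤X X≤2^s)
      cover : ∃ λ t → FiniteCover (Missed (ν ℕ.+ ν) R) t × t * (fromℕ ν * δ) ≤ fromℕ 8 * (fromℕ s * fromℕ (suc (suc (3 ℕ.* w))))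
      cover = missedCover ν s (3 ℕ.* w) M′ union 0<δ ≤-refl 1≤ν 2ν≤2^s 0<M′ fine
        (decay≤ {n} a b L n≤ 1≤ (<⇒≤ 0<δ) (Σ1/p²-nonNeg (primesUpTo (ν ℕ.+ ν))) (Σ1/p²≤θ (ν ℕ.+ ν) (ℕₚ.+-mono-≤ 1≤ν 1≤ν)))
      0≤t : 0# ≤ proj₁ cover
      0≤t = ≤-trans (total-len-nonNeg (proj₁ (proj₂ (proj₁ (proj₂ cover))))) (proj₂ (proj₂ (proj₂ (proj₁ (proj₂ cover)))))
      missed : ∀ {α} → α ∈ [0,1⟩ × ¬ Good η L R α → α ∈ Missed (ν ℕ.+ ν) R
      missed (α∈ , bad) = α∈ , λ (h , 1≤h , h≤2ν , hit) → bad (h , 1≤h , ≤-trans (fromℕ-mono h≤2ν) 2ν≤X , hit)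
      bound : ∀ t → 0# ≤ t → t * (fromℕ ν * δ) ≤ fromℕ 8 * (fromℕ s * fromℕ (suc (suc (3 ℕ.* w)))) →
              t * E ≤ fromℕ (constant a b) * (fromℕ L * fromℕ L)
      bound t 0≤t le = begin
        t * E                                                      ≈⟨ *-congˡ Xδ≈E ⟨
        t * (X * δ)                                                ≤⟨ *-monoˡ-≤ 0≤t (*-monoʳ-≤ (<⇒≤ 0<δ) X≤4ν) ⟩
        t * (fromℕ 4 * fromℕ ν * δ)                                ≈⟨ solve 4 (λ f t v d → t :* (f :* v :* d) := f :* (t :* (v :* d))) refl (fromℕ 4) t (fromℕ ν) δ ⟩
        fromℕ 4 * (t * (fromℕ ν * δ))                              ≤⟨ *-monoˡ-≤ (fromℕ-nonNeg 4) le ⟩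
        fromℕ 4 * (fromℕ 8 * (fromℕ s * fromℕ (suc (suc (3 ℕ.* w))))) ≈⟨ trans (sym (*-assoc _ _ _)) (*-cong (sym (fromℕ-* 4 8)) (sym (fromℕ-* s (suc (suc (3 ℕ.* w)))))) ⟩
        fromℕ 32 * fromℕ (s ℕ.* suc (suc (3 ℕ.* w)))               ≤⟨ *-monoˡ-≤ (fromℕ-nonNeg 32) (fromℕ-mono count) ⟩
        fromℕ 32 * fromℕ (C ℕ.* (L ℕ.* L))                         ≈⟨ *-congˡ (trans (fromℕ-* C (L ℕ.* L)) (*-congˡ (fromℕ-* L L))) ⟩
        fromℕ 32 * (fromℕ C * (fromℕ L * fromℕ L))                 ≈⟨ trans (sym (*-assoc _ _ _)) (*-congʳ (sym (fromℕ-* 32 C))) ⟩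
        fromℕ (32 ℕ.* C) * (fromℕ L * fromℕ L)                     ∎
        where
        open ≤-Reasoning
        C = (1 ℕ.+ b) ℕ.* (14 ℕ.+ 3 ℕ.* (a ℕ.+ (a ℕ.+ b)))

  -- The exceptional set is null

  Σ-geometric : ∀ n → Σ< n (λ k → inv 2 ^ suc k) ≤ 1#
  Σ-geometric n = ≤-by (^-nonNeg n (inv-nonNeg 1)) (exact n)
    where
    exact : ∀ n → Σ< n (λ k → inv 2 ^ suc k) + inv 2 ^ n ≈ 1#
    exact zero    = +-identityˡ 1#
    exact (suc n) = begin
      Σ< (suc n) (λ k → inv 2 ^ suc k) + inv 2 ^ suc n          ≈⟨ +-congʳ (Σ-last n (λ k → inv 2 ^ suc k)) ⟩
      Σ< n (λ k → inv 2 ^ suc k) + inv 2 ^ suc n + inv 2 ^ suc n ≈⟨ solve 3 (λ S h z → S :+ h :* z :+ h :* z := S :+ (h :* :2) :* z) refl _ (inv 2) (inv 2 ^ n) ⟩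
      Σ< n (λ k → inv 2 ^ suc k) + inv 2 * fromℕ 2 * inv 2 ^ n  ≈⟨ +-congˡ (trans (*-congʳ (*-inverseˡ (fromℕ-pos {2} (s≤s z≤n)))) (*-identityˡ _)) ⟩
      Σ< n (λ k → inv 2 ^ suc k) + inv 2 ^ n                    ≈⟨ exact n ⟩
      1#                                                        ∎
      where open ≈-Reasoning

  coverable⇒ℙ≈0 : ∀ {S} → (∀ {ε} → 0# < ε → CoverableWithin (S ∩ [0,1⟩) ε) → ℙ S ≈ 0#
  coverable⇒ℙ≈0 {S} covers = antisym ℙ≤0 (proj₂ (proj₂ (ℙ-infimum S)) 0# λ t (_ , _ , _ , _ , short) → short 0)
    where
    ℙ≤0 : ℙ S ≤ 0#
    ℙ≤0 with total (ℙ S) 0#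
    ... | inj₁ le = le
    ... | inj₂ 0≤ℙ with em {ℙ S ≤ 0#}
    ...   | yes le = le
    ...   | no  ≰0 = contradiction (proj₁ (proj₂ (ℙ-infimum S)) _ (covers (*-pos 0<ℙ 0<inv2))) (<⇒≱ half<)
      where
      0<ℙ : 0# < ℙ S
      0<ℙ = ≰⇒> ≰0
      0<inv2 : 0# < inv 2
      0<inv2 = ⁻¹-pos (fromℕ-pos {2} (s≤s z≤n))
      half< : ℙ S * inv 2 < ℙ S
      half< = ≰⇒> λ le → <⇒≱ (*-pos 0<ℙ 0<inv2) (≤-respˡ-≈ (trans (+-congʳ double) (solve 1 (λ x → :2 :* x :- x := x) refl (ℙ S * inv 2)))
        (≤-respʳ-≈ (-‿inverseʳ (ℙ S * inv 2)) (+-monoˡ-≤ (- (ℙ S * inv 2)) le)))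
        where
        double : ℙ S ≈ fromℕ 2 * (ℙ S * inv 2)
        double = trans (x≈x*y⁻¹*y (fromℕ-pos {2} (s≤s z≤n))) (*-comm _ _)

  module _ {A B : Carrier} (0<A : 0# < A) (0<B : 0# < B) (R : ℕ → Subset)
           (large : ∀ L → (B ^ L) ⁻¹ ≤ ℙ (R L)) (simple : ∀ L → IsDisjointUnionOfIntervals≤ (A ^ L) (R L)) where

    -- Integer bases above A and B, so that grid sizes and exponents are natural numbers; `suc`
    -- makes them positive.
    a b : ℕ
    a = suc (proj₁ (above A))
    b = suc (proj₁ (above B))

    base≤ : ∀ {x} → x ≤ fromℕ (suc (proj₁ (above x)))
    base≤ {x} = ≤-trans (proj₂ (above x)) (fromℕ-mono (ℕₚ.n≤1+n (proj₁ (above x))))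

    power≤ : ∀ {x} → 0# < x → ∀ L → x ^ L ≤ fromℕ (suc (proj₁ (above x)) ℕ.^ L)
    power≤ {x} 0<x L = ≤-respʳ-≈ (sym (fromℕ-^ (suc (proj₁ (above x))) L)) (^-mono-≤ L (<⇒≤ 0<x) base≤)

    0<ℙ : ∀ L → 0# < ℙ (R L)
    0<ℙ L = <-≤-trans (⁻¹-pos (^-pos L 0<B)) (large L)

    1≤b^Lℙ : ∀ L → 1# ≤ fromℕ (b ℕ.^ L) * ℙ (R L)
    1≤b^Lℙ L = ≤-trans (≤-respˡ-≈ (*-inverseʳ _ (>⇒≉0 (^-pos L 0<B))) (*-monoˡ-≤ (^-nonNeg L (<⇒≤ 0<B)) (large L)))
      (*-monoʳ-≤ (<⇒≤ (0<ℙ L)) (power≤ 0<B L))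

    -- One index k is both the precision η = 1/(k+1) and the threshold for L. Enlarging k serves
    -- both purposes, so these countably many sets exhaust the exceptional set.
    AlwaysBad : ℕ → Subset
    AlwaysBad k α = α ∈ [0,1⟩ × (∀ L → k ℕ.≤ L → ¬ Good (inv (suc k)) L (R L) α)

    -- These α are bad at every L ≥ k, so a single such L, chosen after ε, is enough: the bad set at
    -- that level has length at most ε once (1+η)^L outgrows L²/ε by a constant factor.
    alwaysBadCover : ∀ k {ε} → 0# < ε → FiniteCover (AlwaysBad k) ε
    alwaysBadCover k {ε} 0<ε = FiniteCover-⊆ (λ (α∈ , bad) → α∈ , bad L k≤L) t≤ε (proj₁ (proj₂ cover))
      where
      η = inv (suc k)
      0<η : 0# < η
      0<η = ⁻¹-pos (fromℕ-pos {suc k} (s≤s z≤n))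
      η≤1 : η ≤ 1#
      η≤1 = ≤-respˡ-≈ (*-identityˡ η) (x≤y*z⇒x*y⁻¹≤z (fromℕ-pos {suc k} (s≤s z≤n))
        (≤-respʳ-≈ (sym (*-identityʳ _)) (≤-by (fromℕ-nonNeg k) refl)))
      c = fromℕ (constant a b)
      -- The first summand yields cL² ≤ εE, the second the condition 8 ≤ E of `levelCover`.
      C = c * ε ⁻¹ + fromℕ 8
      chosen = growth 0<η C k
      L = proj₁ chosen
      E = (1# + η) ^ L
      L² = fromℕ L * fromℕ L
      k≤L : k ℕ.≤ L
      k≤L = proj₁ (proj₂ chosen)
      1≤L : 1 ℕ.≤ L
      1≤L = proj₁ (proj₂ (proj₂ chosen))
      CL²≤E : C * L² ≤ E
      CL²≤E = proj₂ (proj₂ (proj₂ chosen))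
      0≤cε⁻¹ : 0# ≤ c * ε ⁻¹
      0≤cε⁻¹ = *-nonNeg (fromℕ-nonNeg (constant a b)) (⁻¹-nonNeg 0<ε)
      8≤E : fromℕ 8 ≤ E
      8≤E = begin
        fromℕ 8                           ≈⟨ *-identityʳ _ ⟨
        fromℕ 8 * 1#                      ≤⟨ *-mono-≤ (fromℕ-nonNeg 8) (0≤x*x _) (≤-by 0≤cε⁻¹ (+-comm _ _)) 1≤L² ⟩
        C * L²                            ≤⟨ CL²≤E ⟩
        E                                 ∎
        where
        open ≤-Reasoning
        1≤L² : 1# ≤ L²
        1≤L² = ≤-respʳ-≈ (fromℕ-* L L) (≤-respˡ-≈ (+-identityʳ 1#) (fromℕ-mono {1} (ℕₚ.*-mono-≤ 1≤L 1≤L)))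
      0<E : 0# < E
      0<E = ^-pos L (+-pos 0<1 (<⇒≤ 0<η))
      union = unionOfIntervals (simple L)
      cover : ∃ λ t → FiniteCover (λ α → α ∈ [0,1⟩ × ¬ Good η L (R L) α) t × t * E ≤ c * L²
      cover = levelCover (proj₂ (proj₂ union)) (≤-trans (proj₁ (proj₂ union)) (power≤ 0<A L)) (1≤b^Lℙ L) (0<ℙ L)
        (s≤s z≤n) (s≤s z≤n) 1≤L (<⇒≤ 0<η) η≤1 8≤E
      cL²≤Eε : c * L² ≤ E * ε
      cL²≤Eε = begin
        c * L²                 ≈⟨ *-congʳ (x≈x*y⁻¹*y 0<ε) ⟩
        c * ε ⁻¹ * ε * L²      ≈⟨ solve 3 (λ x e l → x :* e :* l := x :* l :* e) refl (c * ε ⁻¹) ε L² ⟩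
        c * ε ⁻¹ * L² * ε      ≤⟨ *-monoʳ-≤ (<⇒≤ 0<ε) (≤-trans (*-monoʳ-≤ (0≤x*x _) (≤-by (fromℕ-nonNeg 8) refl)) CL²≤E) ⟩
        E * ε                  ∎
        where open ≤-Reasoning
      t≤ε : proj₁ cover ≤ ε
      t≤ε = *-cancelˡ-≤ 0<E (≤-respˡ-≈ (*-comm _ _) (≤-trans (proj₂ (proj₂ cover)) cL²≤Eε))

    Q : Subset
    Q α = ∀ (η : Carrier) → 0# < η → InfinitelyMany (λ L → Good η L (R L) α)

    exceptional⊆ : ∀ α → α ∈ ([0,1⟩ ∖ Q) ∩ [0,1⟩ → ∃ λ k → α ∈ AlwaysBad k
    exceptional⊆ α ((α∈ , ¬Q) , _) with em {∃ λ k → α ∈ AlwaysBad k}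
    ... | yes found = found
    ... | no  none  = contradiction often ¬Q
      where
      often : α ∈ Q
      -- k is at least 1/η, so that 1/(k+1) ≤ η, and at least N, so that every L ≥ k is beyond N.
      often η 0<η N with em {∃ λ L → k ℕ.≤ L × Good (inv (suc k)) L (R L) α}
        where k = proj₁ (above (η ⁻¹)) ℕ.+ N
      ... | no  never = contradiction (_ , α∈ , λ L k≤L good → never (L , k≤L , good)) none
      ... | yes (L , k≤L , h , 1≤h , h≤ , hit) = L , ℕₚ.≤-trans (ℕₚ.m≤n+m N n) k≤L , h , 1≤h , ≤-trans h≤ weaken , hit
        where
        n = proj₁ (above (η ⁻¹))
        k = n ℕ.+ N
        inv≤η : inv (suc k) ≤ η
        inv≤η = ≤-respˡ-≈ (*-identityˡ _) (x≤y*z⇒x*y⁻¹≤z (fromℕ-pos {suc k} (s≤s z≤n))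
          (≤-respˡ-≈ (*-inverseˡ 0<η) (*-monoʳ-≤ (<⇒≤ 0<η) (≤-trans (proj₂ (above (η ⁻¹))) (fromℕ-mono (ℕₚ.m≤n⇒m≤1+n (ℕₚ.m≤m+n n N)))))))
        weaken : (1# + inv (suc k)) ^ L * (ℙ (R L)) ⁻¹ ≤ (1# + η) ^ L * (ℙ (R L)) ⁻¹
        weaken = *-monoʳ-≤ (⁻¹-nonNeg (0<ℙ L)) (^-mono-≤ L (+-nonNeg 0≤1 (inv-nonNeg k)) (+-monoʳ-≤ 1# inv≤η))

    almostAll : ForAlmostAll Q
    almostAll = coverable⇒ℙ≈0 λ {ε} 0<ε → coverable AlwaysBad exceptional⊆
      (λ k → alwaysBadCover k (*-pos 0<ε (^-pos (suc k) (⁻¹-pos (fromℕ-pos {2} (s≤s z≤n))))))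
      (λ n → ≤-respˡ-≈ (sym (Σ-* n ε (λ k → inv 2 ^ suc k))) (≤-respʳ-≈ (*-identityʳ ε) (*-monoˡ-≤ (<⇒≤ 0<ε) (Σ-geometric n))))

theorem4 : ExcludedMiddle 0ℓ → (ℝ : CompleteOrderedField) →
  let open CompleteOrderedField ℝ
      open UnitInterval ℝ
  in (A B : Carrier) → 0# < A → 0# < B →
     (R : ℕ → Subset) →
     (∀ L → R L ⊆ [0,1⟩) →
     (∀ L → IsMeasurable (R L)) →
     (∀ L → (B ^ L) ⁻¹ ≤ ℙ (R L)) →
     (∀ L → IsDisjointUnionOfIntervals≤ (A ^ L) (R L)) →
     ForAlmostAll (λ α →
       ∀ (η : Carrier) → 0# < η →
       InfinitelyMany (λ L →
         ∃ λ (h : ℕ) →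
           1 ℕ.≤ h ×
           fromℕ h ≤ ((1# + η) ^ L) * (ℙ (R L)) ⁻¹ ×
           (∃ λ y → IsFractionalPart (fromℕ h * α) y × y ∈ R L)))
theorem4 em ℝ A B 0<A 0<B R _ _ large simple = Approximation.almostAll em ℝ 0<A 0<B R large simple
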